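{- Let $n,t$ be integers with $0\le t\le n-4$, and let $\mathcal{E}(n,t)$ be the set of trees of order $n$ with exactly $t$ vertices of degree two. Let $T\in\mathcal{E}(n,t)$ have minimum Mostar index among all trees in $\mathcal{E}(n,t)$. (i) If $n-t=5$, then $T\cong F_{n,0,0}$. If $n-t$ is odd and at least $7$, then $T\cong F_{n,\lceil\frac{n-t-5}{4}\rceil-1,\lfloor\frac{n-t-5}{4}\rfloor+1}$. (ii) If $n-t$ is even, then $T\cong C_{n,\lceil\frac{n-t}{4}-\frac12\rceil,\lfloor\frac{n-t}{4}-\frac12\rfloor}$.
   Context: For a connected simple graph $G$, the Mostar index is $Mo(G)=\sum_{uv\in E(G)}|n_u-n_v|$, where for an edge $e=uv$, $n_u$ is the number of vertices of $G$ closer (in graph distance) to $u$ than to $v$, and $n_v$ is the number of vertices closer to $v$ than to $u$. The order of a graph is its number of vertices. For integers $a,b\ge 0$ with $2(a+b)\le n-1$, $C_{n,a,b}$ is the tree obtained from the path $P_{n-a-b}=v_1v_2\dots v_{n-a-b}$ by attaching a pendent vertex $u_i$ to $v_i$ for each $i$ with $2\le i\le a+1$ and each $i$ with $n-a-2b\le i\le n-a-b-1$. In particular $C_{n,0,0}=P_n$, the path on $n$ vertices. For integers $a,b\ge 0$ with $2(a+b)\le n-5$, $F_{n,a,b}$ is the tree obtained from the path $P_{n-a-b-2}=v_1v_2\cdots v_{n-a-b-2}$ by attaching a pendent vertex $u_1$ to $v_2$, and then attaching a pendent vertex $u_i$ to $v_i$ for each $i$ with $2\le i\le a+2$ and each $i$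 with $n-a-2b-2\le i\le n-a-b-3$ (so $v_2$ receives two pendent vertices, $u_1$ and $u_2$). -}

module Defs where

open import Data.Empty using (⊥)
open import Data.Fin using (Fin; toℕ; fromℕ; fromℕ<; inject₁) renaming (zero to fzero; suc to fsuc)
import Data.Fin as Fin
import Data.Fin.Properties as Fin
open import Data.List using (List; length; filter; map; allFin; cartesianProduct)
open import Data.Nat using (ℕ; zero; suc; _+_; _*_; _∸_; _/_; _≤_; z≤n; s≤s; ∣_-_∣)
open import Data.Nat.ListAction using (sum)
open import Data.Nat.Properties
open import Data.Nat.Tactic.RingSolver using (solve-∀)
open import Data.Product using (Σ; ∃; _×_; _,_; proj₁; proj₂)
open import Data.Sum using (_⊎_; inj₁; inj₂; [_,_]′; swap)
open import Data.Unit using (⊤)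
open import Function.Base using (_∘_)
open import Function.Bundles using (_↔_; _⇔_; Inverse)
open import Function.Definitions using (Injective)
open import Level using (0ℓ)
open import Relation.Binary using (Rel; Symmetric; Irreflexive) renaming (Decidable to Decidable₂)
open import Relation.Binary.PropositionalEquality using (_≡_; refl; sym; cong; subst)
open import Relation.Nullary using (¬_; Dec; yes; no)
open import Relation.Nullary.Decidable using (_×-dec_; _⊎-dec_)
import Relation.Nullary.Decidable as Dec
open import Relation.Unary using (Pred; Decidable)

record Graph (V : Set) : Set₁ where
  infix 4 _~_ _~?_
  field
    _~_    : Rel V 0ℓ
    ~-sym  : Symmetric _~_
    ~-irr  : Irreflexive _≡_ _~_
    _~?_   : Decidable₂ _~_

infix 4 _≅_

_≅_ : {V W : Set} → Graph V → Graph W → Set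
_≅_ {V} {W} G H = Σ (V ↔ W) λ f →
  ∀ u v → Graph._~_ G u v ⇔ Graph._~_ H (Inverse.to f u) (Inverse.to f v)

module _ {V : Set} (G : Graph V) where
  open Graph G

  data Walk : ℕ → V → V → Set where
    []  : ∀ {v} → Walk 0 v v
    _∷_ : ∀ {k u v w} → u ~ v → Walk k v w → Walk (suc k) u w

  Connected : Set
  Connected = ∀ u v → ∃ λ k → Walk k u v

  -- A cycle c₀ c₁ … c₍ₗ₊₂₎ c₀ of length l + 3 with pairwise distinct vertices.
  record Cycle : Set where
    field
      l         : ℕ
      c         : Fin (3 + l) → V
      injective : Injective _≡_ _≡_ c
      steps     : ∀ (i : Fin (2 + l)) → c (inject₁ i) ~ c (fsuc i)
      closes    : c (fromℕ (2 + l)) ~ c fzero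

  Acyclic : Set
  Acyclic = ¬ Cycle

least : {P : Pred ℕ 0ℓ} → Decidable P → ∀ k → P k →
        ∃ λ d → P d × (∀ j → P j → d ≤ j)
least P? zero    p = 0 , p , λ _ _ → z≤n
least {P} P? (suc k) p with P? 0
... | yes p₀ = 0 , p₀ , λ _ _ → z≤n
... | no ¬p₀ with least (P? ∘ suc) k p
...   | d , pd , min = suc d , pd , min′
  where
  min′ : ∀ j → P j → suc d ≤ j
  min′ zero    q with () ← ¬p₀ q
  min′ (suc j) q = s≤s (min j q)

count : ∀ {n} {P : Pred (Fin n) 0ℓ} → Decidable P → ℕ
count {n} P? = length (filter P? (allFin n))

module _ {n : ℕ} (G : Graph (Fin n)) where
  open Graph G

  walk? : ∀ k u v → Dec (Walk G k u v)
  walk? zero    u v = Dec.map′ (λ { refl → [] }) (λ { [] → refl }) (u Fin.≟ v)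
  walk? (suc k) u v = Dec.map′ (λ { (_ , e , p) → e ∷ p }) (λ { (e ∷ p) → _ , e , p })
                        (Fin.any? λ x → (u ~? x) ×-dec walk? k x v)

  degree : Fin n → ℕ
  degree v = count (v ~?_)

  #degreeTwo : ℕ
  #degreeTwo = count λ v → degree v ≟ 2

  -- Each edge uv is listed once, with u < v.
  edges : List (Fin n × Fin n)
  edges = filter (λ (u , v) → (u Fin.<? v) ×-dec (u ~? v))
                 (cartesianProduct (allFin n) (allFin n))

  module _ (conn : Connected G) where

    dist : Fin n → Fin n → ℕ
    dist u v = proj₁ (least (λ k → walk? k u v) (proj₁ (conn u v)) (proj₂ (conn u v)))

    #closer : Fin n → Fin n → ℕ
    #closer u v = count λ w → dist w u <? dist w v

    mostar : ℕ
    mostar = sum (map (λ (u , v) → ∣ #closer u v - #closer v u ∣) edges)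

record Tree (n : ℕ) : Set₁ where
  field
    graph     : Graph (Fin n)
    connected : Connected graph
    acyclic   : Acyclic graph

Mo : ∀ {n} → Tree n → ℕ
Mo T = mostar (Tree.graph T) (Tree.connected T)

ℰ : ∀ n → ℕ → Pred (Tree n) 0ℓ
ℰ n t T = #degreeTwo (Tree.graph T) ≡ t

path : ∀ m → Graph (Fin m)
path m = record
  { _~_   = λ i j → suc (toℕ i) ≡ toℕ j ⊎ suc (toℕ j) ≡ toℕ i
  ; ~-sym = swap
  ; ~-irr = λ { refl (inj₁ e) → 1+n≢n e ; refl (inj₂ e) → 1+n≢n e }
  ; _~?_  = λ i j → (suc (toℕ i) ≟ toℕ j) ⊎-dec (suc (toℕ j) ≟ toℕ i)
  }

-- Each u : U becomes a new pendent vertex inj₂ u, attached to f u.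
attach : ∀ {m} {U : Set} → Graph (Fin m) → (U → Fin m) → Graph (Fin m ⊎ U)
attach {m} {U} G f = record
  { _~_   = _≈_
  ; ~-sym = λ {x} {y} → ≈-sym x y
  ; ~-irr = λ {x} {y} → ≈-irr x y
  ; _~?_  = _≈?_
  }
  where
  open Graph G

  _≈_ : Rel (Fin m ⊎ U) 0ℓ
  inj₁ x ≈ inj₁ y = x ~ y
  inj₁ x ≈ inj₂ u = x ≡ f u
  inj₂ u ≈ inj₁ x = x ≡ f u
  inj₂ _ ≈ inj₂ _ = ⊥

  ≈-sym : ∀ x y → x ≈ y → y ≈ x
  ≈-sym (inj₁ _) (inj₁ _) e = ~-sym e
  ≈-sym (inj₁ _) (inj₂ _) e = e
  ≈-sym (inj₂ _) (inj₁ _) e = e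

  ≈-irr : ∀ x y → x ≡ y → ¬ (x ≈ y)
  ≈-irr (inj₁ _) (inj₁ _) refl e = ~-irr refl e

  _≈?_ : Decidable₂ _≈_
  inj₁ x ≈? inj₁ y = x ~? y
  inj₁ x ≈? inj₂ u = x Fin.≟ f u
  inj₂ u ≈? inj₁ x = x Fin.≟ f u
  inj₂ _ ≈? inj₂ _ = no λ ()

-- The path vertex v_i of P_m, with the 1-based numbering v_1, …, v_m.
vertex : ∀ {m} i → .(1 ≤ i) → .(i ≤ m) → Fin m
vertex (suc i) _ i<m = fromℕ< i<m

private
  C-left : ∀ n a b → 2 * (a + b) + 1 ≤ n → (j : Fin a) → 2 + toℕ j ≤ n ∸ a ∸ b
  C-left n a b h j = begin
    2 + toℕ j                 ≤⟨ s≤s (Fin.toℕ<n j) ⟩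
    1 + a                     ≤⟨ m+n≤o⇒m≤o∸n (1 + a) (≤-trans lem h) ⟩
    n ∸ (a + b)               ≡⟨ ∸-+-assoc n a b ⟨
    n ∸ a ∸ b                 ∎
    where
    open ≤-Reasoning
    eq : ∀ a b → 1 + a + (a + b) + b ≡ 2 * (a + b) + 1
    eq = solve-∀
    lem : 1 + a + (a + b) ≤ 2 * (a + b) + 1
    lem = subst (1 + a + (a + b) ≤_) (eq a b) (m≤m+n _ b)

  C-room : ∀ n a b → 2 * (a + b) + 1 ≤ n → 1 + 2 * b ≤ n ∸ a
  C-room n a b h = m+n≤o⇒m≤o∸n (1 + 2 * b) (≤-trans lem h)
    where
    eq : ∀ a b → 1 + 2 * b + a + a ≡ 2 * (a + b) + 1
    eq = solve-∀
    lem : 1 + 2 * b + a ≤ 2 * (a + b) + 1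
    lem = subst (1 + 2 * b + a ≤_) (eq a b) (m≤m+n _ a)

  right≥1 : ∀ m b j → 1 + 2 * b ≤ m → 1 ≤ m ∸ 2 * b + j
  right≥1 m b j h = ≤-trans (m+n≤o⇒m≤o∸n 1 h) (m≤m+n _ j)

  right≤ : ∀ m b (j : Fin b) → 1 + 2 * b ≤ m → m ∸ 2 * b + toℕ j ≤ m ∸ b
  right≤ m b j h = m+n≤o⇒m≤o∸n (m ∸ 2 * b + toℕ j) (begin
    m ∸ 2 * b + toℕ j + b     ≤⟨ +-monoˡ-≤ b (+-monoʳ-≤ (m ∸ 2 * b) (<⇒≤ (Fin.toℕ<n j))) ⟩
    m ∸ 2 * b + b + b         ≡⟨ eq (m ∸ 2 * b) b ⟩
    m ∸ 2 * b + 2 * b         ≡⟨ m∸n+n≡m (<⇒≤ h) ⟩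
    m                         ∎)
    where
    open ≤-Reasoning
    eq : ∀ x b → x + b + b ≡ x + 2 * b
    eq = solve-∀

-- The proof argument is the standing condition 2(a+b) ≤ n − 1.  The two
-- families of pendent vertices sit at v_i for 2 ≤ i ≤ a+1 and for
-- n−a−2b ≤ i ≤ n−a−b−1, the index j counting from the lower end.
C : ∀ n a b → .(2 * (a + b) + 1 ≤ n) → Graph (Fin (n ∸ a ∸ b) ⊎ (Fin a ⊎ Fin b))
C n a b h = attach (path (n ∸ a ∸ b)) [ left , right ]′
  where
  left : Fin a → Fin (n ∸ a ∸ b)
  left j = vertex (2 + toℕ j) (s≤s z≤n) (C-left n a b h j)

  right : Fin b → Fin (n ∸ a ∸ b)
  right j = vertex (n ∸ a ∸ 2 * b + toℕ j)
                   (right≥1 (n ∸ a) b (toℕ j) (C-room n a b h))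
                   (right≤ (n ∸ a) b j (C-room n a b h))

private
  F-left : ∀ n a b → 2 * (a + b) + 5 ≤ n → (j : Fin (suc a)) → 2 + toℕ j ≤ n ∸ a ∸ b ∸ 2
  F-left n a b h j = begin
    2 + toℕ j                 ≤⟨ s≤s (Fin.toℕ<n j) ⟩
    2 + a                     ≤⟨ m+n≤o⇒m≤o∸n (2 + a) (≤-trans lem h) ⟩
    n ∸ (a + b + 2)           ≡⟨ ∸-+-assoc n (a + b) 2 ⟨
    n ∸ (a + b) ∸ 2           ≡⟨ cong (_∸ 2) (∸-+-assoc n a b) ⟨
    n ∸ a ∸ b ∸ 2             ∎
    where
    open ≤-Reasoning
    eq : ∀ a b → 2 + a + (a + b + 2) + (1 + b) ≡ 2 * (a + b) + 5
    eq = solve-∀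
    lem : 2 + a + (a + b + 2) ≤ 2 * (a + b) + 5
    lem = subst (2 + a + (a + b + 2) ≤_) (eq a b) (m≤m+n _ (1 + b))

  F-room : ∀ n a b → 2 * (a + b) + 5 ≤ n → 3 + 2 * b ≤ n ∸ a
  F-room n a b h = m+n≤o⇒m≤o∸n (3 + 2 * b) (≤-trans lem h)
    where
    eq : ∀ a b → 3 + 2 * b + a + (2 + a) ≡ 2 * (a + b) + 5
    eq = solve-∀
    lem : 3 + 2 * b + a ≤ 2 * (a + b) + 5
    lem = subst (3 + 2 * b + a ≤_) (eq a b) (m≤m+n _ (2 + a))

  ∸-swap : ∀ m b c → m ∸ c ∸ b ≡ m ∸ b ∸ c
  ∸-swap m b c rewrite ∸-+-assoc m c b | ∸-+-assoc m b c | +-comm b c = refl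

  F-right≥1 : ∀ m b j → 3 + 2 * b ≤ m → 1 ≤ m ∸ 2 * b ∸ 2 + j
  F-right≥1 m b j h rewrite ∸-swap m 2 (2 * b) =
    right≥1 (m ∸ 2) b j (∸-monoˡ-≤ 2 h)

  F-right≤ : ∀ m b (j : Fin b) → 3 + 2 * b ≤ m → m ∸ 2 * b ∸ 2 + toℕ j ≤ m ∸ b ∸ 2
  F-right≤ m b j h rewrite ∸-swap m 2 (2 * b) | ∸-swap m 2 b =
    right≤ (m ∸ 2) b j (∸-monoˡ-≤ 2 h)

-- The proof argument is the standing condition 2(a+b) ≤ n − 5.  The vertex
-- u_1 is inj₂ (inj₁ tt), sharing v_2 = left fzero with u_2; the others are u_i for 2 ≤ i ≤ a+2 and for
-- n−a−2b−2 ≤ i ≤ n−a−b−3, again counted from the lower end.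
F : ∀ n a b → .(2 * (a + b) + 5 ≤ n) →
    Graph (Fin (n ∸ a ∸ b ∸ 2) ⊎ (⊤ ⊎ (Fin (suc a) ⊎ Fin b)))
F n a b h = attach (path (n ∸ a ∸ b ∸ 2)) [ (λ _ → left fzero) , [ left , right ]′ ]′
  where
  left : Fin (suc a) → Fin (n ∸ a ∸ b ∸ 2)
  left j = vertex (2 + toℕ j) (s≤s z≤n) (F-left n a b h j)

  right : Fin b → Fin (n ∸ a ∸ b ∸ 2)
  right j = vertex (n ∸ a ∸ 2 * b ∸ 2 + toℕ j)
                   (F-right≥1 (n ∸ a) b (toℕ j) (F-room n a b h))
                   (F-right≤ (n ∸ a) b j (F-room n a b h))

⌊_/4⌋ : ℕ → ℕ
⌊ m /4⌋ = m / 4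

⌈_/4⌉ : ℕ → ℕ
⌈ m /4⌉ = (m + 3) / 4

-- Both families are defined only under their standing condition, so
-- "isomorphic to C_{n,a,b}" includes that condition.
IsC : ∀ {V} → Graph V → ℕ → ℕ → ℕ → Set
IsC G n a b = Σ (2 * (a + b) + 1 ≤ n) λ h → G ≅ C n a b h

IsF : ∀ {V} → Graph V → ℕ → ℕ → ℕ → Set
IsF G n a b = Σ (2 * (a + b) + 5 ≤ n) λ h → G ≅ F n a b h

{-# OPTIONS --safe #-}

-- An edge that cuts a tree of order n into parts of sizes x and n − x contributes
-- |n − 2x| ≥ n − 2x to the Mostar index.  Rooting the tree at any vertex therefore gives
-- Mo ≥ 2 loss, where loss is n(n − 1)/2 minus the sum of the distances to the root, with
-- equality when no branch exceeds n/2.  Joining the root of X to the root of Y, as a new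
-- child, gives loss X + loss Y + |X|(|Y| − 1); by induction a branch with p + 1 vertices of
-- degree other than two has 4 loss ≥ p², and 4 loss ≤ p² + 3 forces a caterpillar whose
-- leaves crowd at its far end.
--
-- Walking towards the heaviest branch, one finds either an edge whose two parts differ by
-- at most two, or a vertex all of whose branches are smaller than that.  At such an edge
-- |X|(|Y| − 1) depends on n only, so one has to minimise loss X + loss Y with p + q fixed,
-- which balances p and q as far as parity permits.  At such a vertex, gathering the branches
-- into three groups, none of which exceeds half of the tree, shows that the loss is too
-- large, except for the star with four leaves.
module Submission where

open import Defs renaming ([] to []ʷ; _∷_ to infixr 5 _∷ʷ_)
open import Data.Empty using (⊥; ⊥-elim)
open import Data.Fin using (Fin; toℕ; fromℕ; inject₁; punchIn; punchOut) renaming (zero to fzero; suc to fsuc)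
import Data.Fin as Fin
import Data.Fin.Properties as Fin
open import Data.Fin.Relation.Unary.Top using (‵fromℕ; ‵inject₁) renaming (view to top-view)
open import Data.List using (List; []; _∷_; _++_; length; filter; map; allFin; cartesianProduct)
open import Data.List.Membership.Propositional using (_∉_) renaming (_∈_ to _∈ˡ_)
open import Data.List.Membership.Propositional.Properties
open import Data.List.Membership.Propositional.Properties.WithK using (unique∧set⇒bag)
open import Data.List.Properties using (map-++; map-∘; length-++; length-map; length-tabulate)
open import Data.List.Relation.Binary.BagAndSetEquality using (∼bag⇒↭)
open import Data.List.Relation.Binary.Permutation.Propositional using (_↭_)
open import Data.List.Relation.Binary.Permutation.Propositional.Properties using (↭-length) renaming (map⁺ to ↭-map⁺)
import Data.List.Relation.Unary.All as All
import Data.List.Relation.Unary.AllPairs as AllPairs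
open import Data.List.Relation.Unary.Any using (here; any?)
open import Data.List.Relation.Unary.Unique.Propositional using (Unique)
import Data.List.Relation.Unary.Unique.Propositional.Properties as Unique
open import Data.Nat
open import Data.Nat.Divisibility using (_∣_; divides)
open import Data.Nat.DivMod using (+-distrib-/-∣ʳ; m*n/n≡m; m<n⇒m/n≡0)
open import Data.Nat.ListAction using (sum)
open import Data.Nat.ListAction.Properties using (sum-++; sum-↭)
open import Data.Nat.Properties
open import Data.Nat.Tactic.RingSolver using (solve)
open import Data.Product using (Σ; ∃; _×_; _,_; proj₁; proj₂)
open import Data.Sum using (_⊎_; inj₁; inj₂; [_,_]′)
import Data.Sum as Sum
import Data.Sum.Properties as Sum
open import Data.Unit using (⊤; tt)
open import Function.Base using (_∘_; id; const)
open import Function.Bundles using (mk⇔; mk↔ₛ′)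
open import Function.Definitions using (Injective)
open import Level using (0ℓ)
open import Relation.Binary using (DecidableEquality)
open import Relation.Binary.Definitions using (tri<; tri≈; tri>)
open import Relation.Binary.PropositionalEquality hiding ([_])
open import Relation.Nullary using (¬_; Dec; yes; no; contradiction)
open import Relation.Nullary.Decidable using (_×-dec_; _→-dec_; ¬?)
open import Relation.Unary using (Pred; Decidable; _∈_)

-- Rooted trees and their graphs

-- Let `s` be the number of vertices of degree other than two and `σ = s - 2`, which is `p + q` at
-- every edge. By `4 loss ≥ p²`, the two parts at an edge satisfy
-- `8 (loss X + loss Y) ≥ 2p² + 2q² ≥ σ²`, and the proof depends on how closely integers attain
-- this. For even `s` the best surplus over `σ²` is 0 or 4, for odd `s ≥ 7` it is exactly 7. Hence a
-- surplus of 8 refutes the trees centred at a vertex, and in an optimal tree the surplus of 7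
-- leaves each part with `4 loss ≤ p² + 3`. The obstacle is that no branch has `p = 1`, because a
-- vertex at which it branches brings two leaves along. For `s = 5` this excludes the split 1 + 2,
-- and with 0 + 3 the surplus grows to 15; so this case has a sharper bound at a vertex and its own
-- argument at an edge. The same gap at `p = 1` rescues the inequality for three groups when the
-- branches have only two vertices.

infixr 6 _▸_

-- X ▸ Y hangs X below the root of Y: its root is that of Y, and its edges are
-- those of X and Y and the one between the two roots.
data Rooted : Set where
  •   : Rooted
  _▸_ : Rooted → Rooted → Rooted

V : Rooted → Set
V •       = ⊤
V (X ▸ Y) = V X ⊎ V Y

root : ∀ R → V R
root •       = tt
root (X ▸ Y) = inj₂ (root Y)

_≟V_ : ∀ {R} → DecidableEquality (V R)
_≟V_ {•} tt tt = yes refl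
_≟V_ {X ▸ Y} = Sum.≡-dec _≟V_ _≟V_

Adj : ∀ R → V R → V R → Set
Adj •       _        _        = ⊥
Adj (X ▸ Y) (inj₁ x) (inj₁ y) = Adj X x y
Adj (X ▸ Y) (inj₁ x) (inj₂ y) = x ≡ root X × y ≡ root Y
Adj (X ▸ Y) (inj₂ y) (inj₁ x) = x ≡ root X × y ≡ root Y
Adj (X ▸ Y) (inj₂ x) (inj₂ y) = Adj Y x y

Adj-sym : ∀ R x y → Adj R x y → Adj R y x
Adj-sym (X ▸ Y) (inj₁ x) (inj₁ y) a = Adj-sym X x y a
Adj-sym (X ▸ Y) (inj₁ x) (inj₂ y) a = a
Adj-sym (X ▸ Y) (inj₂ y) (inj₁ x) a = a
Adj-sym (X ▸ Y) (inj₂ x) (inj₂ y) a = Adj-sym Y x y a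

Adj-irr : ∀ R x → ¬ Adj R x x
Adj-irr (X ▸ Y) (inj₁ x) = Adj-irr X x
Adj-irr (X ▸ Y) (inj₂ y) = Adj-irr Y y

Adj? : ∀ R x y → Dec (Adj R x y)
Adj? •       _        _        = no λ ()
Adj? (X ▸ Y) (inj₁ x) (inj₁ y) = Adj? X x y
Adj? (X ▸ Y) (inj₁ x) (inj₂ y) = (x ≟V root X) ×-dec (y ≟V root Y)
Adj? (X ▸ Y) (inj₂ y) (inj₁ x) = (x ≟V root X) ×-dec (y ≟V root Y)
Adj? (X ▸ Y) (inj₂ x) (inj₂ y) = Adj? Y x y

graph : ∀ R → Graph (V R)
graph R = record
  { _~_   = Adj R
  ; ~-sym = λ {x} {y} → Adj-sym R x y
  ; ~-irr = λ { {x} refl → Adj-irr R x }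
  ; _~?_  = Adj? R
  }

-- Isomorphisms, reordering of children, and adding a leaf

record Iso {A B : Set} (G : Graph A) (H : Graph B) : Set where
  field
    to      : A → B
    from    : B → A
    to-from : ∀ y → to (from y) ≡ y
    from-to : ∀ x → from (to x) ≡ x
    adj⁺    : ∀ x y → Graph._~_ G x y → Graph._~_ H (to x) (to y)
    adj⁻    : ∀ x y → Graph._~_ H (to x) (to y) → Graph._~_ G x y

  to-injective : ∀ {x y} → to x ≡ to y → x ≡ y
  to-injective {x} {y} e = trans (sym (from-to x)) (trans (cong from e) (from-to y))

open Iso

Iso⇒≅ : ∀ {A B} {G : Graph A} {H : Graph B} → Iso G H → G ≅ H
Iso⇒≅ φ = mk↔ₛ′ (to φ) (from φ) (to-from φ) (from-to φ) , λ u v → mk⇔ (adj⁺ φ u v) (adj⁻ φ u v)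

iso-refl : ∀ {A} {G : Graph A} → Iso G G
iso-refl = record
  { to = id ; from = id ; to-from = λ _ → refl ; from-to = λ _ → refl
  ; adj⁺ = λ _ _ → id ; adj⁻ = λ _ _ → id }

iso-trans : ∀ {A B C} {G : Graph A} {H : Graph B} {K : Graph C} → Iso G H → Iso H K → Iso G K
iso-trans φ ψ = record
  { to = to ψ ∘ to φ ; from = from φ ∘ from ψ
  ; to-from = λ z → trans (cong (to ψ) (to-from φ (from ψ z))) (to-from ψ z)
  ; from-to = λ x → trans (cong (from φ) (from-to ψ (to φ x))) (from-to φ x)
  ; adj⁺ = λ x y → adj⁺ ψ _ _ ∘ adj⁺ φ x y
  ; adj⁻ = λ x y → adj⁻ φ x y ∘ adj⁻ ψ _ _ }

iso-sym : ∀ {A B} {G : Graph A} {H : Graph B} → Iso G H → Iso H G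
iso-sym {G = G} {H} φ = record
  { to = from φ ; from = to φ ; to-from = from-to φ ; from-to = to-from φ
  ; adj⁺ = λ x y e → adj⁻ φ _ _
      (subst₂ (Graph._~_ H) (sym (to-from φ x)) (sym (to-from φ y)) e)
  ; adj⁻ = λ x y e → subst₂ (Graph._~_ H) (to-from φ x) (to-from φ y) (adj⁺ φ _ _ e) }

record RootedIso {A B : Set} (G : Graph A) (x : A) (H : Graph B) (y : B) : Set where
  constructor _,_
  field
    iso    : Iso G H
    rooted : to iso x ≡ y

open RootedIso

rooted-trans : ∀ {A B C} {G : Graph A} {H : Graph B} {K : Graph C} {x y z} →
               RootedIso G x H y → RootedIso H y K z → RootedIso G x K z
rooted-trans φ ψ = iso-trans (iso φ) (iso ψ) , trans (cong (to (iso ψ)) (rooted φ)) (rooted ψ)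

swap-▸ : ∀ X Y → Iso (graph (X ▸ Y)) (graph (Y ▸ X))
swap-▸ X Y = record
  { to = Sum.swap ; from = Sum.swap
  ; to-from = Sum.swap-involutive ; from-to = Sum.swap-involutive
  ; adj⁺ = λ
    { (inj₁ _) (inj₁ _) a → a ; (inj₁ _) (inj₂ _) (p , q) → q , p
    ; (inj₂ _) (inj₁ _) (p , q) → q , p ; (inj₂ _) (inj₂ _) a → a }
  ; adj⁻ = λ
    { (inj₁ _) (inj₁ _) a → a ; (inj₁ _) (inj₂ _) (p , q) → q , p
    ; (inj₂ _) (inj₁ _) (p , q) → q , p ; (inj₂ _) (inj₂ _) a → a }
  }

infix 4 _∼_

-- Equality up to reordering the children of the vertices.
data _∼_ : Rooted → Rooted → Set where
  ∼-refl  : ∀ {X} → X ∼ X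
  ∼-trans : ∀ {X Y Z} → X ∼ Y → Y ∼ Z → X ∼ Z
  ▸-cong  : ∀ {X X′ Y Y′} → X ∼ X′ → Y ∼ Y′ → X ▸ Y ∼ X′ ▸ Y′
  ▸-comm  : ∀ X Y Z → X ▸ Y ▸ Z ∼ Y ▸ X ▸ Z

▸-cong-iso : ∀ {X X′ Y Y′} → RootedIso (graph X) (root X) (graph X′) (root X′) →
             RootedIso (graph Y) (root Y) (graph Y′) (root Y′) →
             RootedIso (graph (X ▸ Y)) (root (X ▸ Y)) (graph (X′ ▸ Y′)) (root (X′ ▸ Y′))
▸-cong-iso {X} {X′} {Y} {Y′} (φ , r) (ψ , s) = record
  { to = Sum.map (to φ) (to ψ) ; from = Sum.map (from φ) (from ψ)
  ; to-from = λ { (inj₁ x) → cong inj₁ (to-from φ x) ; (inj₂ y) → cong inj₂ (to-from ψ y) }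
  ; from-to = λ { (inj₁ x) → cong inj₁ (from-to φ x) ; (inj₂ y) → cong inj₂ (from-to ψ y) }
  ; adj⁺ = λ
    { (inj₁ x) (inj₁ x′) → adj⁺ φ x x′
    ; (inj₁ _) (inj₂ _) (refl , refl) → r , s
    ; (inj₂ _) (inj₁ _) (refl , refl) → r , s
    ; (inj₂ y) (inj₂ y′) → adj⁺ ψ y y′ }
  ; adj⁻ = λ
    { (inj₁ x) (inj₁ x′) → adj⁻ φ x x′
    ; (inj₁ _) (inj₂ _) (p , q) → to-injective φ (trans p (sym r)) , to-injective ψ (trans q (sym s))
    ; (inj₂ _) (inj₁ _) (p , q) → to-injective φ (trans p (sym r)) , to-injective ψ (trans q (sym s))
    ; (inj₂ y) (inj₂ y′) → adj⁻ ψ y y′ }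
  } , cong inj₂ s

▸-comm-iso : ∀ X Y Z → Iso (graph (X ▸ Y ▸ Z)) (graph (Y ▸ X ▸ Z))
▸-comm-iso X Y Z = record
  { to = exchange ; from = exchange ; to-from = involutive ; from-to = involutive
  ; adj⁺ = adj X Y Z
  ; adj⁻ = λ u v a → subst₂ (Adj (X ▸ Y ▸ Z)) (involutive u) (involutive v)
      (adj Y X Z (exchange u) (exchange v) a)
  }
  where
  exchange : ∀ {A B C : Set} → A ⊎ (B ⊎ C) → B ⊎ (A ⊎ C)
  exchange (inj₁ x)        = inj₂ (inj₁ x)
  exchange (inj₂ (inj₁ y)) = inj₁ y
  exchange (inj₂ (inj₂ z)) = inj₂ (inj₂ z)
  involutive : ∀ {A B C : Set} (w : A ⊎ (B ⊎ C)) → exchange (exchange w) ≡ w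
  involutive (inj₁ x)        = refl
  involutive (inj₂ (inj₁ y)) = refl
  involutive (inj₂ (inj₂ z)) = refl
  adj : ∀ X Y Z u v → Adj (X ▸ Y ▸ Z) u v → Adj (Y ▸ X ▸ Z) (exchange u) (exchange v)
  adj X Y Z (inj₁ _)        (inj₁ _)        a          = a
  adj X Y Z (inj₁ _)        (inj₂ (inj₂ _)) (p , refl) = p , refl
  adj X Y Z (inj₂ (inj₁ _)) (inj₂ (inj₁ _)) a          = a
  adj X Y Z (inj₂ (inj₁ _)) (inj₂ (inj₂ _)) (p , refl) = p , refl
  adj X Y Z (inj₂ (inj₂ _)) (inj₁ _)        (p , refl) = p , refl
  adj X Y Z (inj₂ (inj₂ _)) (inj₂ (inj₁ _)) (p , refl) = p , refl
  adj X Y Z (inj₂ (inj₂ _)) (inj₂ (inj₂ _)) a          = a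

∼⇒rooted : ∀ {X Y} → X ∼ Y → RootedIso (graph X) (root X) (graph Y) (root Y)
∼⇒rooted ∼-refl         = iso-refl , refl
∼⇒rooted (∼-trans p q)  = rooted-trans (∼⇒rooted p) (∼⇒rooted q)
∼⇒rooted (▸-cong p q)   = ▸-cong-iso (∼⇒rooted p) (∼⇒rooted q)
∼⇒rooted (▸-comm X Y Z) = ▸-comm-iso X Y Z , refl

∼⇒iso : ∀ {X Y} → X ∼ Y → Iso (graph X) (graph Y)
∼⇒iso p = iso (∼⇒rooted p)

-- H is G with one new leaf, joined to x.
record Pendant {A B : Set} (G : Graph A) (x : A) (H : Graph B) : Set where
  field
    old      : A → B
    new      : B
    view     : ∀ b → (∃ λ a → old a ≡ b) ⊎ new ≡ b
    old-inj  : ∀ {a a′} → old a ≡ old a′ → a ≡ a′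
    old≢new  : ∀ {a} → old a ≢ new
    old-adj⁺ : ∀ {a a′} → Graph._~_ G a a′ → Graph._~_ H (old a) (old a′)
    old-adj⁻ : ∀ {a a′} → Graph._~_ H (old a) (old a′) → Graph._~_ G a a′
    new-adj⁺ : Graph._~_ H (old x) new
    new-adj⁻ : ∀ {a} → Graph._~_ H (old a) new → a ≡ x

open Pendant

module _ {A B A′ B′ : Set} {G : Graph A} {G′ : Graph A′} {x : A} {x′ : A′}
         {H : Graph B} {H′ : Graph B′} where

  transfer : Pendant G x H → Pendant G′ x′ H′ → (A → A′) → B → B′
  transfer p p′ f b = [ (λ (a , _) → old p′ (f a)) , (λ _ → new p′) ]′ (view p b)

  transfer-old : ∀ p p′ f a → transfer p p′ f (old p a) ≡ old p′ (f a)
  transfer-old p p′ f a with view p (old p a)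
  ... | inj₁ (a′ , e) = cong (old p′ ∘ f) (old-inj p e)
  ... | inj₂ e        = ⊥-elim (old≢new p (sym e))

  transfer-new : ∀ p p′ f → transfer p p′ f (new p) ≡ new p′
  transfer-new p p′ f with view p (new p)
  ... | inj₁ (a′ , e) = ⊥-elim (old≢new p e)
  ... | inj₂ e        = refl

  transfer-adj : ∀ p p′ f → f x ≡ x′ →
                 (∀ a b → Graph._~_ G a b → Graph._~_ G′ (f a) (f b)) → ∀ u v →
                 Graph._~_ H u v → Graph._~_ H′ (transfer p p′ f u) (transfer p p′ f v)
  transfer-adj p p′ f refl adj u v e with view p u | view p v
  ... | inj₁ (a , refl) | inj₁ (b , refl) = old-adj⁺ p′ (adj a b (old-adj⁻ p e))
  ... | inj₁ (a , refl) | inj₂ refl with refl ← new-adj⁻ p e = new-adj⁺ p′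
  ... | inj₂ refl | inj₁ (b , refl) with refl ← new-adj⁻ p (Graph.~-sym H e) =
    Graph.~-sym H′ (new-adj⁺ p′)
  ... | inj₂ refl | inj₂ refl = ⊥-elim (Graph.~-irr H refl e)

module _ {A B A′ B′ : Set} {G : Graph A} {G′ : Graph A′} {x : A} {x′ : A′}
         {H : Graph B} {H′ : Graph B′} where

  transfer-inverse : ∀ (p : Pendant G x H) (p′ : Pendant G′ x′ H′) f g → (∀ a → g (f a) ≡ a) →
                     ∀ b → transfer p′ p g (transfer p p′ f b) ≡ b
  transfer-inverse p p′ f g gf b with view p b
  ... | inj₁ (a , refl) = trans (transfer-old p′ p g (f a)) (cong (old p) (gf a))
  ... | inj₂ refl       = transfer-new p′ p g

module _ {A B A′ B′ : Set} {G : Graph A} {G′ : Graph A′} {x : A} {x′ : A′}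
         {H : Graph B} {H′ : Graph B′} where

  -- The step by which isomorphisms are built leaf by leaf: a finite tree from its leaf deletions, a
  -- caterpillar along its path.
  pendant-iso : Pendant G x H → Pendant G′ x′ H′ → RootedIso G x G′ x′ → Iso H H′
  pendant-iso p p′ (φ , refl) = record
    { to = τ ; from = σ ; to-from = transfer-inverse p′ p (from φ) (to φ) (to-from φ)
    ; from-to = στ
    ; adj⁺ = transfer-adj p p′ (to φ) refl (adj⁺ φ)
    ; adj⁻ = λ u v e → subst₂ (Graph._~_ H) (στ u) (στ v)
        (transfer-adj p′ p (from φ) (from-to φ x) (adj⁺ (iso-sym φ)) (τ u) (τ v) e) }
    where
    τ = transfer p p′ (to φ)
    σ = transfer p′ p (from φ)
    στ : ∀ b → σ (τ b) ≡ b
    στ = transfer-inverse p p′ (to φ) (from φ) (from-to φ)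

  pendant-iso-old : ∀ p p′ φ a → to (pendant-iso p p′ φ) (old p a) ≡ old p′ (to (iso φ) a)
  pendant-iso-old p p′ (φ , refl) = transfer-old p p′ (to φ)

  pendant-iso-new : ∀ p p′ φ → to (pendant-iso p p′ φ) (new p) ≡ new p′
  pendant-iso-new p p′ (φ , refl) = transfer-new p p′ (to φ)

pendant-• : ∀ R → Pendant (graph R) (root R) (graph (• ▸ R))
pendant-• R = record
  { old = inj₂ ; new = inj₁ tt
  ; view = λ { (inj₁ tt) → inj₂ refl ; (inj₂ y) → inj₁ (y , refl) }
  ; old-inj = Sum.inj₂-injective ; old≢new = λ ()
  ; old-adj⁺ = id ; old-adj⁻ = id
  ; new-adj⁺ = refl , refl ; new-adj⁻ = proj₂ }

pendant-root : ∀ R → Pendant (graph R) (root R) (graph (R ▸ •))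
pendant-root R = record
  { old = inj₁ ; new = inj₂ tt
  ; view = λ { (inj₂ tt) → inj₂ refl ; (inj₁ y) → inj₁ (y , refl) }
  ; old-inj = Sum.inj₁-injective ; old≢new = λ ()
  ; old-adj⁺ = id ; old-adj⁻ = id
  ; new-adj⁺ = refl , refl ; new-adj⁻ = proj₁ }

pendant-left : ∀ {X x X′} Y (p : Pendant (graph X) x (graph X′)) → old p (root X) ≡ root X′ →
               Pendant (graph (X ▸ Y)) (inj₁ x) (graph (X′ ▸ Y))
pendant-left Y p r = record
  { old = Sum.map₁ (old p) ; new = inj₁ (new p)
  ; view = λ
    { (inj₁ b) → Sum.map (λ (a , e) → inj₁ a , cong inj₁ e) (cong inj₁) (view p b)
    ; (inj₂ y) → inj₁ (inj₂ y , refl) }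
  ; old-inj = λ
    { {inj₁ _} {inj₁ _} e → cong inj₁ (old-inj p (Sum.inj₁-injective e))
    ; {inj₂ _} {inj₂ _} refl → refl }
  ; old≢new = λ { {inj₁ _} e → old≢new p (Sum.inj₁-injective e) ; {inj₂ _} () }
  ; old-adj⁺ = λ
    { {inj₁ _} {inj₁ _} → old-adj⁺ p
    ; {inj₁ _} {inj₂ _} (refl , e) → r , e
    ; {inj₂ _} {inj₁ _} (refl , e) → r , e
    ; {inj₂ _} {inj₂ _} → id }
  ; old-adj⁻ = λ
    { {inj₁ _} {inj₁ _} → old-adj⁻ p
    ; {inj₁ _} {inj₂ _} (e , e′) → old-inj p (trans e (sym r)) , e′
    ; {inj₂ _} {inj₁ _} (e , e′) → old-inj p (trans e (sym r)) , e′
    ; {inj₂ _} {inj₂ _} → id }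
  ; new-adj⁺ = new-adj⁺ p
  ; new-adj⁻ = λ
    { {inj₁ _} a → cong inj₁ (new-adj⁻ p a)
    ; {inj₂ _} (e , _) → ⊥-elim (old≢new p (trans r (sym e))) }
  }

pendant-right : ∀ X {Y y Y′} (p : Pendant (graph Y) y (graph Y′)) → old p (root Y) ≡ root Y′ →
                Pendant (graph (X ▸ Y)) (inj₂ y) (graph (X ▸ Y′))
pendant-right X p r = record
  { old = Sum.map₂ (old p) ; new = inj₂ (new p)
  ; view = λ
    { (inj₂ b) → Sum.map (λ (a , e) → inj₂ a , cong inj₂ e) (cong inj₂) (view p b)
    ; (inj₁ x) → inj₁ (inj₁ x , refl) }
  ; old-inj = λ
    { {inj₂ _} {inj₂ _} e → cong inj₂ (old-inj p (Sum.inj₂-injective e))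
    ; {inj₁ _} {inj₁ _} refl → refl }
  ; old≢new = λ { {inj₂ _} e → old≢new p (Sum.inj₂-injective e) ; {inj₁ _} () }
  ; old-adj⁺ = λ
    { {inj₂ _} {inj₂ _} → old-adj⁺ p
    ; {inj₂ _} {inj₁ _} (e , refl) → e , r
    ; {inj₁ _} {inj₂ _} (e , refl) → e , r
    ; {inj₁ _} {inj₁ _} → id }
  ; old-adj⁻ = λ
    { {inj₂ _} {inj₂ _} → old-adj⁻ p
    ; {inj₂ _} {inj₁ _} (e′ , e) → e′ , old-inj p (trans e (sym r))
    ; {inj₁ _} {inj₂ _} (e′ , e) → e′ , old-inj p (trans e (sym r))
    ; {inj₁ _} {inj₁ _} → id }
  ; new-adj⁺ = new-adj⁺ p
  ; new-adj⁻ = λ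
    { {inj₂ _} a → cong inj₂ (new-adj⁻ p a)
    ; {inj₁ _} (_ , e) → ⊥-elim (old≢new p (trans r (sym e))) }
  }

insert : ∀ R x → ∃ λ S → Σ (Pendant (graph R) x (graph S)) λ p → old p (root R) ≡ root S
insert •       tt       = • ▸ • , pendant-• • , refl
insert (X ▸ Y) (inj₁ x) = let X′ , p , r = insert X x in X′ ▸ Y , pendant-left Y p r , refl
insert (X ▸ Y) (inj₂ y) = let Y′ , p , r = insert Y y in X ▸ Y′ , pendant-right X p r , cong inj₂ r

size : Rooted → ℕ
size •       = 1
size (X ▸ Y) = size X + size Y

unpend : ∀ X Y → ∃ λ R → ∃ λ x → Σ (Pendant (graph R) x (graph (X ▸ Y))) λ p →
         old p (root R) ≡ root (X ▸ Y) × size (X ▸ Y) ≡ suc (size R)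
unpend •         Y = Y , root Y , pendant-• Y , refl , refl
unpend (X₁ ▸ X₂) Y =
  let R , x , p , r , s = unpend X₁ X₂
  in R ▸ Y , inj₁ x , pendant-left Y p r , refl , cong (_+ size Y) s

-- Every finite tree is the graph of a rooted tree

module _ {n : ℕ} (G : Graph (Fin n)) where
  open Graph G

  IsLeaf : Fin n → Fin n → Set
  IsLeaf v u = v ~ u × (∀ w → v ~ w → w ≡ u)

  leaf? : ∀ v u → Dec (IsLeaf v u)
  leaf? v u = (v ~? u) ×-dec Fin.all? λ w → (v ~? w) →-dec (w Fin.≟ u)

  module _ (w : ℕ → Fin n) (step : ∀ k → w k ~ w (suc k)) (nonback : ∀ k → w (suc (suc k)) ≢ w k) where

    Revisited : ℕ → Set
    Revisited j = ∃ λ (i : Fin j) → w (toℕ i) ≡ w j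

    revisited? : ∀ j → Dec (Revisited j)
    revisited? j = Fin.any? λ i → w (toℕ i) Fin.≟ w j

    revisit : ∃ Revisited
    revisit with Fin.pigeonhole {n} {suc n} ≤-refl (w ∘ toℕ)
    ... | i , j , i<j , e = toℕ j , Fin.fromℕ< i<j , trans (cong w (Fin.toℕ-fromℕ< i<j)) e

    -- The first revisit closes a cycle.
    nonbacktracking⇒cycle : Cycle G
    nonbacktracking⇒cycle with least revisited? (proj₁ revisit) (proj₂ revisit)
    ... | j , (i , e) , j-least = go (j ∸ toℕ i) (m+[n∸m]≡n (<⇒≤ (Fin.toℕ<n i)))
      where
      distinct : ∀ a b → a < b → b < j → w a ≢ w b
      distinct a b a<b b<j eq = <⇒≱ b<j
        (j-least b (Fin.fromℕ< a<b , trans (cong w (Fin.toℕ-fromℕ< a<b)) eq))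
      go : ∀ d → toℕ i + d ≡ j → Cycle G
      -- A gap of one would be a loop and a gap of two a step back, so the gap is at least three.
      go 0 eq = contradiction (trans (sym (+-identityʳ _)) eq) (<⇒≢ (Fin.toℕ<n i))
      go 1 eq = ⊥-elim (~-irr (trans e (cong w (trans (sym eq) (+-comm (toℕ i) 1)))) (step (toℕ i)))
      go 2 eq = ⊥-elim (nonback (toℕ i) (sym (trans e (cong w (trans (sym eq) (+-comm (toℕ i) 2))))))
      go (suc (suc (suc l))) eq = record
        { l = l ; c = c ; injective = inj
        ; steps = λ k → subst₂ _~_
            (cong (w ∘ (toℕ i +_)) (sym (Fin.toℕ-inject₁ k)))
            (cong w (sym (+-suc (toℕ i) (toℕ k)))) (step _)
        ; closes = subst₂ _~_ (cong (w ∘ (toℕ i +_)) (sym (Fin.toℕ-fromℕ (2 + l))))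
            (trans (cong w (trans (sym (+-suc _ _)) eq)) (trans (sym e) (cong w (sym (+-identityʳ _)))))
            (step _) }
        where
        c : Fin (3 + l) → Fin n
        c k = w (toℕ i + toℕ k)
        inside : ∀ k → toℕ i + toℕ k < j
        inside k = subst (toℕ i + toℕ k <_) eq (+-monoʳ-< (toℕ i) (Fin.toℕ<n k))
        inj : ∀ {x y} → c x ≡ c y → x ≡ y
        inj {x} {y} eq′ with <-cmp (toℕ x) (toℕ y)
        ... | tri< x<y _ _ = contradiction eq′ (distinct _ _ (+-monoʳ-< (toℕ i) x<y) (inside y))
        ... | tri≈ _ x≡y _ = Fin.toℕ-injective x≡y
        ... | tri> _ _ y<x = contradiction (sym eq′) (distinct _ _ (+-monoʳ-< (toℕ i) y<x) (inside x))

  module _ (no-leaf : ∀ v u → ¬ IsLeaf v u) (v₀ u₀ : Fin n) (e₀ : v₀ ~ u₀) where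

    avoid : ∀ u v → v ~ u → ∃ λ w → v ~ w × w ≢ u
    avoid u v v~u with Fin.any? (λ w → (v ~? w) ×-dec ¬? (w Fin.≟ u))
    ... | yes p = p
    ... | no ¬p = contradiction (v~u , only) (no-leaf v u)
      where
      only : ∀ w → v ~ w → w ≡ u
      only w v~w with w Fin.≟ u
      ... | yes e = e
      ... | no ¬e = contradiction (w , v~w , ¬e) ¬p

    -- The state of the walk is the previous vertex `u` together with the current vertex `v`, so
    -- that `avoid` can forbid the return to `u`.
    arc : ℕ → ∃ λ u → ∃ λ v → v ~ u
    arc zero    = v₀ , u₀ , ~-sym e₀
    arc (suc k) = let u , v , e = arc k ; w , e′ , _ = avoid u v e in v , w , ~-sym e′

    no-leaf⇒cycle : Cycle G
    no-leaf⇒cycle = nonbacktracking⇒cycle (proj₁ ∘ arc) (λ k → ~-sym (proj₂ (proj₂ (arc k))))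
      (λ k → let u , v , e = arc k in proj₂ (proj₂ (avoid u v e)))

leaf-exists : ∀ {n} (G : Graph (Fin (2 + n))) → Connected G → Acyclic G → ∃ λ v → ∃ λ u → IsLeaf G v u
leaf-exists G conn acyc with Fin.any? (λ v → Fin.any? λ u → leaf? G v u)
... | yes p = p
... | no ¬p with conn fzero (fsuc fzero)
...   | _ , e ∷ʷ _ = ⊥-elim (acyc (no-leaf⇒cycle G (λ v u l → ¬p (v , u , l)) fzero _ e))

delete : ∀ {n} → Graph (Fin (suc n)) → Fin (suc n) → Graph (Fin n)
delete G v = record
  { _~_ = λ a b → punchIn v a ~ punchIn v b
  ; ~-sym = ~-sym
  ; ~-irr = λ { refl → ~-irr refl }
  ; _~?_ = λ a b → punchIn v a ~? punchIn v b }
  where open Graph G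

delete-acyclic : ∀ {n} (G : Graph (Fin (suc n))) v → Acyclic G → Acyclic (delete G v)
delete-acyclic G v acyc C = acyc (record
  { l = l ; c = punchIn v ∘ c ; injective = injective ∘ Fin.punchIn-injective v _ _
  ; steps = steps ; closes = closes })
  where open Cycle C

data PunchIn {n} (v : Fin (suc n)) : Fin (suc n) → Set where
  hole  : PunchIn v v
  other : ∀ a → PunchIn v (punchIn v a)

punchIn? : ∀ {n} (v w : Fin (suc n)) → PunchIn v w
punchIn? v w with v Fin.≟ w
... | yes refl = hole
... | no v≢w   = subst (PunchIn v) (Fin.punchIn-punchOut v≢w) (other (punchOut v≢w))

module _ {n} (G : Graph (Fin (suc n))) (v u : Fin (suc n)) (leaf : IsLeaf G v u) where
  open Graph G

  -- A visit to the leaf `v` enters and leaves through `u`, so its two steps can be cut out.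
  bypass : ∀ {k a b} → Walk G k (punchIn v a) (punchIn v b) → ∃ λ k′ → Walk (delete G v) k′ a b
  bypass {a = a} p = go p refl refl
    where
    go : ∀ {k a b x y} → Walk G k x y → x ≡ punchIn v a → y ≡ punchIn v b →
         ∃ λ k′ → Walk (delete G v) k′ a b
    go []ʷ e e′ with refl ← Fin.punchIn-injective v _ _ (trans (sym e) e′) = 0 , []ʷ
    go (_∷ʷ_ {v = z} s p) e e′ with punchIn? v z
    go (s ∷ʷ p) refl e′ | other c = let k , q = go p refl e′ in suc k , s ∷ʷ q
    go (s ∷ʷ []ʷ) e e′ | hole = contradiction (sym e′) (Fin.punchInᵢ≢i v _)
    go (s ∷ʷ s′ ∷ʷ p) e e′ | hole =
      go p (trans (proj₂ leaf _ s′) (trans (sym (proj₂ leaf _ (~-sym s))) e)) e′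

  delete-connected : Connected G → Connected (delete G v)
  delete-connected conn a b = bypass (proj₂ (conn (punchIn v a) (punchIn v b)))

  pendant-delete : ∀ u′ → punchIn v u′ ≡ u → Pendant (delete G v) u′ G
  pendant-delete u′ refl = record
    { old = punchIn v ; new = v
    ; view = λ b → view′ (punchIn? v b)
    ; old-inj = Fin.punchIn-injective v _ _
    ; old≢new = Fin.punchInᵢ≢i v _
    ; old-adj⁺ = id ; old-adj⁻ = id
    ; new-adj⁺ = ~-sym (proj₁ leaf)
    ; new-adj⁻ = λ e → Fin.punchIn-injective v _ _ (proj₂ leaf _ (~-sym e)) }
    where
    view′ : ∀ {b} → PunchIn v b → (∃ λ a → punchIn v a ≡ b) ⊎ v ≡ b
    view′ hole      = inj₂ refl
    view′ (other a) = inj₁ (a , refl)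

tree⇒rooted : ∀ {n} (G : Graph (Fin (suc n))) → Connected G → Acyclic G → ∃ λ R → Iso G (graph R)
tree⇒rooted {zero} G conn acyc = • , record
  { to = λ _ → tt ; from = λ _ → fzero ; to-from = λ _ → refl ; from-to = λ { fzero → refl }
  ; adj⁺ = λ { fzero fzero e → ⊥-elim (Graph.~-irr G refl e) } ; adj⁻ = λ _ _ () }
tree⇒rooted {suc n} G conn acyc with leaf-exists G conn acyc
... | v , u , leaf with punchIn? v u
...   | hole     = ⊥-elim (Graph.~-irr G refl (proj₁ leaf))
...   | other u′ =
  let R , φ = tree⇒rooted (delete G v) (delete-connected G v _ leaf conn) (delete-acyclic G v acyc)
      S , p , _ = insert R (Iso.to φ u′)
  in S , pendant-iso (pendant-delete G v _ leaf u′ refl) p (φ , refl)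

-- The graph of a rooted tree is a tree

walk-map : ∀ {A B} {G : Graph A} {H : Graph B} (f : A → B) →
           (∀ {x y} → Graph._~_ G x y → Graph._~_ H (f x) (f y)) →
           ∀ {k x y} → Walk G k x y → Walk H k (f x) (f y)
walk-map f hom []ʷ      = []ʷ
walk-map f hom (e ∷ʷ p) = hom e ∷ʷ walk-map f hom p

infixr 5 _++ʷ_

_++ʷ_ : ∀ {A} {G : Graph A} {j k x y z} → Walk G j x y → Walk G k y z → Walk G (j + k) x z
[]ʷ      ++ʷ q = q
(e ∷ʷ p) ++ʷ q = e ∷ʷ (p ++ʷ q)

graph-connected : ∀ R → Connected (graph R)
graph-connected • tt tt = 0 , []ʷ
graph-connected (X ▸ Y) (inj₁ x) (inj₁ y) = let k , p = graph-connected X x y in k , walk-map inj₁ id p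
graph-connected (X ▸ Y) (inj₂ x) (inj₂ y) = let k , p = graph-connected Y x y in k , walk-map inj₂ id p
graph-connected (X ▸ Y) (inj₁ x) (inj₂ y) =
  let j , p = graph-connected X x (root X) ; k , q = graph-connected Y (root Y) y
  in j + suc k , walk-map inj₁ id p ++ʷ (refl , refl) ∷ʷ walk-map inj₂ id q
graph-connected (X ▸ Y) (inj₂ y) (inj₁ x) =
  let j , p = graph-connected X (root X) x ; k , q = graph-connected Y y (root Y)
  in k + suc j , walk-map inj₂ id q ++ʷ (refl , refl) ∷ʷ walk-map inj₁ id p

cycle-neighbours : ∀ {A} {G : Graph A} (K : Cycle G) i → let open Cycle K in
                   ∃ λ a → ∃ λ b → a ≢ b × Graph._~_ G (c i) (c a) × Graph._~_ G (c i) (c b)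
cycle-neighbours {G = G} K fzero =
  fsuc fzero , fromℕ _ , (λ ()) , steps fzero , Graph.~-sym G closes
  where open Cycle K
cycle-neighbours {G = G} K (fsuc j) with top-view j
... | ‵fromℕ     = inject₁ (fromℕ _) , fzero , (λ ()) , Graph.~-sym G (steps (fromℕ _)) , closes
  where open Cycle K
... | ‵inject₁ k = inject₁ (inject₁ k) , fsuc (fsuc k) , ne , Graph.~-sym G (steps (inject₁ k)) , steps (fsuc k)
  where
  open Cycle K
  ne : inject₁ (inject₁ k) ≢ fsuc (fsuc k)
  ne e = m≢1+n+m (toℕ k) {1} (trans (sym (trans (Fin.toℕ-inject₁ (inject₁ k)) (Fin.toℕ-inject₁ k)))
    (cong toℕ e))

-- A vertex of a cycle has two distinct neighbours on it, whereas the new leaf has only one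
-- neighbour; so the cycle would already lie in `G`.
pendant-acyclic : ∀ {A B} {G : Graph A} {x} {H : Graph B} → Pendant G x H → Acyclic G → Acyclic H
pendant-acyclic {A} {G = G} {H = H} p acyc K = all-old (λ i → [ id , ⊥-elim ∘ not-new i ]′ (view p (c i)))
  where
  open Cycle K
  not-new : ∀ i → new p ≢ c i
  not-new i e =
    let a , b , a≢b , ea , eb = cycle-neighbours K i
    in a≢b (injective (trans (sym (at-x a (subst (λ w → Graph._~_ H w (c a)) (sym e) ea)))
                             (at-x b (subst (λ w → Graph._~_ H w (c b)) (sym e) eb))))
    where
    at-x : ∀ a → Graph._~_ H (new p) (c a) → old p _ ≡ c a
    at-x a ea with view p (c a)
    ... | inj₁ (o , e′) with refl ← new-adj⁻ p (Graph.~-sym H (subst (Graph._~_ H (new p)) (sym e′) ea)) = e′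
    ... | inj₂ e′ = ⊥-elim (Graph.~-irr H e′ ea)
  all-old : ¬ (∀ i → ∃ λ a → old p a ≡ c i)
  all-old f = acyc (record
    { l = l ; c = proj₁ ∘ f
    ; injective = λ {i} {j} e → injective (trans (sym (proj₂ (f i))) (trans (cong (old p) e) (proj₂ (f j))))
    ; steps = λ i → old-adj⁻ p (subst₂ (Graph._~_ H) (sym (proj₂ (f _))) (sym (proj₂ (f _))) (steps i))
    ; closes = old-adj⁻ p (subst₂ (Graph._~_ H) (sym (proj₂ (f _))) (sym (proj₂ (f _))) closes) })

-- The bound `n` drives the recursion, as `unpend` does not return a subterm.
graph-acyclic : ∀ n R → size R ≤ n → Acyclic (graph R)
graph-acyclic n       •       _ K with () ← Cycle.steps K fzero
graph-acyclic (suc n) (X ▸ Y) h with unpend X Y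
... | R , x , p , _ , s = pendant-acyclic p (graph-acyclic n R (≤-pred (subst (_≤ suc n) s h)))
graph-acyclic zero    (X ▸ Y) h with unpend X Y
... | R , x , p , _ , s with () ← subst (_≤ 0) s h

toFin : ∀ R → V R → Fin (size R)
toFin •       tt = fzero
toFin (X ▸ Y) v  = Fin.join (size X) (size Y) (Sum.map (toFin X) (toFin Y) v)

fromFin : ∀ R → Fin (size R) → V R
fromFin •       _ = tt
fromFin (X ▸ Y) i = Sum.map (fromFin X) (fromFin Y) (Fin.splitAt (size X) i)

fromFin-toFin : ∀ R v → fromFin R (toFin R v) ≡ v
fromFin-toFin •       tt = refl
fromFin-toFin (X ▸ Y) v
  rewrite Fin.splitAt-join (size X) (size Y) (Sum.map (toFin X) (toFin Y) v) with v
... | inj₁ x = cong inj₁ (fromFin-toFin X x)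
... | inj₂ y = cong inj₂ (fromFin-toFin Y y)

toFin-fromFin : ∀ R i → toFin R (fromFin R i) ≡ i
toFin-fromFin •       fzero = refl
toFin-fromFin (X ▸ Y) i = trans (cong (Fin.join (size X) (size Y)) (lemma (Fin.splitAt (size X) i)))
  (Fin.join-splitAt (size X) (size Y) i)
  where
  lemma : ∀ s → Sum.map (toFin X) (toFin Y) (Sum.map (fromFin X) (fromFin Y) s) ≡ s
  lemma (inj₁ x) = cong inj₁ (toFin-fromFin X x)
  lemma (inj₂ y) = cong inj₂ (toFin-fromFin Y y)

iso-connected : ∀ {A B} {G : Graph A} {H : Graph B} → Iso G H → Connected H → Connected G
iso-connected {G = G} φ conn x y =
  let k , p = conn (to φ x) (to φ y)
  in k , subst₂ (Walk G k) (from-to φ x) (from-to φ y) (walk-map (from φ) (adj⁺ (iso-sym φ) _ _) p)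

iso-acyclic : ∀ {A B} {G : Graph A} {H : Graph B} → Iso G H → Acyclic H → Acyclic G
iso-acyclic φ acyc K = acyc (record
  { l = l ; c = to φ ∘ c ; injective = injective ∘ to-injective φ
  ; steps = adj⁺ φ _ _ ∘ steps ; closes = adj⁺ φ _ _ closes })
  where open Cycle K

finGraph : ∀ R → Graph (Fin (size R))
finGraph R = record
  { _~_ = λ i j → Adj R (fromFin R i) (fromFin R j)
  ; ~-sym = Graph.~-sym (graph R)
  ; ~-irr = λ { refl → Adj-irr R _ }
  ; _~?_ = λ i j → Adj? R (fromFin R i) (fromFin R j) }

finGraph-iso : ∀ R → Iso (finGraph R) (graph R)
finGraph-iso R = record
  { to = fromFin R ; from = toFin R ; to-from = fromFin-toFin R ; from-to = toFin-fromFin R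
  ; adj⁺ = λ _ _ → id ; adj⁻ = λ _ _ → id }

rooted⇒tree : ∀ R → Tree (size R)
rooted⇒tree R = record
  { graph     = finGraph R
  ; connected = iso-connected (finGraph-iso R) (graph-connected R)
  ; acyclic   = iso-acyclic (finGraph-iso R) (graph-acyclic _ R ≤-refl) }

-- Sums over vertices and edges

unique-↭ : ∀ {A : Set} {xs ys : List A} → Unique xs → Unique ys →
           (∀ {v} → v ∈ˡ xs → v ∈ˡ ys) → (∀ {v} → v ∈ˡ ys → v ∈ˡ xs) → xs ↭ ys
unique-↭ u u′ f g = ∼bag⇒↭ (unique∧set⇒bag u u′ (mk⇔ f g))

count-list : ∀ {n} {P : Pred (Fin n) 0ℓ} (P? : Decidable P) {xs} → Unique xs →
             (∀ {v} → v ∈ˡ xs → P v) → (∀ {v} → P v → v ∈ˡ xs) → count P? ≡ length xs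
count-list {n} P? u f g = ↭-length (unique-↭ (Unique.filter⁺ P? (Unique.allFin⁺ n)) u
  (g ∘ proj₂ ∘ ∈-filter⁻ P? {xs = allFin n}) (λ v∈ → ∈-filter⁺ P? (∈-allFin _) (f v∈)))

when : ∀ {P : Set} → Dec P → ℕ → ℕ
when (yes _) k = k
when (no _)  _ = 0

when-yes : ∀ {P : Set} (P? : Dec P) {k} → P → when P? k ≡ k
when-yes (yes _) p = refl
when-yes (no ¬p) p = contradiction p ¬p

when-no : ∀ {P : Set} (P? : Dec P) {k} → ¬ P → when P? k ≡ 0
when-no (yes p) ¬p = contradiction p ¬p
when-no (no _)  ¬p = refl

when-cong : ∀ {P Q : Set} (P? : Dec P) (Q? : Dec Q) {k} → (P → Q) → (Q → P) → when P? k ≡ when Q? k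
when-cong (yes p) Q? f g = sym (when-yes Q? (f p))
when-cong (no ¬p) Q? f g = sym (when-no Q? (¬p ∘ g))

sum-filter : ∀ {A : Set} {P : Pred A 0ℓ} (P? : Decidable P) (g : A → ℕ) xs →
             sum (map g (filter P? xs)) ≡ sum (map (λ x → when (P? x) (g x)) xs)
sum-filter P? g []       = refl
sum-filter P? g (x ∷ xs) with P? x
... | yes _ = cong (g x +_) (sum-filter P? g xs)
... | no _  = sum-filter P? g xs

length≡sum : ∀ {A : Set} (xs : List A) → length xs ≡ sum (map (λ _ → 1) xs)
length≡sum []       = refl
length≡sum (_ ∷ xs) = cong suc (length≡sum xs)

count≡sum : ∀ {n} {P : Pred (Fin n) 0ℓ} (P? : Decidable P) →
            count P? ≡ sum (map (λ v → when (P? v) 1) (allFin n))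
count≡sum {n} P? = trans (length≡sum (filter P? (allFin n))) (sum-filter P? (λ _ → 1) (allFin n))

sum-cartesianProduct : ∀ {A B : Set} (h : A × B → ℕ) xs ys →
  sum (map h (cartesianProduct xs ys)) ≡ sum (map (λ x → sum (map (λ y → h (x , y)) ys)) xs)
sum-cartesianProduct h []       ys = refl
sum-cartesianProduct h (x ∷ xs) ys = begin
  sum (map h (map (x ,_) ys ++ cartesianProduct xs ys))
    ≡⟨ cong sum (map-++ h (map (x ,_) ys) _) ⟩
  sum (map h (map (x ,_) ys) ++ map h (cartesianProduct xs ys))
    ≡⟨ sum-++ (map h (map (x ,_) ys)) _ ⟩
  sum (map h (map (x ,_) ys)) + sum (map h (cartesianProduct xs ys))
    ≡⟨ cong₂ _+_ (cong sum (sym (map-∘ ys))) (sum-cartesianProduct h xs ys) ⟩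
  _ ∎
  where open ≡-Reasoning

sumV : ∀ R → (V R → ℕ) → ℕ
sumV •       f = f tt
sumV (X ▸ Y) f = sumV X (f ∘ inj₁) + sumV Y (f ∘ inj₂)

sumV-cong : ∀ R {f g : V R → ℕ} → (∀ x → f x ≡ g x) → sumV R f ≡ sumV R g
sumV-cong •       e = e tt
sumV-cong (X ▸ Y) e = cong₂ _+_ (sumV-cong X (e ∘ inj₁)) (sumV-cong Y (e ∘ inj₂))

+-interchange : ∀ a b c d → a + b + (c + d) ≡ a + c + (b + d)
+-interchange a b c d = solve (a ∷ b ∷ c ∷ d ∷ [])

sumV-+ : ∀ R (f g : V R → ℕ) → sumV R (λ x → f x + g x) ≡ sumV R f + sumV R g
sumV-+ •       f g = refl
sumV-+ (X ▸ Y) f g = trans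
  (cong₂ _+_ (sumV-+ X (f ∘ inj₁) (g ∘ inj₁)) (sumV-+ Y (f ∘ inj₂) (g ∘ inj₂)))
  (+-interchange (sumV X (f ∘ inj₁)) _ _ _)

sumV-zero : ∀ R (f : V R → ℕ) → (∀ x → f x ≡ 0) → sumV R f ≡ 0
sumV-zero •       f e = e tt
sumV-zero (X ▸ Y) f e = cong₂ _+_ (sumV-zero X _ (e ∘ inj₁)) (sumV-zero Y _ (e ∘ inj₂))

sumV-single : ∀ R (f : V R → ℕ) z → (∀ x → x ≢ z → f x ≡ 0) → sumV R f ≡ f z
sumV-single •       f tt       e = refl
sumV-single (X ▸ Y) f (inj₁ x) e = trans
  (cong₂ _+_ (sumV-single X _ x (λ x′ ne → e (inj₁ x′) (ne ∘ Sum.inj₁-injective)))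
             (sumV-zero Y _ (λ y → e (inj₂ y) (λ ()))))
  (+-identityʳ _)
sumV-single (X ▸ Y) f (inj₂ y) e =
  cong₂ _+_ (sumV-zero X _ (λ x → e (inj₁ x) (λ ())))
            (sumV-single Y _ y (λ y′ ne → e (inj₂ y′) (ne ∘ Sum.inj₂-injective)))

vertices : ∀ R → List (V R)
vertices •       = tt ∷ []
vertices (X ▸ Y) = map inj₁ (vertices X) ++ map inj₂ (vertices Y)

∈-vertices : ∀ R x → x ∈ˡ vertices R
∈-vertices •       tt       = here refl
∈-vertices (X ▸ Y) (inj₁ x) = ∈-++⁺ˡ (∈-map⁺ inj₁ (∈-vertices X x))
∈-vertices (X ▸ Y) (inj₂ y) = ∈-++⁺ʳ (map inj₁ (vertices X)) (∈-map⁺ inj₂ (∈-vertices Y y))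

vertices-unique : ∀ R → Unique (vertices R)
vertices-unique •       = All.[] AllPairs.∷ AllPairs.[]
vertices-unique (X ▸ Y) = Unique.++⁺
  (Unique.map⁺ Sum.inj₁-injective (vertices-unique X))
  (Unique.map⁺ Sum.inj₂-injective (vertices-unique Y))
  disjoint
  where
  disjoint : ∀ {v} → ¬ (v ∈ˡ map inj₁ (vertices X) × v ∈ˡ map inj₂ (vertices Y))
  disjoint (p , q) with ∈-map⁻ inj₁ p | ∈-map⁻ inj₂ q
  ... | _ , _ , refl | _ , _ , ()

length-vertices : ∀ R → length (vertices R) ≡ size R
length-vertices •       = refl
length-vertices (X ▸ Y) = trans (length-++ (map inj₁ (vertices X)))
  (cong₂ _+_ (trans (length-map inj₁ (vertices X)) (length-vertices X))
             (trans (length-map inj₂ (vertices Y)) (length-vertices Y)))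

sum-vertices : ∀ R f → sum (map f (vertices R)) ≡ sumV R f
sum-vertices •       f = +-identityʳ (f tt)
sum-vertices (X ▸ Y) f = begin
  sum (map f (map inj₁ (vertices X) ++ map inj₂ (vertices Y)))
    ≡⟨ cong sum (map-++ f (map inj₁ (vertices X)) _) ⟩
  sum (map f (map inj₁ (vertices X)) ++ map f (map inj₂ (vertices Y)))
    ≡⟨ sum-++ (map f (map inj₁ (vertices X))) _ ⟩
  sum (map f (map inj₁ (vertices X))) + sum (map f (map inj₂ (vertices Y)))
    ≡⟨ cong₂ _+_ (cong sum (sym (map-∘ (vertices X)))) (cong sum (sym (map-∘ (vertices Y)))) ⟩
  sum (map (f ∘ inj₁) (vertices X)) + sum (map (f ∘ inj₂) (vertices Y))
    ≡⟨ cong₂ _+_ (sum-vertices X (f ∘ inj₁)) (sum-vertices Y (f ∘ inj₂)) ⟩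
  _ ∎
  where open ≡-Reasoning

edgeSum : ∀ R → (V R → V R → ℕ) → ℕ
edgeSum •       g = 0
edgeSum (X ▸ Y) g = g (inj₁ (root X)) (inj₂ (root Y)) +
  (edgeSum X (λ x x′ → g (inj₁ x) (inj₁ x′)) + edgeSum Y (λ y y′ → g (inj₂ y) (inj₂ y′)))

sumV-roots : ∀ X Y {P : V X → V Y → Set} (P? : ∀ x y → Dec (P x y)) (g : V X → V Y → ℕ) →
  sumV X (λ x → sumV Y (λ y → when (P? x y ×-dec ((x ≟V root X) ×-dec (y ≟V root Y))) (g x y)))
  ≡ when (P? (root X) (root Y)) (g (root X) (root Y))
sumV-roots X Y P? g = trans
  (sumV-single X _ (root X) (λ x ne → sumV-zero Y _ (λ y →
    when-no (P? x y ×-dec ((x ≟V root X) ×-dec (y ≟V root Y))) (λ (_ , e , _) → ne e))))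
  (trans (sumV-single Y _ (root Y) (λ y ne →
    when-no (P? (root X) y ×-dec ((root X ≟V root X) ×-dec (y ≟V root Y))) (λ (_ , _ , e) → ne e)))
  (when-cong (P? (root X) (root Y) ×-dec ((root X ≟V root X) ×-dec (root Y ≟V root Y)))
             (P? (root X) (root Y)) proj₁ (λ p → p , refl , refl)))

sumV-comm : ∀ X Y (f : V X → V Y → ℕ) →
            sumV X (λ x → sumV Y (f x)) ≡ sumV Y (λ y → sumV X (λ x → f x y))
sumV-comm •         Y f = refl
sumV-comm (X₁ ▸ X₂) Y f = trans
  (cong₂ _+_ (sumV-comm X₁ Y (f ∘ inj₁)) (sumV-comm X₂ Y (f ∘ inj₂)))
  (sym (sumV-+ Y _ _))

-- `edges` orders the two ends of an edge as elements of `Fin n`, which has nothing to do with the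
-- shape of `R`. Any total asymmetric `≺` selects each edge in one direction, and the symmetry of
-- `g` hides which.
sumV-edges : ∀ R {_≺_ : V R → V R → Set} (_≺?_ : ∀ x y → Dec (x ≺ y)) (g : V R → V R → ℕ) →
  (∀ {x y} → x ≢ y → x ≺ y ⊎ y ≺ x) → (∀ {x y} → x ≺ y → ¬ (y ≺ x)) → (∀ x y → g x y ≡ g y x) →
  sumV R (λ x → sumV R (λ y → when ((x ≺? y) ×-dec Adj? R x y) (g x y))) ≡ edgeSum R g
sumV-edges • _≺?_ g total asym g-sym = when-no ((tt ≺? tt) ×-dec no λ ()) (λ ())
sumV-edges (X ▸ Y) {_≺_} _≺?_ g total asym g-sym = begin
  sumV X (λ x → XX x + XY x) + sumV Y (λ y → YX y + YY y)
    ≡⟨ cong₂ _+_ (sumV-+ X XX XY) (sumV-+ Y YX YY) ⟩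
  (sumV X XX + sumV X XY) + (sumV Y YX + sumV Y YY)
    ≡⟨ cong₂ _+_ (+-comm (sumV X XX) _) refl ⟩
  (sumV X XY + sumV X XX) + (sumV Y YX + sumV Y YY)
    ≡⟨ +-interchange (sumV X XY) _ _ _ ⟩
  (sumV X XY + sumV Y YX) + (sumV X XX + sumV Y YY)
    ≡⟨ cong₂ _+_ cross (cong₂ _+_ inX inY) ⟩
  _ ∎
  where
  open ≡-Reasoning
  XX XY : V X → ℕ
  YX YY : V Y → ℕ
  XX x = sumV X (λ x′ → when ((inj₁ x ≺? inj₁ x′) ×-dec Adj? X x x′) (g (inj₁ x) (inj₁ x′)))
  XY x = sumV Y (λ y → when ((inj₁ x ≺? inj₂ y) ×-dec ((x ≟V root X) ×-dec (y ≟V root Y))) (g (inj₁ x) (inj₂ y)))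
  YX y = sumV X (λ x → when ((inj₂ y ≺? inj₁ x) ×-dec ((x ≟V root X) ×-dec (y ≟V root Y))) (g (inj₂ y) (inj₁ x)))
  YY y = sumV Y (λ y′ → when ((inj₂ y ≺? inj₂ y′) ×-dec Adj? Y y y′) (g (inj₂ y) (inj₂ y′)))
  inX = sumV-edges X (λ x x′ → inj₁ x ≺? inj₁ x′) (λ x x′ → g (inj₁ x) (inj₁ x′))
    (λ ne → total (ne ∘ Sum.inj₁-injective)) asym (λ _ _ → g-sym _ _)
  inY = sumV-edges Y (λ y y′ → inj₂ y ≺? inj₂ y′) (λ y y′ → g (inj₂ y) (inj₂ y′))
    (λ ne → total (ne ∘ Sum.inj₂-injective)) asym (λ _ _ → g-sym _ _)
  rX = inj₁ (root X)
  rY = inj₂ (root Y)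
  one-order : (p : Dec (rX ≺ rY)) (q : Dec (rY ≺ rX)) → when p (g rX rY) + when q (g rY rX) ≡ g rX rY
  one-order (yes p) (yes q) = contradiction q (asym p)
  one-order (yes p) (no _)  = +-identityʳ _
  one-order (no _)  (yes q) = g-sym rY rX
  one-order (no ¬p) (no ¬q) = ⊥-elim ([ ¬p , ¬q ]′ (total (λ ())))
  cross : sumV X XY + sumV Y YX ≡ g rX rY
  cross = trans (cong₂ _+_
    (sumV-roots X Y (λ x y → inj₁ x ≺? inj₂ y) (λ x y → g (inj₁ x) (inj₂ y)))
    (trans (sym (sumV-comm X Y _)) (sumV-roots X Y (λ x y → inj₂ y ≺? inj₁ x) (λ x y → g (inj₂ y) (inj₁ x)))))
    (one-order (rX ≺? rY) (rY ≺? rX))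

module _ {n} {G : Graph (Fin n)} {R} (φ : Iso G (graph R)) where

  allFin-↭ : allFin n ↭ map (from φ) (vertices R)
  allFin-↭ = unique-↭ (Unique.allFin⁺ n) (Unique.map⁺ (to-injective (iso-sym φ)) (vertices-unique R))
    (λ {v} _ → subst (_∈ˡ _) (from-to φ v) (∈-map⁺ (from φ) (∈-vertices R (to φ v))))
    (λ _ → ∈-allFin _)

  sum-allFin : ∀ f → sum (map f (allFin n)) ≡ sumV R (f ∘ from φ)
  sum-allFin f = begin
    sum (map f (allFin n))                     ≡⟨ sum-↭ (↭-map⁺ f allFin-↭) ⟩
    sum (map f (map (from φ) (vertices R)))    ≡⟨ cong sum (map-∘ (vertices R)) ⟨
    sum (map (f ∘ from φ) (vertices R))        ≡⟨ sum-vertices R _ ⟩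
    sumV R (f ∘ from φ)                        ∎
    where open ≡-Reasoning

  iso-size : n ≡ size R
  iso-size = begin
    n                                      ≡⟨ length-tabulate {n = n} id ⟨
    length (allFin n)                      ≡⟨ ↭-length allFin-↭ ⟩
    length (map (from φ) (vertices R))     ≡⟨ length-map (from φ) (vertices R) ⟩
    length (vertices R)                    ≡⟨ length-vertices R ⟩
    size R                                 ∎
    where open ≡-Reasoning

  sum-edges : (g : Fin n → Fin n → ℕ) → (∀ x y → g x y ≡ g y x) →
    sum (map (λ (u , v) → g u v) (edges G)) ≡ edgeSum R (λ x y → g (from φ x) (from φ y))
  sum-edges g g-sym = begin
    _ ≡⟨ sum-filter (λ (u , v) → (u Fin.<? v) ×-dec (u ~? v)) (λ (u , v) → g u v)
           (cartesianProduct (allFin n) (allFin n)) ⟩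
    _ ≡⟨ sum-cartesianProduct (λ (u , v) → when ((u Fin.<? v) ×-dec (u ~? v)) (g u v)) (allFin n) (allFin n) ⟩
    _ ≡⟨ sum-allFin _ ⟩
    _ ≡⟨ sumV-cong R (λ x → sum-allFin _) ⟩
    _ ≡⟨ sumV-cong R (λ x → sumV-cong R (λ y → when-cong
           ((from φ x Fin.<? from φ y) ×-dec (from φ x ~? from φ y))
           ((from φ x Fin.<? from φ y) ×-dec Adj? R x y)
           (λ (p , a) → p , adj⁻ (iso-sym φ) x y a) (λ (p , a) → p , adj⁺ (iso-sym φ) x y a))) ⟩
    _ ≡⟨ sumV-edges R (λ x y → from φ x Fin.<? from φ y) (λ x y → g (from φ x) (from φ y))
           (λ ne → total (ne ∘ to-injective (iso-sym φ))) <-asym (λ _ _ → g-sym _ _) ⟩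
    _ ∎
    where
    open ≡-Reasoning
    open Graph G
    total : ∀ {u v : Fin n} → u ≢ v → u Fin.< v ⊎ v Fin.< u
    total {u} {v} ne with <-cmp (toℕ u) (toℕ v)
    ... | tri< p _ _ = inj₁ p
    ... | tri≈ _ e _ = contradiction (Fin.toℕ-injective e) ne
    ... | tri> _ _ p = inj₂ p

-- Degrees and the Mostar index of a rooted tree

-- The number of vertices of degree two, when the root has e further neighbours outside R.
twos : ℕ → Rooted → ℕ
twos e •       = when (e ≟ 2) 1
twos e (X ▸ Y) = twos 1 X + twos (suc e) Y

deg : ∀ R → V R → ℕ
deg R x = sumV R (λ y → when (Adj? R x y) 1)

deg-left : ∀ X Y x → deg (X ▸ Y) (inj₁ x) ≡ deg X x + when (x ≟V root X) 1
deg-left X Y x = cong (deg X x +_) (trans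
  (sumV-single Y _ (root Y) λ y ne → when-no ((x ≟V root X) ×-dec (y ≟V root Y)) (ne ∘ proj₂))
  (when-cong ((x ≟V root X) ×-dec (root Y ≟V root Y)) (x ≟V root X) proj₁ (_, refl)))

deg-right : ∀ X Y y → deg (X ▸ Y) (inj₂ y) ≡ deg Y y + when (y ≟V root Y) 1
deg-right X Y y = trans (+-comm _ (deg Y y)) (cong (deg Y y +_) (trans
  (sumV-single X _ (root X) λ x ne → when-no ((x ≟V root X) ×-dec (y ≟V root Y)) (ne ∘ proj₁))
  (when-cong ((root X ≟V root X) ×-dec (y ≟V root Y)) (y ≟V root Y) proj₂ (refl ,_))))

when-+ : ∀ {P : Set} (P? : Dec P) a b → when P? a + when P? b ≡ when P? (a + b)
when-+ (yes _) a b = refl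
when-+ (no _)  a b = refl

-- The parameter `e` carries the induction: the edge of `X ▸ Y` between the two roots gives each of
-- them one more neighbour outside its own part.
twos-correct : ∀ e R → sumV R (λ x → when (deg R x + when (x ≟V root R) e ≟ 2) 1) ≡ twos e R
twos-correct e •       = refl
twos-correct e (X ▸ Y) = cong₂ _+_
  (trans (sumV-cong X λ x → cong (λ d → when (d ≟ 2) 1)
      (trans (+-identityʳ _) (deg-left X Y x)))
    (twos-correct 1 X))
  (trans (sumV-cong Y λ y → cong (λ d → when (d ≟ 2) 1) (begin
      deg (X ▸ Y) (inj₂ y) + when (inj₂ y ≟V root (X ▸ Y)) e
        ≡⟨ cong₂ _+_ (deg-right X Y y)
             (when-cong (inj₂ y ≟V root (X ▸ Y)) (y ≟V root Y) Sum.inj₂-injective (cong inj₂)) ⟩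
      deg Y y + when (y ≟V root Y) 1 + when (y ≟V root Y) e
        ≡⟨ +-assoc (deg Y y) _ _ ⟩
      deg Y y + (when (y ≟V root Y) 1 + when (y ≟V root Y) e)
        ≡⟨ cong (deg Y y +_) (when-+ (y ≟V root Y) 1 e) ⟩
      deg Y y + when (y ≟V root Y) (suc e) ∎))
    (twos-correct (suc e) Y))
  where open ≡-Reasoning

when-zero : ∀ {P : Set} (P? : Dec P) → when P? 0 ≡ 0
when-zero (yes _) = refl
when-zero (no _)  = refl

#degreeTwo-iso : ∀ {n} {G : Graph (Fin n)} {R} → Iso G (graph R) → #degreeTwo G ≡ twos 0 R
#degreeTwo-iso {n} {G} {R} φ = begin
  #degreeTwo G                                       ≡⟨ count≡sum (λ v → degree G v ≟ 2) ⟩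
  sum (map (λ v → when (degree G v ≟ 2) 1) (allFin n)) ≡⟨ sum-allFin φ _ ⟩
  sumV R (λ x → when (degree G (from φ x) ≟ 2) 1)
    ≡⟨ sumV-cong R (λ x → cong (λ d → when (d ≟ 2) 1) (begin
         degree G (from φ x)                          ≡⟨ count≡sum (from φ x ~?_) ⟩
         sum (map (λ v → when (from φ x ~? v) 1) (allFin n)) ≡⟨ sum-allFin φ _ ⟩
         sumV R (λ y → when (from φ x ~? from φ y) 1)
           ≡⟨ sumV-cong R (λ y → when-cong (from φ x ~? from φ y) (Adj? R x y)
                (adj⁻ (iso-sym φ) x y) (adj⁺ (iso-sym φ) x y)) ⟩
         deg R x                                      ≡⟨ +-identityʳ _ ⟨
         deg R x + 0                                  ≡⟨ cong (deg R x +_) (when-zero (x ≟V root R)) ⟨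
         deg R x + when (x ≟V root R) 0               ∎)) ⟩
  sumV R (λ x → when (deg R x + when (x ≟V root R) 0 ≟ 2) 1) ≡⟨ twos-correct 0 R ⟩
  twos 0 R                                           ∎
  where
  open ≡-Reasoning
  open Graph G

-- Distances on the two sides of a bridge

count-complement : ∀ {A : Set} {P Q : Pred A 0ℓ} (P? : Decidable P) (Q? : Decidable Q) →
                   (∀ {x} → P x → ¬ Q x) → (∀ {x} → ¬ P x → Q x) → ∀ xs →
                   length (filter P? xs) + length (filter Q? xs) ≡ length xs
count-complement P? Q? disj cover []       = refl
count-complement P? Q? disj cover (x ∷ xs) with P? x | Q? x
... | yes p | yes q = contradiction q (disj p)
... | yes p | no ¬q = cong suc (count-complement P? Q? disj cover xs)
... | no ¬p | yes q = trans (+-suc _ _) (cong suc (count-complement P? Q? disj cover xs))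
... | no ¬p | no ¬q = contradiction (cover ¬p) ¬q

module _ {n} (G : Graph (Fin n)) (conn : Connected G) where
  open Graph G

  dist-walk : ∀ u v → Walk G (dist G conn u v) u v
  dist-walk u v = proj₁ (proj₂ (least (λ k → walk? G k u v) (proj₁ (conn u v)) (proj₂ (conn u v))))

  dist-least : ∀ {u v k} → Walk G k u v → dist G conn u v ≤ k
  dist-least {u} {v} p =
    proj₂ (proj₂ (least (λ k → walk? G k u v) (proj₁ (conn u v)) (proj₂ (conn u v)))) _ p

  module _ {S : Pred (Fin n) 0ℓ} (S? : Decidable S) {a b : Fin n} where

    -- A walk out of S has to pass through the only edge ab that leaves S.
    through-bridge : (∀ {u v} → S u → ¬ S v → u ~ v → u ≡ a × v ≡ b) → ¬ S b →
                     ∀ {k w} → S w → Walk G k w b → ∃ λ j → j < k × Walk G j w a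
    through-bridge bridge ¬Sb Sw []ʷ = contradiction Sw ¬Sb
    through-bridge bridge ¬Sb Sw (_∷ʷ_ {v = w′} e p) with S? w′
    ... | yes Sw′ = let j , j<k , q = through-bridge bridge ¬Sb Sw′ p in suc j , s≤s j<k , e ∷ʷ q
    ... | no ¬Sw′ with refl , _ ← bridge Sw ¬Sw′ e = 0 , s≤s z≤n , []ʷ

    closer-to-bridge : (∀ {u v} → S u → ¬ S v → u ~ v → u ≡ a × v ≡ b) → ¬ S b →
                       ∀ {w} → S w → dist G conn w a < dist G conn w b
    closer-to-bridge bridge ¬Sb {w} Sw =
      let j , j<k , q = through-bridge bridge ¬Sb Sw (dist-walk w b)
      in ≤-<-trans (dist-least q) j<k

  -- R sits in G so that it is joined to the rest of G at its root only.
  record Hanging (R : Rooted) (ι : V R → Fin n) : Set where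
    field
      injective : Injective _≡_ _≡_ ι
      outside   : ∀ {x w} → ι x ~ w → (∃ λ y → ι y ≡ w × Adj R x y) ⊎ x ≡ root R

  open Hanging

  hanging-left : ∀ {X Y ι} → Hanging (X ▸ Y) ι → Hanging X (ι ∘ inj₁)
  hanging-left h = record
    { injective = Sum.inj₁-injective ∘ injective h
    ; outside = λ e → [ (λ { (inj₁ y , eq , a) → inj₁ (y , eq , a) ; (inj₂ y , eq , r , _) → inj₂ r })
                      , (λ ()) ]′ (outside h e) }

  hanging-right : ∀ {X Y ι} → Hanging (X ▸ Y) ι → Hanging Y (ι ∘ inj₂)
  hanging-right h = record
    { injective = Sum.inj₂-injective ∘ injective h
    ; outside = λ e → [ (λ { (inj₂ y , eq , a) → inj₁ (y , eq , a) ; (inj₁ y , eq , _ , r) → inj₂ r })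
                      , inj₂ ∘ Sum.inj₂-injective ]′ (outside h e) }

  module _ {X Y : Rooted} {ι : V (X ▸ Y) → Fin n} (h : Hanging (X ▸ Y) ι) where

    private
      a = ι (inj₁ (root X))
      b = ι (inj₂ (root Y))
      S = map (ι ∘ inj₁) (vertices X)

      bridge : ∀ {u v} → u ∈ˡ S → v ∉ S → u ~ v → u ≡ a × v ≡ b
      bridge u∈ v∉ e with ∈-map⁻ (ι ∘ inj₁) u∈
      ... | x , _ , refl with outside h e
      ...   | inj₁ (inj₁ y , refl , _)           = contradiction (∈-map⁺ (ι ∘ inj₁) (∈-vertices X y)) v∉
      ...   | inj₁ (inj₂ y , refl , refl , refl) = refl , refl

      b∉S : b ∉ S
      b∉S b∈ with ∈-map⁻ (ι ∘ inj₁) b∈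
      ... | x , _ , e with () ← injective h e

      a∈S : a ∈ˡ S
      a∈S = ∈-map⁺ (ι ∘ inj₁) (∈-vertices X (root X))

      S? : Decidable (_∈ˡ S)
      S? w = any? (w Fin.≟_) S

      near-a : ∀ {w} → w ∈ˡ S → dist G conn w a < dist G conn w b
      near-a = closer-to-bridge S? bridge b∉S

      near-b : ∀ {w} → w ∉ S → dist G conn w b < dist G conn w a
      -- The same argument on the complement of `S`, with the bridge crossed the other way.
      near-b = closer-to-bridge (¬? ∘ S?)
        (λ {u} {v} u∉ ¬v∉ e → let p , q = bridge (S-stable v ¬v∉) u∉ (~-sym e) in q , p)
        (λ a∉ → a∉ a∈S)
        where
        S-stable : ∀ v → ¬ (v ∉ S) → v ∈ˡ S
        S-stable v ¬∉ with S? v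
        ... | yes p = p
        ... | no ¬p = contradiction ¬p ¬∉

    #closer-inner : #closer G conn a b ≡ size X
    #closer-inner = trans
      (count-list _ (Unique.map⁺ (Sum.inj₁-injective ∘ injective h) (vertices-unique X)) near-a inS)
      (trans (length-map _ (vertices X)) (length-vertices X))
      where
      inS : ∀ {w} → dist G conn w a < dist G conn w b → w ∈ˡ S
      inS {w} lt with S? w
      ... | yes p = p
      ... | no ¬p = contradiction lt (<-asym (near-b ¬p))

    -- No vertex is equidistant from the two ends of a bridge, so the two counts add up to `n`.
    #closer-outer : #closer G conn b a ≡ n ∸ size X
    #closer-outer = begin
      #closer G conn b a                          ≡⟨ m+n∸m≡n (#closer G conn a b) _ ⟨
      #closer G conn a b + #closer G conn b a ∸ #closer G conn a b
        ≡⟨ cong₂ _∸_ (trans (count-complement _ _ <-asym ¬near (allFin n)) (length-tabulate {n = n} id)) #closer-inner ⟩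
      n ∸ size X                                  ∎
      where
      open ≡-Reasoning
      ¬near : ∀ {w} → ¬ (dist G conn w a < dist G conn w b) → dist G conn w b < dist G conn w a
      ¬near {w} ¬lt with S? w
      ... | yes p = contradiction (near-a p) ¬lt
      ... | no ¬p = near-b ¬p

  imbalance : Fin n → Fin n → ℕ
  imbalance u v = ∣ #closer G conn u v - #closer G conn v u ∣

-- The contribution to the Mostar index of a graph on n vertices of the edges in a hanging R.
moSum : ℕ → Rooted → ℕ
moSum n •       = 0
moSum n (X ▸ Y) = ∣ size X - (n ∸ size X) ∣ + (moSum n X + moSum n Y)

edgeSum-hanging : ∀ {n} (G : Graph (Fin n)) conn R ι → Hanging G conn R ι →
                  edgeSum R (λ x y → imbalance G conn (ι x) (ι y)) ≡ moSum n R
edgeSum-hanging G conn •       ι h = refl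
edgeSum-hanging G conn (X ▸ Y) ι h = cong₂ _+_
  (cong₂ ∣_-_∣ (#closer-inner G conn h) (#closer-outer G conn h))
  (cong₂ _+_ (edgeSum-hanging G conn X _ (hanging-left G conn h))
             (edgeSum-hanging G conn Y _ (hanging-right G conn h)))

mostar-iso : ∀ {n} {G : Graph (Fin n)} {R} → Iso G (graph R) → ∀ conn → mostar G conn ≡ moSum n R
mostar-iso {G = G} {R} φ conn = trans
  (sum-edges φ (imbalance G conn) (λ u v → ∣-∣-comm (#closer G conn u v) _))
  (edgeSum-hanging G conn R (from φ) (record
    { injective = to-injective (iso-sym φ)
    ; outside = λ {x} {w} e → inj₁ (to φ w , from-to φ w ,
        adj⁻ (iso-sym φ) x (to φ w) (subst (Graph._~_ G (from φ x)) (sym (from-to φ w)) e)) }))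

-- An inequality for three groups of branches

-- L ≤ R follows from A ≤ B once R − L = (B − A) + w.
deduce : ∀ {A B L R} w → A ≤ B → L + B + w ≡ R + A → L ≤ R
deduce {A} {B} {L} {R} w h e = +-cancelʳ-≤ A L R (begin
  L + A     ≤⟨ +-monoʳ-≤ L h ⟩
  L + B     ≤⟨ m≤m+n (L + B) w ⟩
  L + B + w ≡⟨ e ⟩
  R + A     ∎)
  where open ≤-Reasoning

scale : ∀ k {a b} → a ≤ b → k * a ≤ k * b
scale k = *-monoʳ-≤ k

infixl 6 _⊕_
infixl 7 _⊗_

-- With these, the hypothesis given to `deduce` is a nonnegative combination of known inequalities,
-- and the ring solver checks the remaining identity.
_⊕_ : ∀ {a b c d} → a ≤ b → c ≤ d → a + c ≤ b + d
_⊕_ = +-mono-≤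

_⊗_ : ∀ {a b c d} → a ≤ b → c ≤ d → a * c ≤ b * d
_⊗_ = *-mono-≤

2xy≤x²+y² : ∀ x y → 2 * (x * y) ≤ x * x + y * y
2xy≤x²+y² zero    y       = z≤n
2xy≤x²+y² (suc x) zero    = ≤-trans (≤-reflexive (cong (2 *_) (*-zeroʳ x))) z≤n
2xy≤x²+y² (suc x) (suc y) = deduce 0 (2xy≤x²+y² x y) (solve (x ∷ y ∷ []))

-- This is `(p - q - r)² ≥ 0`.
heron : ∀ p q r → (p + q + r) * (p + q + r) ≤ 2 * (p * p + q * q + r * r) + 4 * (q * r)
heron p q r = deduce 0 (2xy≤x²+y² p (q + r)) (solve (p ∷ q ∷ r ∷ []))

-- Applied to the `p` of a single branch, which is never one. Otherwise the smallest branches would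
-- violate `Core`: for `κ = 2`, all `mᵢ = 2` and all `pᵢ = 1` it would read `36 ≤ 32`.
below-two : ∀ {p} → suc p ≤ 2 → p ≢ 1 → p ≡ 0
below-two {zero}        _ _ = refl
below-two {suc zero}    _ ne = contradiction refl ne
below-two {suc (suc p)} (s≤s (s≤s ())) _

-- The case of Spread below in which m₁ = m₂ + m₃ − a is the largest: Heron's form
-- 2(xy + yz + zx) − x² − y² − z² is 4m₂m₃ − a² at the mᵢ and at most 4p₂p₃ at the pᵢ.
Core : (κ m₂ m₃ p₁ p₂ p₃ a : ℕ) → Set
Core κ m₂ m₃ p₁ p₂ p₃ a =
  4 * (p₂ * p₃) + 2 * (κ * (p₁ + p₂ + p₃)) + κ * κ + 8 + 2 * (a * a) ≤ 8 * (m₂ * m₃)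

core-swap : ∀ κ m₂ m₃ p₁ p₂ p₃ a → Core κ m₃ m₂ p₁ p₃ p₂ a → Core κ m₂ m₃ p₁ p₂ p₃ a
core-swap κ m₂ m₃ p₁ p₂ p₃ a h = deduce 0 h (solve (κ ∷ m₂ ∷ m₃ ∷ p₁ ∷ p₂ ∷ p₃ ∷ a ∷ []))

core₂-edge : ∀ m₁ m₃ p₁ p₃ → m₁ + 2 ≤ 2 + m₃ → suc p₁ ≤ m₁ → suc p₃ ≤ m₃ → 2 ≤ m₃ → Core 2 2 m₃ p₁ 0 p₃ 2
core₂-edge m₁ m₃ p₁ p₃ e h₁ h₃ h =
  deduce 4 (scale 4 e ⊕ scale 4 h₁ ⊕ scale 4 h₃ ⊕ scale 8 h) (solve (m₁ ∷ m₃ ∷ p₁ ∷ p₃ ∷ []))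

-- Three single branches. The general estimate is used from size three on; at size two `below-two`
-- gives `p = 0` instead.
core₂ : ∀ m₁ m₂ m₃ p₁ p₂ p₃ a → m₁ + a ≤ m₂ + m₃ → a ≤ m₂ → a ≤ m₃ → 2 ≤ a →
        suc p₁ ≤ m₁ → suc p₂ ≤ m₂ → suc p₃ ≤ m₃ → p₂ ≢ 1 → p₃ ≢ 1 → Core 2 m₂ m₃ p₁ p₂ p₃ a
core₂ m₁ 2 m₃ p₁ p₂ p₃ a e a≤m₂ a≤m₃ 2≤a h₁ h₂ h₃ n₂ n₃
  with refl ← ≤-antisym 2≤a a≤m₂ | refl ← below-two h₂ n₂ = core₂-edge m₁ m₃ p₁ p₃ e h₁ h₃ a≤m₃
core₂ m₁ m₂ 2 p₁ p₂ p₃ a e a≤m₂ a≤m₃ 2≤a h₁ h₂ h₃ n₂ n₃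
  with refl ← ≤-antisym 2≤a a≤m₃ | refl ← below-two h₃ n₃ =
  core-swap 2 m₂ 2 p₁ p₂ 0 2 (core₂-edge m₁ m₂ p₁ p₂ (≤-trans e (≤-reflexive (+-comm m₂ 2))) h₁ h₂ a≤m₂)
core₂ m₁ 0 m₃ p₁ p₂ p₃ a e a≤m₂ a≤m₃ 2≤a h₁ () h₃ n₂ n₃
core₂ m₁ 1 m₃ p₁ p₂ p₃ a e a≤m₂ a≤m₃ 2≤a h₁ h₂ h₃ n₂ n₃ with ≤-trans 2≤a a≤m₂
... | s≤s ()
core₂ m₁ m₂ 0 p₁ p₂ p₃ a e a≤m₂ a≤m₃ 2≤a h₁ h₂ () n₂ n₃
core₂ m₁ m₂ 1 p₁ p₂ p₃ a e a≤m₂ a≤m₃ 2≤a h₁ h₂ h₃ n₂ n₃ with ≤-trans 2≤a a≤m₃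
... | s≤s ()
core₂ m₁ (suc (suc (suc x))) (suc (suc (suc y))) p₁ p₂ p₃ (suc a) e (s≤s a≤m₂) (s≤s a≤m₃) 2≤a h₁ h₂ h₃ n₂ n₃ =
  deduce (2 * (x * y + 2 * x + 2 * y) + 2)
    (scale 4 (h₂ ⊗ h₃) ⊕ scale 4 h₁ ⊕ scale 4 e ⊕ scale 2 (a≤m₂ ⊗ a≤m₃))
    (solve (m₁ ∷ x ∷ y ∷ p₁ ∷ p₂ ∷ p₃ ∷ a ∷ []))

-- For `κ = 1` the terms `4p₂p₃ + 2p₂ + 2p₃ + 1` of `Core` form the product `(2p₂ + 1)(2p₃ + 1)`.
-- Bounding it by the sizes leaves the last hypothesis, which is free of the `pᵢ`.
core₁-generic : ∀ x y p₁ p₂ p₃ a → p₁ + a ≤ 2 + x + y → p₂ ≤ x → p₃ ≤ y →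
                2 * (a * a) + 9 ≤ 4 * ((1 + x) * (1 + y)) + 2 * a →
                Core 1 (1 + x) (1 + y) p₁ p₂ p₃ a
core₁-generic x y p₁ p₂ p₃ a e h₂ h₃ g =
  deduce 0 (scale 2 e ⊕ (s≤s (scale 2 h₂) ⊗ s≤s (scale 2 h₃)) ⊕ g)
    (solve (x ∷ y ∷ p₁ ∷ p₂ ∷ p₃ ∷ a ∷ []))

-- Here the largest group is the one with several branches. `5 ≤ m₁ + m₂ + m₃` excludes
-- `m₂ = m₃ = 1`, where `m₁` is at most two.
core₁-max : ∀ m₁ m₂ m₃ p₁ p₂ p₃ a → m₁ + a ≡ m₂ + m₃ → a ≤ m₂ → a ≤ m₃ → 5 ≤ m₁ + m₂ + m₃ →
            p₁ ≤ m₁ → suc p₂ ≤ m₂ → suc p₃ ≤ m₃ → p₂ ≢ 1 → p₃ ≢ 1 → Core 1 m₂ m₃ p₁ p₂ p₃ a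
core₁-max m₁ (suc x) (suc y) p₁ p₂ p₃ a e a≤m₂ a≤m₃ 5≤N h₁ (s≤s h₂) (s≤s h₃) n₂ n₃ =
  go x y a e a≤m₂ a≤m₃ 5≤N h₂ h₃
  where
  e≤ : ∀ x y a → m₁ + a ≡ suc x + suc y → p₁ + a ≤ 2 + x + y
  e≤ x y a e = ≤-trans (+-monoˡ-≤ a h₁) (≤-reflexive (trans e (cong suc (+-suc x y))))
  small : ∀ a → a ≤ 1 → p₁ + a ≤ 3 → Core 1 1 2 p₁ 0 0 a
  small 0 _ h = deduce 1 (scale 2 h) (solve (p₁ ∷ []))
  small 1 _ h = deduce 1 (scale 2 h) (solve (p₁ ∷ []))
  small (suc (suc _)) (s≤s ()) _
  go : ∀ x y a → m₁ + a ≡ suc x + suc y → a ≤ suc x → a ≤ suc y → 5 ≤ m₁ + suc x + suc y →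
       p₂ ≤ x → p₃ ≤ y → Core 1 (suc x) (suc y) p₁ p₂ p₃ a
  go 0 0 a e a≤ _ 5≤N _ _ = contradiction (≤-trans 5≤N (≤-trans
    (≤-reflexive (+-assoc m₁ 1 1)) (+-monoˡ-≤ 2 (m+n≤o⇒m≤o m₁ (≤-reflexive e))))) (<⇒≱ (s≤s ≤-refl))
  go 0 1 a e a≤ _ _ z≤n h₃ with refl ← below-two (s≤s h₃) n₃ = small a a≤ (e≤ 0 1 a e)
  go 1 0 a e _ a≤ _ h₂ z≤n with refl ← below-two (s≤s h₂) n₂ =
    core-swap 1 2 1 p₁ 0 0 a (small a a≤ (e≤ 1 0 a e))
  go 0 (suc (suc y)) 0 e a≤ _ _ h₂ h₃ =
    core₁-generic 0 (2 + y) p₁ p₂ p₃ 0 (e≤ 0 (2 + y) 0 e) h₂ h₃ (deduce (4 * y + 3) (z≤n {0}) (solve (y ∷ [])))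
  go 0 (suc (suc y)) 1 e a≤ _ _ h₂ h₃ =
    core₁-generic 0 (2 + y) p₁ p₂ p₃ 1 (e≤ 0 (2 + y) 1 e) h₂ h₃ (deduce (4 * y + 3) (z≤n {0}) (solve (y ∷ [])))
  go 0 (suc (suc y)) (suc (suc _)) e (s≤s ()) _ _ _ _
  go (suc (suc x)) 0 0 e _ a≤ _ h₂ h₃ =
    core₁-generic (2 + x) 0 p₁ p₂ p₃ 0 (e≤ (2 + x) 0 0 e) h₂ h₃ (deduce (4 * x + 3) (z≤n {0}) (solve (x ∷ [])))
  go (suc (suc x)) 0 1 e _ a≤ _ h₂ h₃ =
    core₁-generic (2 + x) 0 p₁ p₂ p₃ 1 (e≤ (2 + x) 0 1 e) h₂ h₃ (deduce (4 * x + 3) (z≤n {0}) (solve (x ∷ [])))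
  go (suc (suc x)) 0 (suc (suc _)) e _ (s≤s ()) _ _ _
  go (suc x) (suc y) 0 e _ _ _ h₂ h₃ =
    core₁-generic (1 + x) (1 + y) p₁ p₂ p₃ 0 (e≤ (1 + x) (1 + y) 0 e) h₂ h₃
      (deduce (4 * (x * y) + 8 * x + 8 * y + 7) (z≤n {0}) (solve (x ∷ y ∷ [])))
  go (suc x) (suc y) (suc a) e a≤m₂ a≤m₃ _ h₂ h₃ =
    core₁-generic (1 + x) (1 + y) p₁ p₂ p₃ (suc a) (e≤ (1 + x) (1 + y) (suc a) e) h₂ h₃
      (deduce (2 * (x * y) + 4 * x + 4 * y + 2 * a + 1) (scale 2 (a≤m₂ ⊗ a≤m₃)) (solve (x ∷ y ∷ a ∷ [])))

-- Here the largest group is a single branch, which gives `2 ≤ a`, and the third group has several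
-- branches.
core₁-side : ∀ m₁ m₂ m₃ p₁ p₂ p₃ a → m₁ + a ≤ m₂ + m₃ → a ≤ m₂ → a ≤ m₃ → 2 ≤ a →
             suc p₁ ≤ m₁ → suc p₂ ≤ m₂ → p₃ ≤ m₃ → p₂ ≢ 1 → Core 1 m₂ m₃ p₁ p₂ p₃ a
core₁-side m₁ 0 m₃ p₁ p₂ p₃ a e a≤m₂ a≤m₃ 2≤a h₁ () h₃ n₂
core₁-side m₁ 1 m₃ p₁ p₂ p₃ a e a≤m₂ a≤m₃ 2≤a h₁ h₂ h₃ n₂ with ≤-trans 2≤a a≤m₂
... | s≤s ()
core₁-side m₁ 2 m₃ p₁ p₂ p₃ a e a≤m₂ a≤m₃ 2≤a h₁ h₂ h₃ n₂
  with refl ← ≤-antisym 2≤a a≤m₂ | refl ← below-two h₂ n₂ =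
  deduce (4 * m₃ + 1) (scale 2 e ⊕ scale 2 h₁ ⊕ scale 2 h₃ ⊕ scale 8 a≤m₃) (solve (m₁ ∷ m₃ ∷ p₁ ∷ p₃ ∷ []))
core₁-side m₁ m₂ 0 p₁ p₂ p₃ a e a≤m₂ a≤m₃ 2≤a h₁ h₂ h₃ n₂ with ≤-trans 2≤a a≤m₃
... | ()
core₁-side m₁ m₂ 1 p₁ p₂ p₃ a e a≤m₂ a≤m₃ 2≤a h₁ h₂ h₃ n₂ with ≤-trans 2≤a a≤m₃
... | s≤s ()
core₁-side m₁ (suc (suc (suc x))) 2 p₁ p₂ p₃ a e a≤m₂ a≤m₃ 2≤a h₁ (s≤s h₂) h₃ n₂
  with refl ← ≤-antisym 2≤a a≤m₃ =
  deduce (4 * x + 3) (scale 2 e ⊕ scale 2 h₁ ⊕ (s≤s (scale 2 h₂) ⊗ s≤s (scale 2 h₃)))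
    (solve (m₁ ∷ x ∷ p₁ ∷ p₂ ∷ p₃ ∷ []))
core₁-side m₁ (suc (suc (suc x))) (suc (suc (suc y))) p₁ p₂ p₃ (suc a) e a≤m₂ (s≤s a≤m₃) 2≤a h₁ (s≤s h₂) h₃ n₂ =
  deduce (2 * (x * y) + 4 * x + 6 * y + 7)
    (scale 2 e ⊕ scale 2 h₁ ⊕ (s≤s (scale 2 h₂) ⊗ s≤s (scale 2 h₃)) ⊕ scale 2 (a≤m₂ ⊗ a≤m₃))
    (solve (m₁ ∷ x ∷ y ∷ p₁ ∷ p₂ ∷ p₃ ∷ a ∷ []))

core₀ : ∀ m₂ m₃ p₁ p₂ p₃ a → a ≤ m₂ → a ≤ m₃ → p₂ ≤ m₂ → p₃ ≤ m₃ → 2 ≤ m₂ → 2 ≤ m₃ → Core 0 m₂ m₃ p₁ p₂ p₃ a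
core₀ m₂ m₃ p₁ p₂ p₃ a a≤m₂ a≤m₃ h₂ h₃ 2≤m₂ 2≤m₃ =
  deduce 0 (scale 4 (h₂ ⊗ h₃) ⊕ scale 2 (a≤m₂ ⊗ a≤m₃) ⊕ scale 2 (2≤m₂ ⊗ 2≤m₃))
    (solve (m₂ ∷ m₃ ∷ p₁ ∷ p₂ ∷ p₃ ∷ a ∷ []))

core₀-side : ∀ m₂ m₃ p₁ p₂ p₃ a → a ≤ m₂ → a ≤ m₃ → suc p₂ ≤ m₂ → p₃ ≤ m₃ → 2 ≤ m₃ → Core 0 m₂ m₃ p₁ p₂ p₃ a
core₀-side 1 m₃ p₁ 0 p₃ a a≤1 a≤m₃ h₂ h₃ 2≤m₃ =
  deduce 6 (scale 2 (a≤1 ⊗ a≤1) ⊕ scale 8 2≤m₃) (solve (m₃ ∷ p₁ ∷ p₃ ∷ a ∷ []))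
core₀-side 1 m₃ p₁ (suc _) p₃ a a≤1 a≤m₃ (s≤s ()) h₃ 2≤m₃
core₀-side (suc (suc x)) m₃ p₁ p₂ p₃ a a≤m₂ a≤m₃ h₂ h₃ 2≤m₃ =
  core₀ (2 + x) m₃ p₁ p₂ p₃ a a≤m₂ a≤m₃ (<⇒≤ h₂) h₃ (s≤s (s≤s z≤n)) 2≤m₃

-- So twice Heron's form at the `mᵢ` is `8m₂m₃ - 2a²`, the quantity that `Core` bounds from below.
heron-identity : ∀ m₁ m₂ m₃ a → m₁ + a ≡ m₂ + m₃ →
  4 * (m₁ * m₂ + m₁ * m₃ + m₂ * m₃) + 2 * (a * a) ≡ 2 * (m₁ * m₁ + m₂ * m₂ + m₃ * m₃) + 8 * (m₂ * m₃)
heron-identity m₁ m₂ m₃ a e = begin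
  4 * (m₁ * m₂ + m₁ * m₃ + m₂ * m₃) + 2 * (a * a)
    ≡⟨ solve (m₁ ∷ m₂ ∷ m₃ ∷ a ∷ []) ⟩
  4 * (m₁ * (m₂ + m₃)) + 4 * (m₂ * m₃) + 2 * (a * a)
    ≡⟨ cong (λ s → 4 * (m₁ * s) + 4 * (m₂ * m₃) + 2 * (a * a)) e ⟨
  4 * (m₁ * (m₁ + a)) + 4 * (m₂ * m₃) + 2 * (a * a)
    ≡⟨ solve (m₁ ∷ m₂ ∷ m₃ ∷ a ∷ []) ⟩
  2 * (m₁ * m₁) + 2 * ((m₁ + a) * (m₁ + a)) + 4 * (m₂ * m₃)
    ≡⟨ cong (λ s → 2 * (m₁ * m₁) + 2 * (s * s) + 4 * (m₂ * m₃)) e ⟩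
  2 * (m₁ * m₁) + 2 * ((m₂ + m₃) * (m₂ + m₃)) + 4 * (m₂ * m₃)
    ≡⟨ solve (m₁ ∷ m₂ ∷ m₃ ∷ []) ⟩
  2 * (m₁ * m₁ + m₂ * m₂ + m₃ * m₃) + 8 * (m₂ * m₃) ∎
  where open ≡-Reasoning

-- Twice Heron's form at the `mᵢ`, compared with the `pᵢ`. Together with `p² ≤ 4 loss` for each
-- group it becomes `centred-loss`, where `8` is the surplus that no best tree at an edge reaches.
Spread : (κ m₁ m₂ m₃ p₁ p₂ p₃ : ℕ) → Set
Spread κ m₁ m₂ m₃ p₁ p₂ p₃ =
  2 * (m₁ * m₁ + m₂ * m₂ + m₃ * m₃) + (p₁ + p₂ + p₃ + κ) * (p₁ + p₂ + p₃ + κ) + 8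
  ≤ 2 * (p₁ * p₁ + p₂ * p₂ + p₃ * p₃) + 4 * (m₁ * m₂ + m₁ * m₃ + m₂ * m₃)

core⇒spread : ∀ κ m₁ m₂ m₃ p₁ p₂ p₃ a → m₁ + a ≡ m₂ + m₃ → Core κ m₂ m₃ p₁ p₂ p₃ a →
              Spread κ m₁ m₂ m₃ p₁ p₂ p₃
core⇒spread κ m₁ m₂ m₃ p₁ p₂ p₃ a e h =
  deduce 0 (heron p₁ p₂ p₃ ⊕ h ⊕ ≤-reflexive (sym (heron-identity m₁ m₂ m₃ a e)))
    (solve (κ ∷ m₁ ∷ m₂ ∷ m₃ ∷ p₁ ∷ p₂ ∷ p₃ ∷ a ∷ []))

-- One or several branches at a vertex, with m vertices in total; p + κ is the
-- number of vertices of degree other than two in them.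
data Group (N : ℕ) : (m p κ : ℕ) → Set where
  single : ∀ {m p} → suc p ≤ m → p ≢ 1 → 2 + 2 * m ≤ N → Group N m p 1
  multi  : ∀ {m p} → p ≤ m → 2 ≤ p → 2 * m ≤ N → Group N m p 0

group-size : ∀ {N m p κ} → Group N m p κ → 2 * m ≤ N
group-size (single _ _ h) = m+n≤o⇒n≤o 2 h
group-size (multi _ _ h)  = h

spread-max : ∀ {N m₁ m₂ m₃ p₁ p₂ p₃ κ₁ κ₂ κ₃} κ →
  Group N m₁ p₁ κ₁ → Group N m₂ p₂ κ₂ → Group N m₃ p₃ κ₃ → κ₁ + κ₂ + κ₃ ≡ suc κ → N ≡ m₁ + m₂ + m₃ →
  m₂ ≤ m₁ → m₃ ≤ m₁ → 5 ≤ N → Spread κ m₁ m₂ m₃ p₁ p₂ p₃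
spread-max {N} {m₁} {m₂} {m₃} {p₁} {p₂} {p₃} κ g₁ g₂ g₃ κ≡ N≡ m₂≤m₁ m₃≤m₁ 5≤N =
  core⇒spread κ m₁ m₂ m₃ p₁ p₂ p₃ a e (go κ g₁ g₂ g₃ κ≡)
  where
  m₁≤ : m₁ ≤ m₂ + m₃
  m₁≤ = deduce 0 (≤-trans (group-size g₁) (≤-reflexive N≡)) (solve (m₁ ∷ m₂ ∷ m₃ ∷ []))
  a = m₂ + m₃ ∸ m₁
  e : m₁ + a ≡ m₂ + m₃
  e = m+[n∸m]≡n m₁≤
  a≤m₂ : a ≤ m₂
  a≤m₂ = m≤n+o⇒m∸n≤o (m₂ + m₃) m₁ (deduce 0 m₃≤m₁ (solve (m₁ ∷ m₂ ∷ m₃ ∷ [])))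
  a≤m₃ : a ≤ m₃
  a≤m₃ = m≤n+o⇒m∸n≤o (m₂ + m₃) m₁ (deduce 0 m₂≤m₁ (solve (m₁ ∷ m₂ ∷ m₃ ∷ [])))
  2≤a : 2 + 2 * m₁ ≤ N → 2 ≤ a
  2≤a h = m+n≤o⇒m≤o∸n 2 {m₁} {m₂ + m₃} (deduce 0 (≤-trans h (≤-reflexive N≡)) (solve (m₁ ∷ m₂ ∷ m₃ ∷ [])))
  go : ∀ {κ₁ κ₂ κ₃} κ → Group _ m₁ p₁ κ₁ → Group _ m₂ p₂ κ₂ → Group _ m₃ p₃ κ₃ →
       κ₁ + κ₂ + κ₃ ≡ suc κ → Core κ m₂ m₃ p₁ p₂ p₃ a
  go _ (single h₁ n₁ s₁) (single h₂ n₂ s₂) (single h₃ n₃ s₃) refl =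
    core₂ m₁ m₂ m₃ p₁ p₂ p₃ a (≤-reflexive e) a≤m₂ a≤m₃ (2≤a s₁) h₁ h₂ h₃ n₂ n₃
  go _ (multi h₁ n₁ s₁) (single h₂ n₂ s₂) (single h₃ n₃ s₃) refl =
    core₁-max m₁ m₂ m₃ p₁ p₂ p₃ a e a≤m₂ a≤m₃ (≤-trans 5≤N (≤-reflexive N≡)) h₁ h₂ h₃ n₂ n₃
  go _ (single h₁ n₁ s₁) (single h₂ n₂ s₂) (multi h₃ n₃ s₃) refl =
    core₁-side m₁ m₂ m₃ p₁ p₂ p₃ a (≤-reflexive e) a≤m₂ a≤m₃ (2≤a s₁) h₁ h₂ h₃ n₂
  go _ (single h₁ n₁ s₁) (multi h₂ n₂ s₂) (single h₃ n₃ s₃) refl =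
    core-swap 1 m₂ m₃ p₁ p₂ p₃ a (core₁-side m₁ m₃ m₂ p₁ p₃ p₂ a
      (≤-reflexive (trans e (+-comm m₂ m₃))) a≤m₃ a≤m₂ (2≤a s₁) h₁ h₃ h₂ n₃)
  go _ (single h₁ n₁ s₁) (multi h₂ n₂ s₂) (multi h₃ n₃ s₃) refl =
    core₀ m₂ m₃ p₁ p₂ p₃ a a≤m₂ a≤m₃ h₂ h₃ (≤-trans n₂ h₂) (≤-trans n₃ h₃)
  go _ (multi h₁ n₁ s₁) (single h₂ n₂ s₂) (multi h₃ n₃ s₃) refl =
    core₀-side m₂ m₃ p₁ p₂ p₃ a a≤m₂ a≤m₃ h₂ h₃ (≤-trans n₃ h₃)
  go _ (multi h₁ n₁ s₁) (multi h₂ n₂ s₂) (single h₃ n₃ s₃) refl =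
    core-swap 0 m₂ m₃ p₁ p₂ p₃ a (core₀-side m₃ m₂ p₁ p₃ p₂ a a≤m₃ a≤m₂ h₃ h₂ (≤-trans n₂ h₂))

spread-rotate : ∀ κ m₁ m₂ m₃ p₁ p₂ p₃ → Spread κ m₂ m₃ m₁ p₂ p₃ p₁ → Spread κ m₁ m₂ m₃ p₁ p₂ p₃
spread-rotate κ m₁ m₂ m₃ p₁ p₂ p₃ h =
  deduce 0 h (solve (κ ∷ m₁ ∷ m₂ ∷ m₃ ∷ p₁ ∷ p₂ ∷ p₃ ∷ []))

rotate : ∀ x y z → x + y + z ≡ y + z + x
rotate x y z = solve (x ∷ y ∷ z ∷ [])

spread : ∀ {N m₁ m₂ m₃ p₁ p₂ p₃ κ₁ κ₂ κ₃} κ →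
  Group N m₁ p₁ κ₁ → Group N m₂ p₂ κ₂ → Group N m₃ p₃ κ₃ → κ₁ + κ₂ + κ₃ ≡ suc κ →
  N ≡ m₁ + m₂ + m₃ → 5 ≤ N → Spread κ m₁ m₂ m₃ p₁ p₂ p₃
spread {N} {m₁} {m₂} {m₃} {p₁} {p₂} {p₃} {κ₁} {κ₂} {κ₃} κ g₁ g₂ g₃ κ≡ N≡ 5≤N = go (≤-total m₁ m₂)
  where
  N≡₂ = trans N≡ (rotate m₁ m₂ m₃)
  κ≡₂ = trans (sym (rotate κ₁ κ₂ κ₃)) κ≡
  first : m₂ ≤ m₁ → m₃ ≤ m₁ → Spread κ m₁ m₂ m₃ p₁ p₂ p₃
  first h h′ = spread-max κ g₁ g₂ g₃ κ≡ N≡ h h′ 5≤N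
  second : m₃ ≤ m₂ → m₁ ≤ m₂ → Spread κ m₁ m₂ m₃ p₁ p₂ p₃
  second h h′ = spread-rotate κ m₁ m₂ m₃ p₁ p₂ p₃ (spread-max κ g₂ g₃ g₁ κ≡₂ N≡₂ h h′ 5≤N)
  third : m₁ ≤ m₃ → m₂ ≤ m₃ → Spread κ m₁ m₂ m₃ p₁ p₂ p₃
  third h h′ = spread-rotate κ m₁ m₂ m₃ p₁ p₂ p₃ (spread-rotate κ m₂ m₃ m₁ p₂ p₃ p₁
    (spread-max κ g₃ g₁ g₂ (trans (sym (rotate κ₂ κ₃ κ₁)) κ≡₂) (trans N≡₂ (rotate m₂ m₃ m₁)) h h′ 5≤N))
  go : m₁ ≤ m₂ ⊎ m₂ ≤ m₁ → Spread κ m₁ m₂ m₃ p₁ p₂ p₃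
  go (inj₁ m₁≤m₂) with ≤-total m₂ m₃
  ... | inj₁ m₂≤m₃ = third (≤-trans m₁≤m₂ m₂≤m₃) m₂≤m₃
  ... | inj₂ m₃≤m₂ = second m₃≤m₂ m₁≤m₂
  go (inj₂ m₂≤m₁) with ≤-total m₁ m₃
  ... | inj₁ m₁≤m₃ = third m₁≤m₃ (≤-trans m₂≤m₁ m₁≤m₃)
  ... | inj₂ m₃≤m₁ = first m₂≤m₁ m₃≤m₁

-- The loss of a rooted tree

below : Rooted → ℕ
below •       = 0
below (X ▸ Y) = suc (below X) + below Y

size≡1+below : ∀ R → size R ≡ suc (below R)
size≡1+below •       = refl
size≡1+below (X ▸ Y) = trans (cong₂ _+_ (size≡1+below X) (size≡1+below Y)) (cong suc (+-suc (below X) (below Y)))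

below-▸• : ∀ X → below (X ▸ •) ≡ size X
below-▸• X = trans (+-identityʳ _) (sym (size≡1+below X))

-- n(n − 1)/2 minus the sum of the distances to the root, n being the size.
loss : Rooted → ℕ
loss •       = 0
loss (X ▸ Y) = loss X + loss Y + size X * below Y

-- The sum of the distances to the root, counted by edges: the edge above `X` lies on the paths from
-- all vertices of `X`. Twice this is the sum of the terms `2x` in `|n - 2x|`.
distances : Rooted → ℕ
distances •       = 0
distances (X ▸ Y) = size X + (distances X + distances Y)

distances+loss : ∀ R → 2 * distances R + 2 * loss R ≡ size R * below R
distances+loss •       = refl
distances+loss (X ▸ Y) rewrite size≡1+below X | size≡1+below Y =
  eq (below X) (below Y) (distances X) (distances Y) (loss X) (loss Y)
    (trans (distances+loss X) (cong (_* below X) (size≡1+below X)))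
    (trans (distances+loss Y) (cong (_* below Y) (size≡1+below Y)))
  where
  eq : ∀ x y d e l m → 2 * d + 2 * l ≡ suc x * x → 2 * e + 2 * m ≡ suc y * y →
       2 * (suc x + (d + e)) + 2 * (l + m + suc x * y) ≡ (suc x + suc y) * (suc x + y)
  eq x y d e l m h k = begin
    2 * (suc x + (d + e)) + 2 * (l + m + suc x * y)                    ≡⟨ solve (x ∷ y ∷ d ∷ e ∷ l ∷ m ∷ []) ⟩
    2 * suc x + 2 * (suc x * y) + ((2 * d + 2 * l) + (2 * e + 2 * m))  ≡⟨ cong (2 * suc x + 2 * (suc x * y) +_) (cong₂ _+_ h k) ⟩
    2 * suc x + 2 * (suc x * y) + (suc x * x + suc y * y)              ≡⟨ solve (x ∷ y ∷ []) ⟩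
    (suc x + suc y) * (suc x + y)                                      ∎
    where open ≡-Reasoning

n≤∣m-[n∸m]∣+2m : ∀ m n → n ≤ ∣ m - (n ∸ m) ∣ + 2 * m
n≤∣m-[n∸m]∣+2m m n = begin
  n                          ≤⟨ m≤n+m∸n n m ⟩
  m + (n ∸ m)                ≤⟨ +-monoʳ-≤ m (m≤n+∣n-m∣ (n ∸ m) m) ⟩
  m + (m + ∣ m - (n ∸ m) ∣)  ≡⟨ eq ∣ m - (n ∸ m) ∣ ⟩
  ∣ m - (n ∸ m) ∣ + 2 * m    ∎
  where
  open ≤-Reasoning
  eq : ∀ k → m + (m + k) ≡ k + 2 * m
  eq k = solve (m ∷ k ∷ [])

moSum+distances : ∀ n R → n * below R ≤ moSum n R + 2 * distances R
moSum+distances n •       = ≤-reflexive (*-zeroʳ n)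
moSum+distances n (X ▸ Y) =
  lemma (below X) (below Y) (size X) (distances X) (distances Y) (moSum n X) (moSum n Y) ∣ size X - (n ∸ size X) ∣
    (n≤∣m-[n∸m]∣+2m (size X) n) (moSum+distances n X) (moSum+distances n Y)
  where
  lemma : ∀ x y s d e u v i → n ≤ i + 2 * s → n * x ≤ u + 2 * d → n * y ≤ v + 2 * e →
          n * (suc x + y) ≤ i + (u + v) + 2 * (s + (d + e))
  lemma x y s d e u v i h k l =
    deduce 0 (h ⊕ k ⊕ l) (solve (n ∷ x ∷ y ∷ s ∷ d ∷ e ∷ u ∷ v ∷ i ∷ []))

moSum≥2loss : ∀ R → 2 * loss R ≤ moSum (size R) R
moSum≥2loss R = deduce 0 (moSum+distances (size R) R ⊕ ≤-reflexive (distances+loss R))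
  (solve′ (loss R) (moSum (size R) R) (distances R) (size R * below R))
  where
  solve′ : ∀ l u d k → 2 * l + (u + 2 * d + k) + 0 ≡ u + (k + (2 * d + 2 * l))
  solve′ l u d k = solve (l ∷ u ∷ d ∷ k ∷ [])

-- No edge has more than half of the `n` vertices below it, so each `|n - 2x|` is `n - 2x`: the case
-- of equality in `moSum≥2loss`.
Light : ℕ → Rooted → Set
Light n •       = ⊤
Light n (X ▸ Y) = 2 * size X ≤ n × Light n X × Light n Y

size≤⇒Light : ∀ n R → 2 * size R ≤ n → Light n R
size≤⇒Light n •       h = tt
size≤⇒Light n (X ▸ Y) h =
  ≤-trans (scale 2 (m≤m+n (size X) (size Y))) h ,
  size≤⇒Light n X (≤-trans (scale 2 (m≤m+n (size X) (size Y))) h) ,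
  size≤⇒Light n Y (≤-trans (scale 2 (m≤n+m (size Y) (size X))) h)

-- The root of `R` is below no edge of `R`. For this reason the outer part at a balanced edge may
-- exceed half of the tree by one vertex.
below≤⇒Light : ∀ n R → 2 * below R ≤ n → Light n R
below≤⇒Light n •       h = tt
below≤⇒Light n (X ▸ Y) h = hX , size≤⇒Light n X hX ,
  below≤⇒Light n Y (≤-trans (scale 2 (m≤n+m (below Y) (suc (below X)))) h)
  where
  hX : 2 * size X ≤ n
  hX = ≤-trans (scale 2 (≤-trans (≤-reflexive (size≡1+below X)) (m≤m+n (suc (below X)) (below Y)))) h

n≡∣m-[n∸m]∣+2m : ∀ m n → 2 * m ≤ n → ∣ m - (n ∸ m) ∣ + 2 * m ≤ n
n≡∣m-[n∸m]∣+2m m n h with m≤n⇒∃[o]m+o≡n h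
... | o , refl = ≤-reflexive (begin
  ∣ m - (2 * m + o ∸ m) ∣ + 2 * m ≡⟨ cong (λ k → ∣ m - k ∣ + 2 * m) (trans (cong (_∸ m) eq) (m+n∸m≡n m (m + o))) ⟩
  ∣ m - (m + o) ∣ + 2 * m         ≡⟨ cong (_+ 2 * m) (∣m-m+n∣≡n m o) ⟩
  o + 2 * m                       ≡⟨ +-comm o (2 * m) ⟩
  2 * m + o                       ∎)
  where
  open ≡-Reasoning
  eq : 2 * m + o ≡ m + (m + o)
  eq = solve (m ∷ o ∷ [])

Light-moSum : ∀ n R → Light n R → moSum n R + 2 * distances R ≤ n * below R
Light-moSum n •       _           = z≤n
Light-moSum n (X ▸ Y) (h , a , b) =
  lemma (below X) (below Y) (size X) (distances X) (distances Y) (moSum n X) (moSum n Y) ∣ size X - (n ∸ size X) ∣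
    (n≡∣m-[n∸m]∣+2m (size X) n h) (Light-moSum n X a) (Light-moSum n Y b)
  where
  lemma : ∀ x y s d e u v i → i + 2 * s ≤ n → u + 2 * d ≤ n * x → v + 2 * e ≤ n * y →
          i + (u + v) + 2 * (s + (d + e)) ≤ n * (suc x + y)
  lemma x y s d e u v i h k l =
    deduce 0 (h ⊕ k ⊕ l) (solve (n ∷ x ∷ y ∷ s ∷ d ∷ e ∷ u ∷ v ∷ i ∷ []))

Light⇒moSum≤2loss : ∀ R → Light (size R) R → moSum (size R) R ≤ 2 * loss R
Light⇒moSum≤2loss R h = deduce 0 (Light-moSum (size R) R h ⊕ ≤-reflexive (sym (distances+loss R)))
  (solve′ (loss R) (moSum (size R) R) (distances R) (size R * below R))
  where
  solve′ : ∀ l u d k → u + (k + (2 * d + 2 * l)) + 0 ≡ 2 * l + (u + 2 * d + k)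
  solve′ l u d k = solve (l ∷ u ∷ d ∷ k ∷ [])

-- Vertices of degree other than two

others : ℕ → Rooted → ℕ
others e •       = when (¬? (e ≟ 2)) 1
others e (X ▸ Y) = others 1 X + others (suc e) Y

twos+others : ∀ e R → twos e R + others e R ≡ size R
twos+others e • with e ≟ 2
... | yes _ = refl
... | no _  = refl
twos+others e (X ▸ Y) = trans (+-interchange (twos 1 X) _ _ _) (cong₂ _+_ (twos+others 1 X) (twos+others (suc e) Y))

-- One less than the number of vertices of R whose degree is not two, where the
-- root of R has one further neighbour outside R.
kinks : Rooted → ℕ
kinks •                 = 0
kinks (X ▸ •)           = kinks X
kinks (X ▸ Z ▸ •)       = kinks X + kinks Z + 2
kinks (X ▸ Y@(_ ▸ _ ▸ _)) = suc (kinks X + kinks Y)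

others-high : ∀ e R → others (3 + e) R ≡ others 3 R
others-high e •       = refl
others-high e (X ▸ Y) = cong (others 1 X +_) (trans (others-high (suc e) Y) (sym (others-high 1 Y)))

others≡1+kinks : ∀ R → others 1 R ≡ suc (kinks R)
others≡1+kinks •       = refl
others≡1+kinks (X ▸ •) = trans (+-identityʳ _) (others≡1+kinks X)
others≡1+kinks (X ▸ Z ▸ •) rewrite others≡1+kinks X | others≡1+kinks Z = eq (kinks X) (kinks Z)
  where
  eq : ∀ x z → suc x + (suc z + 1) ≡ suc (x + z + 2)
  eq x z = solve (x ∷ z ∷ [])
others≡1+kinks (X ▸ Y@(Z ▸ W ▸ U)) = begin
  others 1 X + (others 1 Z + (others 1 W + others 4 U))
    ≡⟨ cong (λ o → others 1 X + (others 1 Z + (others 1 W + o))) (others-high 1 U) ⟩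
  others 1 X + others 1 Y          ≡⟨ cong₂ _+_ (others≡1+kinks X) (others≡1+kinks Y) ⟩
  suc (kinks X + suc (kinks Y))    ≡⟨ cong suc (+-suc (kinks X) (kinks Y)) ⟩
  suc (suc (kinks X + kinks Y))    ∎
  where open ≡-Reasoning

kinks≥2 : ∀ X Z Y → 2 ≤ kinks (X ▸ Z ▸ Y)
kinks≥2 X Z •       = m≤n+m 2 _
kinks≥2 X Z (W ▸ U) = m≤n⇒m≤1+n (≤-trans (kinks≥2 Z W U) (m≤n+m _ (kinks X)))

-- Without a branching vertex, the end leaf is the only vertex of degree other than two; a branching
-- vertex brings two leaves along, which makes at least three.
kinks≢1 : ∀ R → kinks R ≢ 1
kinks≢1 (X ▸ •)     e = kinks≢1 X e
kinks≢1 (X ▸ Z ▸ Y) e with subst (2 ≤_) e (kinks≥2 X Z Y)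
... | s≤s ()

kinks≤below : ∀ R → kinks R ≤ below R
kinks≤below •           = z≤n
kinks≤below (X ▸ •)     = ≤-trans (kinks≤below X) (m≤n⇒m≤1+n (m≤m+n _ 0))
kinks≤below (X ▸ Z ▸ •) = lemma (kinks X) (kinks Z) (below X) (below Z) (kinks≤below X) (kinks≤below Z)
  where
  lemma : ∀ p q x z → p ≤ x → q ≤ z → p + q + 2 ≤ suc x + (suc z + 0)
  lemma p q x z h k = deduce 0 (h ⊕ k) (solve (p ∷ q ∷ x ∷ z ∷ []))
kinks≤below (X ▸ Y@(_ ▸ _ ▸ _)) = s≤s (+-mono-≤ (kinks≤below X) (kinks≤below Y))

kinks<size : ∀ R → suc (kinks R) ≤ size R
kinks<size R = ≤-trans (s≤s (kinks≤below R)) (≤-reflexive (sym (size≡1+below R)))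

-- For two branches, `p² + q² + 4(p + 1)(q + 1)` is `(p + q + 2)² + 2pq`. For more,
-- `p² + q² + 4(p + 1)q` is at least `(p + q + 1)²` because `q ≥ 2`.
kinks²≤4loss : ∀ R → kinks R * kinks R ≤ 4 * loss R
kinks²≤4loss •           = z≤n
kinks²≤4loss (X ▸ •)     = lemma (kinks X) (loss X) (size X) (kinks²≤4loss X)
  where
  lemma : ∀ p l s → p * p ≤ 4 * l → p * p ≤ 4 * (l + 0 + s * 0)
  lemma p l s h = deduce 0 h (solve (p ∷ l ∷ s ∷ []))
kinks²≤4loss (X ▸ Z ▸ •) =
  lemma (kinks X) (kinks Z) (loss X) (loss Z) (size X) (size Z)
    (kinks²≤4loss X) (kinks²≤4loss Z) (kinks<size X) (kinks<size Z)
    (≤-reflexive (sym (below-▸• Z)))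
  where
  lemma : ∀ p q l k m n → p * p ≤ 4 * l → q * q ≤ 4 * k → suc p ≤ m → suc q ≤ n →
          ∀ {b} → n ≤ b →
          (p + q + 2) * (p + q + 2) ≤ 4 * (l + (k + 0 + n * 0) + m * b)
  lemma p q l k m n h₁ h₂ h₃ h₄ {b} h₅ = deduce (2 * (p * q))
    (h₁ ⊕ h₂ ⊕ scale 4 (h₃ ⊗ (≤-trans h₄ h₅))) (solve (p ∷ q ∷ l ∷ k ∷ m ∷ n ∷ b ∷ []))
kinks²≤4loss (X ▸ Y@(Z ▸ W ▸ U)) =
  lemma (kinks X) (kinks Y) (loss X) (loss Y) (size X) (below Y)
    (kinks²≤4loss X) (kinks²≤4loss Y) (kinks<size X) (kinks≤below Y) (kinks≥2 Z W U)
  where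
  lemma : ∀ p q l k m n → p * p ≤ 4 * l → q * q ≤ 4 * k → suc p ≤ m → q ≤ n → 2 ≤ q →
          suc (p + q) * suc (p + q) ≤ 4 * (l + k + m * n)
  lemma p 1 l k m n _ _ _ _ (s≤s ())
  lemma p (suc (suc q)) l k m n h₁ h₂ h₃ h₄ h₅ = deduce (2 * p * q + 2 * p + 2 * q + 3)
    (h₁ ⊕ h₂ ⊕ scale 4 (h₃ ⊗ h₄)) (solve (p ∷ q ∷ l ∷ k ∷ m ∷ n ∷ []))

-- The shapes of least loss

∼-size : ∀ {X Y} → X ∼ Y → size X ≡ size Y
∼-size ∼-refl        = refl
∼-size (∼-trans p q) = trans (∼-size p) (∼-size q)
∼-size (▸-cong p q)  = cong₂ _+_ (∼-size p) (∼-size q)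
∼-size (▸-comm X Y Z) = lemma (size X) (size Y) (size Z)
  where
  lemma : ∀ x y z → x + (y + z) ≡ y + (x + z)
  lemma x y z = solve (x ∷ y ∷ z ∷ [])

-- Vertices of degree two added above the root; they change neither `kinks` nor `loss`.
ext : ℕ → Rooted → Rooted
ext zero    R = R
ext (suc j) R = ext j R ▸ •

-- Each tooth is a vertex of degree three together with its leaf, so it adds two kinks.
comb : ℕ → Rooted → Rooted
comb zero    R = R
comb (suc k) R = • ▸ comb k R ▸ •

-- Its four vertices give three kinks, the smallest odd value; the edge above the root makes the
-- degree of the root four.
claw : Rooted
claw = • ▸ • ▸ • ▸ •

size-ext : ∀ j R → size (ext j R) ≡ j + size R
size-ext zero    R = refl
size-ext (suc j) R = trans (+-comm _ 1) (cong suc (size-ext j R))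

size-comb : ∀ k R → size (comb k R) ≡ 2 * k + size R
size-comb zero    R = refl
size-comb (suc k) R = trans (cong (λ s → suc (s + 1)) (size-comb k R)) (eq (size R))
  where
  eq : ∀ s → suc (2 * k + s + 1) ≡ 2 * suc k + s
  eq s = solve (k ∷ s ∷ [])

kinks-ext : ∀ j R → kinks (ext j R) ≡ kinks R
kinks-ext zero    R = refl
kinks-ext (suc j) R = kinks-ext j R

kinks-comb : ∀ k R → kinks (comb k R) ≡ 2 * k + kinks R
kinks-comb zero    R = refl
kinks-comb (suc k) R = trans (cong (_+ 2) (kinks-comb k R)) (eq (kinks R))
  where
  eq : ∀ s → 2 * k + s + 2 ≡ 2 * suc k + s
  eq s = solve (k ∷ s ∷ [])

loss-ext : ∀ j R → loss (ext j R) ≡ loss R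
loss-ext zero    R = refl
loss-ext (suc j) R = trans (trans (cong₂ _+_ (+-identityʳ _) (*-zeroʳ (size (ext j R)))) (+-identityʳ _)) (loss-ext j R)

-- The caterpillars of least loss for their number of kinks.
data Shape (R : Rooted) : Set where
  even : ∀ k j → R ∼ ext j (comb k •)    → kinks R ≡ 2 * k     → Shape R
  odd  : ∀ k j → R ∼ ext j (comb k claw) → kinks R ≡ 2 * k + 3 → Shape R

size≡1⇒• : ∀ R → size R ≡ 1 → R ≡ •
size≡1⇒• •       _ = refl
size≡1⇒• (X ▸ Y) e with size X | size≡1+below X | size Y | size≡1+below Y
... | _ | refl | _ | refl with () ← trans (sym (+-suc (below X) (below Y))) (suc-injective e)

below≡0⇒• : ∀ R → below R ≡ 0 → R ≡ •
below≡0⇒• • _ = refl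

-- `d` and `f` are the excess of the sizes over their minimum. A positive one costs at least 4, and
-- the surplus `2pq` of the two-branch estimate is at most 3 only for `pq ≤ 1`.
two-branches : ∀ p q l k d f → p * p ≤ 4 * l → q * q ≤ 4 * k →
  4 * (l + k + (suc p + d) * (suc q + f)) ≤ (p + q + 2) * (p + q + 2) + 3 →
  d ≡ 0 × f ≡ 0 × ((p ≡ 0 × 4 * k ≤ q * q + 3) ⊎ (q ≡ 0 × 4 * l ≤ p * p + 3) ⊎ (p ≡ 1 × q ≡ 1))
two-branches p q l k (suc d) f h₁ h₂ h = contradiction {A = 4 ≤ 3}
  (deduce (8 * f + 4 * (d * f) + 4 * q + 4 * (d * q) + 4 * (f * p) + 2 * (p * q) + 4 * d)
    (h₁ ⊕ h₂ ⊕ h) (solve (p ∷ q ∷ l ∷ k ∷ d ∷ f ∷ []))) (<⇒≱ (s≤s ≤-refl))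
two-branches p q l k zero (suc f) h₁ h₂ h = contradiction {A = 4 ≤ 3}
  (deduce (4 * p + 4 * (f * p) + 2 * (p * q) + 4 * f)
    (h₁ ⊕ h₂ ⊕ h) (solve (p ∷ q ∷ l ∷ k ∷ f ∷ []))) (<⇒≱ (s≤s ≤-refl))
two-branches zero q l k zero zero h₁ h₂ h = refl , refl , inj₁ (refl ,
  deduce 0 (h₁ ⊕ h) (solve (q ∷ l ∷ k ∷ [])))
two-branches (suc p) zero l k zero zero h₁ h₂ h = refl , refl , inj₂ (inj₁ (refl ,
  deduce 0 (h₂ ⊕ h) (solve (p ∷ l ∷ k ∷ []))))
two-branches 1 1 l k zero zero h₁ h₂ h = refl , refl , inj₂ (inj₂ (refl , refl))
two-branches (suc (suc p)) (suc q) l k zero zero h₁ h₂ h = contradiction {A = 4 ≤ 3}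
  (deduce (2 * (p * q) + 2 * p + 4 * q)
    (h₁ ⊕ h₂ ⊕ h) (solve (p ∷ q ∷ l ∷ k ∷ []))) (<⇒≱ (s≤s ≤-refl))
two-branches 1 (suc (suc q)) l k zero zero h₁ h₂ h = contradiction {A = 4 ≤ 3}
  (deduce (2 * q)
    (h₁ ⊕ h₂ ⊕ h) (solve (q ∷ l ∷ k ∷ []))) (<⇒≱ (s≤s ≤-refl))

-- With three or more branches the surplus is 3 already at the minimum, which is reached by three
-- leaves only.
many-branches : ∀ p r l k d f → p * p ≤ 4 * l → (2 + r) * (2 + r) ≤ 4 * k →
  4 * (l + k + (suc p + d) * (2 + r + f)) ≤ suc (p + (2 + r)) * suc (p + (2 + r)) + 3 →
  d + f + p + r ≤ 0
many-branches p r l k d f h₁ h₂ h = deduce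
  (4 * (d * f) + 4 * (d * r) + 4 * (f * p) + 2 * (p * r) + 7 * d + 3 * f + p + r)
  (h₁ ⊕ h₂ ⊕ h) (solve (p ∷ r ∷ l ∷ k ∷ d ∷ f ∷ []))

-- The size leaves no room for vertices of degree two, so a comb can be continued without a gap.
ext-trivial : ∀ j k R {Z} → Z ∼ ext j (comb k R) → size Z ≡ 2 * k + size R → j ≡ 0
ext-trivial j k R {Z} s e = +-cancelʳ-≡ (size Z) j 0 (begin
  j + size Z              ≡⟨ cong (j +_) (trans e (sym (size-comb k R))) ⟩
  j + size (comb k R)     ≡⟨ size-ext j (comb k R) ⟨
  size (ext j (comb k R)) ≡⟨ ∼-size s ⟨
  size Z                  ∎)
  where open ≡-Reasoning

leaf▸shape : ∀ Z → Shape Z → size Z ≡ suc (kinks Z) → Shape (• ▸ Z ▸ •)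
leaf▸shape Z (even k j s e) sz
  with refl ← ext-trivial j k • s (trans sz (trans (cong suc e) (+-comm 1 (2 * k)))) =
  even (suc k) 0 (▸-cong ∼-refl (▸-cong s ∼-refl)) (trans (cong (_+ 2) e) (solve (k ∷ [])))
leaf▸shape Z (odd k j s e) sz
  with refl ← ext-trivial j k claw s (trans sz (trans (cong suc e) (sym (+-suc (2 * k) 3)))) =
  odd (suc k) 0 (▸-cong ∼-refl (▸-cong s ∼-refl)) (trans (cong (_+ 2) e) (solve (k ∷ [])))

shape-∼ : ∀ {R S} → R ∼ S → kinks R ≡ kinks S → Shape S → Shape R
shape-∼ p e (even k j s e′) = even k j (∼-trans p s) (trans e e′)
shape-∼ p e (odd k j s e′)  = odd k j (∼-trans p s) (trans e e′)

-- The hypothesis says that the loss is `p² / 4` rounded up; for odd `p` this is `(p² + 3) / 4`, the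
-- loss of a comb over `claw`.
tight⇒shape : ∀ R → 4 * loss R ≤ kinks R * kinks R + 3 → Shape R
tight⇒shape • h = even 0 0 ∼-refl refl
tight⇒shape (X ▸ •) h with tight⇒shape X (subst (λ l → 4 * l ≤ kinks X * kinks X + 3) (loss-ext 1 X) h)
... | even k j s e = even k (suc j) (▸-cong s ∼-refl) e
... | odd k j s e  = odd k (suc j) (▸-cong s ∼-refl) e
tight⇒shape (X ▸ Z ▸ •) h
  with m≤n⇒∃[o]m+o≡n (kinks<size X) | m≤n⇒∃[o]m+o≡n (kinks<size Z)
... | d , ed | f , ef
  with two-branches (kinks X) (kinks Z) (loss X) (loss Z) d f (kinks²≤4loss X) (kinks²≤4loss Z)
         (subst₂ (λ m n → 4 * (loss X + loss Z + m * n) ≤ (kinks X + kinks Z + 2) * (kinks X + kinks Z + 2) + 3) (sym ed) (sym ef)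
           (subst₂ (λ k b → 4 * (loss X + k + size X * b) ≤ (kinks X + kinks Z + 2) * (kinks X + kinks Z + 2) + 3) (loss-ext 1 Z) (below-▸• Z) h))
... | refl , refl , inj₁ (p≡0 , hZ)
  with refl ← size≡1⇒• X (trans (sym ed) (trans (+-identityʳ _) (cong suc p≡0))) =
  leaf▸shape Z (tight⇒shape Z hZ) (trans (sym ef) (+-identityʳ _))
... | refl , refl , inj₂ (inj₁ (q≡0 , hX))
  with refl ← size≡1⇒• Z (trans (sym ef) (trans (+-identityʳ _) (cong suc q≡0))) =
  shape-∼ (▸-comm X • •) (cong (_+ 2) (+-identityʳ (kinks X)))
    (leaf▸shape X (tight⇒shape X hX) (trans (sym ed) (+-identityʳ _)))
... | refl , refl , inj₂ (inj₂ (p≡1 , _)) = contradiction p≡1 (kinks≢1 X)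
tight⇒shape (X ▸ Y@(Z ▸ W ▸ U)) h
  with m≤n⇒∃[o]m+o≡n (kinks<size X) | m≤n⇒∃[o]m+o≡n (kinks≤below Y) | m≤n⇒∃[o]m+o≡n (kinks≥2 Z W U)
... | d , ed | f , ef | r , er = go zeros
  where
  total : d + f + kinks X + r ≤ 0
  total = many-branches (kinks X) r (loss X) (loss Y) d f (kinks²≤4loss X)
    (subst (λ q → q * q ≤ 4 * loss Y) (sym er) (kinks²≤4loss Y))
    (subst (λ q → 4 * (loss X + loss Y + (suc (kinks X) + d) * (q + f)) ≤
                  suc (kinks X + q) * suc (kinks X + q) + 3) (sym er)
      (subst₂ (λ m n → 4 * (loss X + loss Y + m * n) ≤ suc (kinks X + kinks Y) * suc (kinks X + kinks Y) + 3) (sym ed) (sym ef) h))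
  zeros : (d ≡ 0 × f ≡ 0) × kinks X ≡ 0 × r ≡ 0
  zeros =
    let e  = n≤0⇒n≡0 total
        e′ = m+n≡0⇒m≡0 (d + f + kinks X) e
        e″ = m+n≡0⇒m≡0 (d + f) e′
    in (m+n≡0⇒m≡0 d e″ , m+n≡0⇒n≡0 d e″) , m+n≡0⇒n≡0 (d + f) e′ , m+n≡0⇒n≡0 (d + f + kinks X) e
  leaves : ∀ Z W U → below (Z ▸ W ▸ U) ≡ 2 → (Z ≡ • × W ≡ •) × U ≡ •
  leaves Z W U e =
    let e′ = m+n≡0⇒m≡0 (below Z) eq
        e″ = m+n≡0⇒n≡0 (below Z) eq
    in (below≡0⇒• Z e′ , below≡0⇒• W (m+n≡0⇒m≡0 (below W) e″)) , below≡0⇒• U (m+n≡0⇒n≡0 (below W) e″)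
    where
    eq : below Z + (below W + below U) ≡ 0
    eq = suc-injective (suc-injective (trans (cong suc (sym (+-suc (below Z) _))) e))
  go : (d ≡ 0 × f ≡ 0) × kinks X ≡ 0 × r ≡ 0 → Shape (X ▸ Z ▸ W ▸ U)
  go ((refl , refl) , kX≡0 , refl)
    with refl ← size≡1⇒• X (trans (sym ed) (trans (+-identityʳ _) (cong suc kX≡0)))
       | (refl , refl) , refl ← leaves Z W U (trans (sym ef) (trans (+-identityʳ _) (sym er))) =
    odd 0 0 ∼-refl refl

-- Centroids

infixr 6 _⧺_

-- Identifies the roots.
_⧺_ : Rooted → Rooted → Rooted
•       ⧺ B = B
(X ▸ Y) ⧺ B = X ▸ Y ⧺ B

below-⧺ : ∀ A B → below (A ⧺ B) ≡ below A + below B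
below-⧺ •       B = refl
below-⧺ (X ▸ Y) B = trans (cong (suc (below X) +_) (below-⧺ Y B)) (sym (+-assoc (suc (below X)) (below Y) (below B)))

loss-⧺ : ∀ A B → loss (A ⧺ B) ≡ loss A + loss B + below A * below B
loss-⧺ •       B = sym (+-identityʳ _)
loss-⧺ (X ▸ Y) B rewrite loss-⧺ Y B | below-⧺ Y B | size≡1+below X =
  lemma (loss X) (loss Y) (loss B) (below X) (below Y) (below B)
  where
  lemma : ∀ k l m x y b → k + (l + m + y * b) + suc x * (y + b) ≡ k + l + suc x * y + m + (suc x + y) * b
  lemma k l m x y b = solve (k ∷ l ∷ m ∷ x ∷ y ∷ b ∷ [])

-- The number of vertices of degree other than two in the branches at the root.
branchSum : Rooted → ℕ
branchSum •       = 0
branchSum (X ▸ Y) = suc (kinks X) + branchSum Y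

branchSum-⧺ : ∀ A B → branchSum (A ⧺ B) ≡ branchSum A + branchSum B
branchSum-⧺ •       B = refl
branchSum-⧺ (X ▸ Y) B = trans (cong (suc (kinks X) +_) (branchSum-⧺ Y B)) (sym (+-assoc (suc (kinks X)) _ _))

branchSum≡kinks : ∀ X Z Y → branchSum (X ▸ Z ▸ Y) ≡ kinks (X ▸ Z ▸ Y)
branchSum≡kinks X Z •       = lemma (kinks X) (kinks Z)
  where
  lemma : ∀ x z → suc x + (suc z + 0) ≡ x + z + 2
  lemma x z = solve (x ∷ z ∷ [])
branchSum≡kinks X Z (W ▸ U) = cong (suc (kinks X) +_) (branchSum≡kinks Z W U)

-- For `N = below R` the two sides of the edge above a branch then differ by at least three, so no
-- edge at the root is balanced.
Small : ℕ → Rooted → Set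
Small N •       = ⊤
Small N (X ▸ Y) = 2 + 2 * size X ≤ N × Small N Y

-- `M` is the branch with which the running total of the sizes, starting from `a`, first reaches
-- `N / 2`. From `a = 0` and `N = below R`, the branches before it, `M` itself and the branches
-- after it are three groups within half of `N`.
record Crossing (N a : ℕ) (R : Rooted) : Set where
  field
    A M B   : Rooted
    split   : R ≡ A ⧺ (M ▸ B)
    before  : 2 * (a + below A) < N
    after   : N ≤ 2 * (a + below A + size M)
    A-small : Small N A
    M-small : 2 + 2 * size M ≤ N
    B-small : Small N B

crossing : ∀ N a R → 2 * a < N → N ≤ 2 * (a + below R) → Small N R → Crossing N a R
crossing N a • h k _ = contradiction (subst (λ b → N ≤ 2 * b) (+-identityʳ a) k) (<⇒≱ h)
crossing N a (X ▸ Y) h k (sX , sY) with N ≤? 2 * (a + size X)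
... | yes p = record
  { A = • ; M = X ; B = Y ; split = refl
  ; before = subst (λ b → 2 * b < N) (sym (+-identityʳ a)) h
  ; after = subst (λ b → N ≤ 2 * (b + size X)) (sym (+-identityʳ a)) p
  ; A-small = tt ; M-small = sX ; B-small = sY }
... | no ¬p = let open Crossing rec in record
  { A = X ▸ A ; M = M ; B = B ; split = cong (X ▸_) split
  ; before = subst (λ b → 2 * b < N) (assoc A) before
  ; after = subst (λ b → N ≤ 2 * (b + size M)) (assoc A) after
  ; A-small = sX , A-small ; M-small = M-small ; B-small = B-small }
  where
  assoc : ∀ A → a + size X + below A ≡ a + (suc (below X) + below A)
  assoc A = trans (+-assoc a _ _) (cong (λ s → a + (s + below A)) (size≡1+below X))
  rec : Crossing N (a + size X) Y
  rec = crossing N (a + size X) Y (≰⇒> ¬p) (subst (λ b → N ≤ 2 * b) (sym (assoc Y)) k) sY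

data Branches : Rooted → Set where
  none : Branches •
  one  : ∀ Z → Branches (Z ▸ •)
  many : ∀ X Z Y → Branches (X ▸ Z ▸ Y)

branches : ∀ R → Branches R
branches •           = none
branches (Z ▸ •)     = one Z
branches (X ▸ Z ▸ Y) = many X Z Y

-- From `x + y ≤ 1 + xy` for positive `x` and `y`. It feeds the sharper bound for `σ = 3`.
below≤1+loss : ∀ X Z Y → below (X ▸ Z ▸ Y) ≤ 1 + loss (X ▸ Z ▸ Y)
below≤1+loss X Z Y = lemma (below X) (below Z + below Y) (size X) (loss X + loss (Z ▸ Y)) (≤-reflexive (sym (size≡1+below X)))
  where
  lemma : ∀ x b s l → suc x ≤ s → suc x + suc b ≤ 1 + (l + s * suc b)
  lemma x b s l h = deduce (l + x * b) (h ⊗ ≤-refl {suc b}) (solve (x ∷ b ∷ s ∷ l ∷ []))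

-- Over a single branch the root counts as a vertex of degree two, so `kinks` is one less than the
-- count in the branch and `κ = 1`. Over several branches the root itself makes up for that one.
group : ∀ {N} R → R ≢ • → Small N R → 2 * below R ≤ N →
        ∃ λ κ → Group N (below R) (kinks R) κ × branchSum R ≡ kinks R + κ × (κ ≡ 0 → below R ≤ 1 + loss R)
group {N} R ne s h with branches R
... | none       = contradiction refl ne
... | one Z      = 1 ,
  subst (λ b → Group N b (kinks Z) 1) (sym (below-▸• Z)) (single (kinks<size Z) (kinks≢1 Z) (proj₁ s)) ,
  trans (+-identityʳ _) (+-comm 1 (kinks Z)) , λ ()
... | many X Z Y = 0 , multi (kinks≤below R) (kinks≥2 X Z Y) h ,
  trans (branchSum≡kinks X Z Y) (sym (+-identityʳ _)) , λ _ → below≤1+loss X Z Y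

-- `33` is `25 + 8`, where the `8` is lost in passing from `m₁` to `l₁` by `m₁ ≤ 1 + l₁`. The slack
-- `x` plays the role of `a` in `Core`, but `m₁` may be any of the three sizes in order.
claw-spread : ∀ {N} m₁ m₂ m₃ → N ≡ m₁ + m₂ + m₃ → 2 * m₁ ≤ N → 2 + 2 * m₂ ≤ N → 2 + 2 * m₃ ≤ N → 5 ≤ N →
  2 * (m₁ * m₁ + m₂ * m₂ + m₃ * m₃) + 33 ≤ 8 * m₁ + 4 * (m₁ * m₂ + m₁ * m₃ + m₂ * m₃)
claw-spread m₁ m₂ m₃ refl h₁ h₂ h₃ h with m≤n⇒∃[o]m+o≡n m₁≤
  where
  m₁≤ : m₁ ≤ m₂ + m₃
  m₁≤ = deduce 0 h₁ (solve (m₁ ∷ m₂ ∷ m₃ ∷ []))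
... | x , e = deduce 0 (≤-reflexive (sym (heron-identity m₁ m₂ m₃ x e)) ⊕
                        gap x m₂ m₃ e x≤₂ x≤₃ (≤-trans h (≤-reflexive (+-assoc m₁ m₂ m₃))))
  (solve (m₁ ∷ m₂ ∷ m₃ ∷ x ∷ []))
  where
  x≤₂ : 2 + x ≤ 2 * m₂
  x≤₂ = deduce 0 (h₃ ⊕ ≤-reflexive e) (solve (m₁ ∷ m₂ ∷ m₃ ∷ x ∷ []))
  x≤₃ : 2 + x ≤ 2 * m₃
  x≤₃ = deduce 0 (h₂ ⊕ ≤-reflexive e) (solve (m₁ ∷ m₂ ∷ m₃ ∷ x ∷ []))
  gap : ∀ x m₂ m₃ → m₁ + x ≡ m₂ + m₃ → 2 + x ≤ 2 * m₂ → 2 + x ≤ 2 * m₃ → 5 ≤ m₁ + (m₂ + m₃) →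
        33 + 2 * (x * x) ≤ 8 * m₁ + 8 * (m₂ * m₃)
  gap 0 1 1 e _ _ h = contradiction {A = 5 ≤ 4} (deduce 0 (h ⊕ ≤-reflexive e) (solve (m₁ ∷ []))) (<⇒≱ (s≤s ≤-refl))
  gap 0 (suc (suc y)) (suc z) e _ _ _ = deduce (8 * (y * z) + 16 * y + 24 * z + 7) (scale 8 (≤-reflexive (sym e)))
    (solve (m₁ ∷ y ∷ z ∷ []))
  gap 0 1 (suc (suc z)) e _ _ _ = deduce (16 * z + 7) (scale 8 (≤-reflexive (sym e))) (solve (m₁ ∷ z ∷ []))
  gap 1 (suc (suc y)) (suc (suc z)) e _ _ h = deduce (8 * (y * z) + 24 * y + 24 * z + 21) (scale 8 (≤-reflexive (sym e)))
    (solve (m₁ ∷ y ∷ z ∷ []))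
  gap 1 1 _ e (s≤s (s≤s ())) _ _
  gap 1 (suc (suc _)) 1 e _ (s≤s (s≤s ())) _
  -- From slack two on, twice the square of the slack plus four is at most `8(m₂ + 1)(m₃ + 1)`, and
  -- `m₂ + m₃` exceeds `m₁` by the slack.
  gap (suc (suc x)) m₂ m₃ e h₂ h₃ _ = deduce (8 * x + 7)
    (scale 2 ((≤-refl {2} ⊕ h₂) ⊗ (≤-refl {2} ⊕ h₃)) ⊕ scale 8 (≤-reflexive (sym e)))
    (solve (m₁ ∷ m₂ ∷ m₃ ∷ x ∷ []))

-- `σ` is the value of `p + q` at any edge of the same tree. The constants `8` and `25` are one
-- above what the competitors at a balanced edge allow: `σ² + 7` in general and `24` for `σ = 3`.
record Centred (R : Rooted) : Set where
  field
    σ        : ℕ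
    kinks≡   : kinks R ≡ suc σ
    others≡  : others 0 R ≡ others 1 R
    loss≥    : 2 * (below R * below R) + σ * σ + 8 ≤ 8 * loss R
    loss≥-3  : σ ≡ 3 → 2 * (below R * below R) + 25 ≤ 8 * loss R

-- The root has at least three branches, so its degree is not two with or without an outer
-- neighbour.
others-0≡1 : ∀ A X B → A ≢ • → B ≢ • → others 0 (A ⧺ (X ▸ B)) ≡ others 1 (A ⧺ (X ▸ B))
others-0≡1 •       X B       ne _  = contradiction refl ne
others-0≡1 (_ ▸ _) X •       _  ne = contradiction refl ne
others-0≡1 (Y ▸ A) X (Z ▸ B) _  _  = cong (others 1 Y +_) (two A)
  where
  two : ∀ A → others 1 (A ⧺ (X ▸ Z ▸ B)) ≡ others 2 (A ⧺ (X ▸ Z ▸ B))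
  two •       = cong (λ o → others 1 X + (others 1 Z + o)) (sym (others-high 1 B))
  two (W ▸ A) = cong (others 1 W +_) (three A)
    where
    three : ∀ A → others 2 (A ⧺ (X ▸ Z ▸ B)) ≡ others 3 (A ⧺ (X ▸ Z ▸ B))
    three •       = cong (λ o → others 1 X + (others 1 Z + o)) (trans (others-high 1 B) (sym (others-high 2 B)))
    three (U ▸ A) = cong (others 1 U +_) (sym (others-high 1 (A ⧺ (X ▸ Z ▸ B))))

kinks≡branchSum : ∀ A X B → A ≢ • → kinks (A ⧺ (X ▸ B)) ≡ branchSum (A ⧺ (X ▸ B))
kinks≡branchSum •           X B ne = contradiction refl ne
kinks≡branchSum (Y ▸ •)     X B _  = sym (branchSum≡kinks Y X B)
kinks≡branchSum (Y ▸ Z ▸ A) X B _  = sym (branchSum≡kinks Y Z (A ⧺ (X ▸ B)))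

centred-loss : ∀ κ m₁ m₂ m₃ p₁ p₂ p₃ l₁ l₂ l₃ → Spread κ m₁ m₂ m₃ p₁ p₂ p₃ →
  p₁ * p₁ ≤ 4 * l₁ → p₂ * p₂ ≤ 4 * l₂ → p₃ * p₃ ≤ 4 * l₃ →
  2 * ((m₁ + m₂ + m₃) * (m₁ + m₂ + m₃)) + (p₁ + p₂ + p₃ + κ) * (p₁ + p₂ + p₃ + κ) + 8
  ≤ 8 * (l₁ + l₂ + l₃ + (m₁ * m₂ + m₁ * m₃ + m₂ * m₃))
centred-loss κ m₁ m₂ m₃ p₁ p₂ p₃ l₁ l₂ l₃ h h₁ h₂ h₃ =
  deduce 0 (h ⊕ scale 2 h₁ ⊕ scale 2 h₂ ⊕ scale 2 h₃)
    (solve (κ ∷ m₁ ∷ m₂ ∷ m₃ ∷ p₁ ∷ p₂ ∷ p₃ ∷ l₁ ∷ l₂ ∷ l₃ ∷ []))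

claw-loss : ∀ {N} m₁ m₂ m₃ l₁ l₂ l₃ → N ≡ m₁ + m₂ + m₃ → 2 * m₁ ≤ N → 2 + 2 * m₂ ≤ N → 2 + 2 * m₃ ≤ N →
  5 ≤ N → m₁ ≤ 1 + l₁ →
  2 * ((m₁ + m₂ + m₃) * (m₁ + m₂ + m₃)) + 25 ≤ 8 * (l₁ + l₂ + l₃ + (m₁ * m₂ + m₁ * m₃ + m₂ * m₃))
claw-loss m₁ m₂ m₃ l₁ l₂ l₃ e h₁ h₂ h₃ h k =
  deduce (8 * l₂ + 8 * l₃) (claw-spread m₁ m₂ m₃ e h₁ h₂ h₃ h ⊕ scale 8 k)
    (solve (m₁ ∷ m₂ ∷ m₃ ∷ l₁ ∷ l₂ ∷ l₃ ∷ []))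

no-kink-sum : ∀ {p q r} → p ≢ 1 → q ≢ 1 → r ≢ 1 → p + q + r ≢ 1
no-kink-sum {zero}        {zero}          _ _ r≢1 e = r≢1 e
no-kink-sum {zero}        {suc zero}      _ q≢1 _ e = q≢1 refl
no-kink-sum {suc zero}    p≢1 _ _ e = p≢1 refl

-- For `σ = 3` exactly one group has several branches: with none the `pᵢ` would add up to one, with
-- two they would add up to at least four.
three-groups : ∀ {N m₁ m₂ m₃ p₁ p₂ p₃ κ₁ κ₃} l₁ l₂ l₃ →
  Group N m₁ p₁ κ₁ → Group N m₂ p₂ 1 → Group N m₃ p₃ κ₃ → N ≡ m₁ + m₂ + m₃ → 5 ≤ N →
  (κ₁ ≡ 0 → m₁ ≤ 1 + l₁) → (κ₃ ≡ 0 → m₃ ≤ 1 + l₃) → p₁ + p₂ + p₃ + (κ₁ + κ₃) ≡ 3 →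
  2 * ((m₁ + m₂ + m₃) * (m₁ + m₂ + m₃)) + 25 ≤ 8 * (l₁ + l₂ + l₃ + (m₁ * m₂ + m₁ * m₃ + m₂ * m₃))
three-groups {p₁ = p₁} {p₂} {p₃} l₁ l₂ l₃ (single h₁ n₁ s₁) (single h₂ n₂ s₂) (single h₃ n₃ s₃) N≡ h _ _ e =
  contradiction (+-cancelʳ-≡ 2 (p₁ + p₂ + p₃) 1 e) (no-kink-sum n₁ n₂ n₃)
three-groups {m₁ = m₁} {m₂} {m₃} l₁ l₂ l₃ (multi h₁ n₁ s₁) (single h₂ n₂ s₂) (single h₃ n₃ s₃) N≡ h k _ e =
  claw-loss m₁ m₂ m₃ l₁ l₂ l₃ N≡ s₁ s₂ s₃ h (k refl)
three-groups {m₁ = m₁} {m₂} {m₃} l₁ l₂ l₃ (single h₁ n₁ s₁) (single h₂ n₂ s₂) (multi h₃ n₃ s₃) N≡ h _ k e =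
  deduce 0 (claw-loss m₃ m₂ m₁ l₃ l₂ l₁ (trans N≡ reversed) s₃ s₂ s₁ h (k refl))
    (solve (m₁ ∷ m₂ ∷ m₃ ∷ l₁ ∷ l₂ ∷ l₃ ∷ []))
  where
  reversed : m₁ + m₂ + m₃ ≡ m₃ + m₂ + m₁
  reversed = solve (m₁ ∷ m₂ ∷ m₃ ∷ [])
three-groups {p₁ = p₁} {p₂} {p₃} l₁ l₂ l₃ (multi h₁ n₁ s₁) (single h₂ n₂ s₂) (multi h₃ n₃ s₃) N≡ h _ _ e =
  contradiction {A = 4 ≤ 3} (deduce p₂ (n₁ ⊕ n₃ ⊕ ≤-reflexive e) (solve (p₁ ∷ p₂ ∷ p₃ ∷ []))) (<⇒≱ (s≤s ≤-refl))

module _ (A M B : Rooted) where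

  private
    N = below (A ⧺ (M ▸ B))

    N≡ : N ≡ below A + size M + below B
    N≡ = trans (below-⧺ A (M ▸ B)) (trans (cong (λ s → below A + (s + below B)) (sym (size≡1+below M)))
      (sym (+-assoc (below A) (size M) (below B))))

    loss≡ : loss (A ⧺ (M ▸ B)) ≡
            loss A + loss M + loss B + (below A * size M + below A * below B + size M * below B)
    loss≡ = trans (loss-⧺ A (M ▸ B)) (trans
      (cong (λ s → loss A + (loss M + loss B + size M * below B) + below A * (s + below B)) (sym (size≡1+below M)))
      (lemma (loss A) (loss M) (loss B) (below A) (size M) (below B)))
      where
      lemma : ∀ k l m a s b → k + (l + m + s * b) + a * (s + b) ≡ k + l + m + (a * s + a * b + s * b)
      lemma k l m a s b = solve (k ∷ l ∷ m ∷ a ∷ s ∷ b ∷ [])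

  centred-⧺ : 2 * below A < N → N ≤ 2 * (below A + size M) →
              Small N A → 2 + 2 * size M ≤ N → Small N B → 5 ≤ N → Centred (A ⧺ (M ▸ B))
  centred-⧺ h h′ sA sM sB 5≤N = record
    { σ       = σ
    ; kinks≡  = trans (kinks≡branchSum A M B A≢•) (trans (branchSum-⧺ A (M ▸ B))
        (trans (cong₂ (λ a b → a + (suc (kinks M) + b)) (proj₁ (proj₂ (proj₂ gA))) (proj₁ (proj₂ (proj₂ gB))))
          (shuffle (kinks A) κA (kinks M) (kinks B) κB)))
    ; others≡ = others-0≡1 A M B A≢• B≢•
    ; loss≥   = subst₂ (λ n l → 2 * (n * n) + σ * σ + 8 ≤ 8 * l) (sym N≡) (sym loss≡)
        (centred-loss (κA + κB) (below A) (size M) (below B) (kinks A) (kinks M) (kinks B) (loss A) (loss M) (loss B)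
          (spread (κA + κB) GA GM GB (bump κA κB) N≡ 5≤N)
          (kinks²≤4loss A) (kinks²≤4loss M) (kinks²≤4loss B))
    ; loss≥-3 = λ e → subst₂ (λ n l → 2 * (n * n) + 25 ≤ 8 * l) (sym N≡) (sym loss≡)
        (three-groups (loss A) (loss M) (loss B) GA GM GB N≡ 5≤N
          (proj₂ (proj₂ (proj₂ gA))) (proj₂ (proj₂ (proj₂ gB))) e)
    }
    where
    shuffle : ∀ a k m b l → a + k + (suc m + (b + l)) ≡ suc (a + m + b + (k + l))
    shuffle a k m b l = solve (a ∷ k ∷ m ∷ b ∷ l ∷ [])
    bump : ∀ k l → k + 1 + l ≡ suc (k + l)
    bump k l = solve (k ∷ l ∷ [])
    A≢• : A ≢ •
    A≢• refl = <⇒≱ sM (≤-trans h′ (n≤1+n _))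
    B≢• : B ≢ •
    B≢• refl = contradiction {A = 3 ≤ 0} (lemma (below A) (size M) (≤-trans h (≤-reflexive N≡)) (≤-trans sM (≤-reflexive N≡))) λ ()
      where
      lemma : ∀ a m → suc (2 * a) ≤ a + m + 0 → 2 + 2 * m ≤ a + m + 0 → 3 ≤ 0
      lemma a m h k = deduce 0 (h ⊕ k) (solve (a ∷ m ∷ []))
    gA = group A A≢• sA (<⇒≤ h)
    gB = group B B≢• sB (lemma (below A) (size M) (below B) N≡ h′)
      where
      lemma : ∀ {n} a m b → n ≡ a + m + b → n ≤ 2 * (a + m) → 2 * b ≤ n
      lemma a m b refl k = deduce 0 k (solve (a ∷ m ∷ b ∷ []))
    κA = proj₁ gA
    κB = proj₁ gB
    σ = kinks A + kinks M + kinks B + (κA + κB)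
    GA = proj₁ (proj₂ gA)
    GB = proj₁ (proj₂ gB)
    GM : Group N (size M) (kinks M) 1
    GM = single (kinks<size M) (kinks≢1 M) sM

centred : ∀ R → Small (below R) R → 5 ≤ below R → Centred R
centred R s h with crossing (below R) 0 R (≤-trans (s≤s z≤n) h) (m≤m+n (below R) _) s
... | record { A = A ; M = M ; B = B ; split = refl ; before = b ; after = a
             ; A-small = sA ; M-small = sM ; B-small = sB } = centred-⧺ A M B b a sA sM sB h

-- The walk to a balanced edge or a centre

find-large : ∀ N R → Small N R ⊎ (∃ λ W → ∃ λ U → R ∼ W ▸ U × N < 2 + 2 * size W)
find-large N •       = inj₁ tt
find-large N (X ▸ Y) with 2 + 2 * size X ≤? N
... | no ¬p = inj₂ (X , Y , ∼-refl , ≰⇒> ¬p)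
... | yes p with find-large N Y
...   | inj₁ s                = inj₁ (p , s)
...   | inj₂ (W , U , q , h) = inj₂ (W , X ▸ U , ∼-trans (▸-cong ∼-refl q) (▸-comm X W U) , h)

-- At such an edge `size X` and `size Y - 1` differ by at most one, so their product is the largest
-- one for their sum.
data Centroid {A : Set} (G : Graph A) : Set where
  at-edge   : ∀ X Y → Iso G (graph (X ▸ Y)) → size X ≤ size Y → size Y ≤ 2 + size X → Centroid G
  at-vertex : ∀ R → Iso G (graph R) → Small (below R) R → Centroid G

below-▸ : ∀ X Y → suc (below (X ▸ Y)) ≡ size X + size Y
below-▸ X Y = sym (size≡1+below (X ▸ Y))

-- Walks towards the largest branch, W.
descend : ∀ {A} {G : Graph A} k N W U → size W ≤ k → suc N ≡ size W + size U →
          Iso G (graph (W ▸ U)) → N < 2 + 2 * size W → Centroid G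
descend zero    N W U h e φ l with () ← ≤-trans (≤-reflexive (sym (size≡1+below W))) h
descend (suc k) N W U h e φ l with size W ≤? size U
... | yes W≤U = at-edge W U φ W≤U (lemma (size W) (size U) e l)
  where
  lemma : ∀ w u → suc N ≡ w + u → N < 2 + 2 * w → u ≤ 2 + w
  lemma w u e l = ≤-pred (deduce 0 (≤-reflexive (sym e) ⊕ l) (solve (N ∷ w ∷ u ∷ [])))
... | no W≰U with size W ≤? 2 + size U
...   | yes W≤2+U = at-edge U W (iso-trans φ (swap-▸ W U)) (<⇒≤ (≰⇒> W≰U)) W≤2+U
...   | no W≰2+U with find-large N W
-- Moving the root into `W` turns `U` into a branch, which is small because `W` exceeds it by at
-- least three.
...     | inj₁ s = at-vertex (U ▸ W) (iso-trans φ (swap-▸ W U))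
  (subst (λ n → Small n (U ▸ W)) (suc-injective (trans e (trans (+-comm (size W) _) (sym (below-▸ U W)))))
    (lemma (size W) (size U) e (≰⇒> W≰2+U) , s))
  where
  lemma : ∀ w u → suc N ≡ w + u → 3 + u ≤ w → 2 + 2 * u ≤ N
  lemma w u e l = ≤-pred (deduce 0 (l ⊕ ≤-reflexive (sym e)) (solve (N ∷ w ∷ u ∷ [])))
...     | inj₂ (W′ , U′ , q , l′) = descend k N W′ (U ▸ U′)
  (smaller (size W) (size W′) (size U′) (∼-size q) h (≤-trans (s≤s z≤n) (≤-reflexive (sym (size≡1+below U′)))))
  (trans e (lemma (size W) (size W′) (size U) (size U′) (∼-size q)))
  (iso-trans φ (iso-trans (swap-▸ W U)
    (∼⇒iso (∼-trans (▸-cong ∼-refl q) (▸-comm U W′ U′)))))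
  l′
  where
  smaller : ∀ w w′ u′ → w ≡ w′ + u′ → w ≤ suc k → 1 ≤ u′ → w′ ≤ k
  smaller w w′ u′ refl h l = ≤-pred (deduce 0 (h ⊕ l) (solve (w′ ∷ u′ ∷ k ∷ [])))
  lemma : ∀ w w′ u u′ → w ≡ w′ + u′ → w + u ≡ w′ + (u + u′)
  lemma w w′ u u′ refl = solve (w′ ∷ u ∷ u′ ∷ [])

centroid : ∀ {A} {G : Graph A} R → Iso G (graph R) → Centroid G
centroid R φ with find-large (below R) R
... | inj₁ s = at-vertex R φ s
... | inj₂ (W , U , q , l) = descend (size W) (below R) W U ≤-refl
  (trans (sym (size≡1+below R)) (∼-size q)) (iso-trans φ (∼⇒iso q)) l

-- Uniqueness of the optimal parameters

deduce-≡ : ∀ {A B L R} → A ≡ B → L + B ≡ R + A → L ≡ R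
deduce-≡ {A} {B} {L} {R} e h = +-cancelʳ-≡ B L R (trans h (cong (R +_) e))

loss-leaf▸ : ∀ R → loss (• ▸ R ▸ •) ≡ loss R + 1 * size R
loss-leaf▸ R = cong₂ (λ l b → l + 1 * b) (loss-ext 1 R) (below-▸• R)

loss-comb-• : ∀ k → loss (comb k •) ≡ k * k
loss-comb-• zero    = refl
loss-comb-• (suc k) = trans (loss-leaf▸ (comb k •))
  (trans (cong₂ (λ l s → l + 1 * s) (loss-comb-• k) (size-comb k •)) (solve (k ∷ [])))

loss-comb-claw : ∀ k → loss (comb k claw) ≡ k * k + 3 * k + 3
loss-comb-claw zero    = refl
loss-comb-claw (suc k) = trans (loss-leaf▸ (comb k claw))
  (trans (cong₂ (λ l s → l + 1 * s) (loss-comb-claw k) (size-comb k claw)) (solve (k ∷ [])))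

-- Integrality; applied twice, it leads from `4m ≤ 4n + 3` to `m ≤ n`.
double-≤ : ∀ {m n} → 2 * m ≤ 2 * n + 1 → m ≤ n
double-≤ {m} {n} h with m ≤? n
... | yes p = p
... | no ¬p = contradiction {A = 2 ≤ 1} (deduce 0 (scale 2 (≰⇒> ¬p) ⊕ h) (solve (m ∷ n ∷ []))) (<⇒≱ (s≤s ≤-refl))

odd≢even : ∀ m n → 2 * m + 1 ≢ 2 * n
odd≢even m n e = contradiction
  (≤-antisym (double-≤ {m} {n} (≤-trans (m≤m+n (2 * m) 1) (≤-trans (≤-reflexive e) (m≤m+n (2 * n) 1))))
             (double-≤ {n} {m} (≤-reflexive (sym e))))
  λ { refl → m+1+n≢m (2 * m) e }

-- By `(x + y)² ≤ 2x² + 2y²` one has `8l ≤ 2x² + 7`; thus a surplus of 7 in the sum leaves 3 for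
-- each part.
tight : ∀ x y l k → 8 * (l + k) ≤ (x + y) * (x + y) + 7 → y * y ≤ 4 * k → 4 * l ≤ x * x + 3
tight x y l k h h′ = double-≤ (deduce 0 (h ⊕ 2xy≤x²+y² x y ⊕ scale 2 h′) (solve (x ∷ y ∷ l ∷ k ∷ [])))

odd-loss : ∀ k l → (2 * k + 3) * (2 * k + 3) ≤ 4 * l → k * k + 3 * k + 3 ≤ l
odd-loss k l h = double-≤ (double-≤ (deduce 0 h (solve (k ∷ l ∷ []))))

even-loss : ∀ k l → 2 * k * (2 * k) ≤ 4 * l → k * k ≤ l
even-loss k l h = *-cancelˡ-≤ 4 (deduce 0 h (solve (k ∷ l ∷ [])))

square-zero : ∀ d → d * d ≤ 0 → d ≡ 0
square-zero zero _ = refl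

-- The two halves of a number, rounded up and rounded down.
Near : ℕ → ℕ → Set
Near a b = a ≡ b ⊎ a ≡ suc b

near-square : ∀ {a b} → Near a b → 8 * (a * a + b * b) ≤ 2 * (a + b) * (2 * (a + b)) + 4
near-square {a} (inj₁ refl)     = deduce 4 (z≤n {0}) (solve (a ∷ []))
near-square {_} {b} (inj₂ refl) = deduce 0 (z≤n {0}) (solve (b ∷ []))

even-ordered : ∀ k d {a b} → Near a b → k + (k + d) ≡ a + b → k * k + (k + d) * (k + d) ≤ a * a + b * b →
               k ≡ b × k + d ≡ a
even-ordered k d {a} (inj₁ refl) e h
  with refl ← square-zero d (deduce 0 (scale 2 h ⊕ ≤-reflexive (cong (λ z → z * z) (sym e))) (solve (k ∷ d ∷ a ∷ []))) =
  k≡a , trans (+-identityʳ k) k≡a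
  where
  k≡a : k ≡ a
  k≡a = *-cancelˡ-≡ k a 2 (deduce-≡ e (solve (k ∷ a ∷ [])))
even-ordered k d {_} {b} (inj₂ refl) e h = go d e
  (deduce 0 (scale 2 h ⊕ ≤-reflexive (cong (λ z → z * z) (sym e))) (solve (k ∷ d ∷ b ∷ [])))
  where
  go : ∀ d → k + (k + d) ≡ suc b + b → d * d ≤ 1 → k ≡ b × k + d ≡ suc b
  go 0 e _ = contradiction {A = 2 * b + 1 ≡ 2 * k} (deduce-≡ (sym e) (solve (k ∷ b ∷ []))) (odd≢even b k)
  go 1 e _ = k≡b , trans (+-comm k 1) (cong suc k≡b)
    where
    k≡b : k ≡ b
    k≡b = *-cancelˡ-≡ k b 2 (deduce-≡ e (solve (k ∷ b ∷ [])))
  go (suc (suc d)) e (s≤s ())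

even-unique : ∀ k l {a b} → Near a b → k + l ≡ a + b → k * k + l * l ≤ a * a + b * b →
              (k ≡ b × l ≡ a) ⊎ (k ≡ a × l ≡ b)
even-unique k l {a} {b} near e h with ≤-total k l
... | inj₁ k≤l with m≤n⇒∃[o]m+o≡n k≤l
...   | d , refl = inj₁ (even-ordered k d near e h)
even-unique k l {a} {b} near e h | inj₂ l≤k with m≤n⇒∃[o]m+o≡n l≤k
...   | d , refl =
  let p , q = even-ordered l d near (trans (+-comm l (l + d)) e) (≤-trans (≤-reflexive (+-comm (l * l) _)) h)
  in inj₂ (q , p)

-- Two odd parts also have an even sum, but both are rounded up by `3 / 4`: eight times their loss
-- is at least `σ² + 12`, against `σ² + 4` for `a` and `b`.
odd-odd-loss : ∀ k l a b → k + l + 3 ≡ a + b → 8 * (a * a + b * b) ≤ 2 * (a + b) * (2 * (a + b)) + 4 →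
               ¬ (k * k + 3 * k + 3 + (l * l + 3 * l + 3) ≤ a * a + b * b)
odd-odd-loss k l a b e near h = contradiction {A = 3 ≤ 1}
  (*-cancelˡ-≤ {3} {1} 4 (deduce 0
    (near ⊕ scale 8 h ⊕ scale 4 (≤-reflexive (cong (λ z → z * z) (sym e))) ⊕ scale 4 (2xy≤x²+y² k l))
    (solve (k ∷ l ∷ a ∷ b ∷ []))))
  (<⇒≱ (s≤s (s≤s z≤n)))

-- The two parts have `2a + 3` and `2b` kinks; these are the cases in which the two numbers differ
-- by exactly one.
Next : ℕ → ℕ → Set
Next a b = b ≡ 1 + a ⊎ b ≡ 2 + a

-- An equality in both cases, and the origin of the constant 7.
next-square : ∀ {a b} → Next a b → 8 * (a * a + 3 * a + 3 + b * b) ≤ (2 * (a + b) + 3) * (2 * (a + b) + 3) + 7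
next-square {a} (inj₁ refl) = deduce 0 (z≤n {0}) (solve (a ∷ []))
next-square {a} (inj₂ refl) = deduce 0 (z≤n {0}) (solve (a ∷ []))

-- For `l = k + d` the inequality becomes `(d - 1)(d - 2) ≤ 0`, and the parity of `a + b` decides
-- between the two values. For `l ≤ k` it cannot hold.
odd-unique : ∀ k l {a b} → Next a b → k + l ≡ a + b → k * k + 3 * k + 3 + l * l ≤ a * a + 3 * a + 3 + b * b → k ≡ a × l ≡ b
odd-unique k l {a} {b} next e h with ≤-total k l
... | inj₂ l≤k with m≤n⇒∃[o]m+o≡n l≤k
...   | d , refl = contradiction {A = 9 ≤ 1}
  (deduce (4 * (d * d) + 12 * d)
    (scale 8 h ⊕ next-square next ⊕ scale 1 (≤-reflexive (cong (λ z → (2 * z + 3) * (2 * z + 3)) (sym e))))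
    (solve (l ∷ d ∷ a ∷ b ∷ [])))
  (<⇒≱ (s≤s (s≤s z≤n)))
odd-unique k l {a} {b} next e h | inj₁ k≤l with m≤n⇒∃[o]m+o≡n k≤l
...   | d , refl = go d next e
  (deduce 0
    (scale 8 h ⊕ next-square next ⊕ scale 1 (≤-reflexive (cong (λ z → (2 * z + 3) * (2 * z + 3)) (sym e))))
    (solve (k ∷ d ∷ a ∷ b ∷ [])))
  where
  match : ∀ d {b} → b ≡ d + a → k + (k + d) ≡ a + b → k ≡ a × k + d ≡ b
  match d refl e = k≡a , trans (+-comm k d) (cong (d +_) k≡a)
    where
    k≡a : k ≡ a
    k≡a = *-cancelˡ-≡ k a 2 (deduce-≡ e (solve (k ∷ d ∷ a ∷ [])))
  go : ∀ d {b} → Next a b → k + (k + d) ≡ a + b → 9 + 4 * (d * d) ≤ 1 + 12 * d → k ≡ a × k + d ≡ b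
  go 0 _ _ (s≤s ())
  go 1 (inj₁ p)    e _ = match 1 p e
  go 1 (inj₂ refl) e _ = contradiction {A = 2 * k + 1 ≡ 2 * (1 + a)} (deduce-≡ e (solve (k ∷ a ∷ []))) (odd≢even k (1 + a))
  go 2 (inj₂ p)    e _ = match 2 p e
  go 2 (inj₁ refl) e _ = contradiction {A = 2 * a + 1 ≡ 2 * (1 + k)} (deduce-≡ (sym e) (solve (k ∷ a ∷ []))) (odd≢even a (1 + k))
  go (suc (suc (suc d))) _ _ h = contradiction {A = 9 ≤ 1} (deduce (4 * (d * d) + 12 * d) h (solve (d ∷ []))) (<⇒≱ (s≤s (s≤s z≤n)))

-- Caterpillars laid out along a path

-- The pendent vertices of `C` and `F` are indexed by nested sums in which one summand at a time
-- gains an element.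
record OneMore (U U′ : Set) : Set where
  field
    keep      : U → U′
    extra     : U′
    keep-view : ∀ w → (∃ λ u → keep u ≡ w) ⊎ extra ≡ w
    keep-inj  : ∀ {u v} → keep u ≡ keep v → u ≡ v
    keep≢     : ∀ {u} → keep u ≢ extra

open OneMore

Fin-oneMore : ∀ k → OneMore (Fin k) (Fin (suc k))
Fin-oneMore k = record
  { keep = inject₁ ; extra = fromℕ k ; keep-view = λ w → view′ w
  ; keep-inj = Fin.inject₁-injective ; keep≢ = Fin.fromℕ≢inject₁ ∘ sym }
  where
  view′ : ∀ w → (∃ λ u → inject₁ u ≡ w) ⊎ fromℕ k ≡ w
  view′ w with top-view w
  ... | ‵fromℕ     = inj₂ refl
  ... | ‵inject₁ u = inj₁ (u , refl)

oneMore-⊎ˡ : ∀ {U U′} W → OneMore U U′ → OneMore (U ⊎ W) (U′ ⊎ W)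
oneMore-⊎ˡ W o = record
  { keep = Sum.map₁ (keep o) ; extra = inj₁ (extra o)
  ; keep-view = λ
    { (inj₁ w) → Sum.map (λ (u , e) → inj₁ u , cong inj₁ e) (cong inj₁) (keep-view o w)
    ; (inj₂ w) → inj₁ (inj₂ w , refl) }
  ; keep-inj = λ
    { {inj₁ _} {inj₁ _} e → cong inj₁ (keep-inj o (Sum.inj₁-injective e))
    ; {inj₂ _} {inj₂ _} refl → refl }
  ; keep≢ = λ { {inj₁ _} e → keep≢ o (Sum.inj₁-injective e) ; {inj₂ _} () } }

oneMore-⊎ʳ : ∀ {U U′} W → OneMore U U′ → OneMore (W ⊎ U) (W ⊎ U′)
oneMore-⊎ʳ W o = record
  { keep = Sum.map₂ (keep o) ; extra = inj₂ (extra o)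
  ; keep-view = λ
    { (inj₂ w) → Sum.map (λ (u , e) → inj₂ u , cong inj₂ e) (cong inj₂) (keep-view o w)
    ; (inj₁ w) → inj₁ (inj₁ w , refl) }
  ; keep-inj = λ
    { {inj₂ _} {inj₂ _} e → cong inj₂ (keep-inj o (Sum.inj₂-injective e))
    ; {inj₁ _} {inj₁ _} refl → refl }
  ; keep≢ = λ { {inj₂ _} e → keep≢ o (Sum.inj₂-injective e) ; {inj₁ _} () } }

attach-leaf : ∀ {m U U′} (o : OneMore U U′) (f : U → Fin (suc m)) (f′ : U′ → Fin (suc m)) →
              (∀ u → f′ (keep o u) ≡ f u) → f′ (extra o) ≡ fromℕ m →
              Pendant (attach (path (suc m)) f) (inj₁ (fromℕ m)) (attach (path (suc m)) f′)
attach-leaf o f f′ e e′ = record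
  { old = Sum.map₂ (keep o) ; new = inj₂ (extra o)
  ; view = λ
    { (inj₁ i) → inj₁ (inj₁ i , refl)
    ; (inj₂ w) → Sum.map (λ (u , e) → inj₂ u , cong inj₂ e) (cong inj₂) (keep-view o w) }
  ; old-inj = λ
    { {inj₁ _} {inj₁ _} refl → refl
    ; {inj₂ _} {inj₂ _} eq → cong inj₂ (keep-inj o (Sum.inj₂-injective eq)) }
  ; old≢new = λ { {inj₁ _} () ; {inj₂ _} eq → keep≢ o (Sum.inj₂-injective eq) }
  ; old-adj⁺ = λ
    { {inj₁ _} {inj₁ _} a → a
    ; {inj₁ _} {inj₂ u} a → trans a (sym (e u))
    ; {inj₂ u} {inj₁ _} a → trans a (sym (e u)) }
  ; old-adj⁻ = λ
    { {inj₁ _} {inj₁ _} a → a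
    ; {inj₁ _} {inj₂ u} a → trans a (e u)
    ; {inj₂ u} {inj₁ _} a → trans a (e u) }
  ; new-adj⁺ = sym e′
  ; new-adj⁻ = λ { {inj₁ _} a → cong inj₁ (trans a e′) }
  }

attach-ext : ∀ {m U} (f : U → Fin (suc m)) →
             Pendant (attach (path (suc m)) f) (inj₁ (fromℕ m)) (attach (path (suc (suc m))) (inject₁ ∘ f))
attach-ext {m} f = record
  { old = Sum.map₁ inject₁ ; new = inj₁ (fromℕ (suc m))
  ; view = λ
    { (inj₂ u) → inj₁ (inj₂ u , refl)
    ; (inj₁ w) → Sum.map (λ (i , e) → inj₁ i , cong inj₁ e) (cong inj₁) (keep-view (Fin-oneMore (suc m)) w) }
  ; old-inj = λ
    { {inj₂ _} {inj₂ _} refl → refl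
    ; {inj₁ _} {inj₁ _} eq → cong inj₁ (Fin.inject₁-injective (Sum.inj₁-injective eq)) }
  ; old≢new = λ { {inj₂ _} () ; {inj₁ _} eq → Fin.fromℕ≢inject₁ (sym (Sum.inj₁-injective eq)) }
  ; old-adj⁺ = λ
    { {inj₁ i} {inj₁ j} a → Sum.map (λ e → trans (cong suc (Fin.toℕ-inject₁ i)) (trans e (sym (Fin.toℕ-inject₁ j))))
                                    (λ e → trans (cong suc (Fin.toℕ-inject₁ j)) (trans e (sym (Fin.toℕ-inject₁ i)))) a
    ; {inj₁ _} {inj₂ _} → cong inject₁
    ; {inj₂ _} {inj₁ _} → cong inject₁ }
  ; old-adj⁻ = λ
    { {inj₁ i} {inj₁ j} a → Sum.map (λ e → trans (sym (cong suc (Fin.toℕ-inject₁ i))) (trans e (Fin.toℕ-inject₁ j)))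
                                    (λ e → trans (sym (cong suc (Fin.toℕ-inject₁ j))) (trans e (Fin.toℕ-inject₁ i))) a
    ; {inj₁ _} {inj₂ _} → Fin.inject₁-injective
    ; {inj₂ _} {inj₁ _} → Fin.inject₁-injective }
  ; new-adj⁺ = inj₁ (cong suc (Fin.toℕ-inject₁ (fromℕ m)))
  ; new-adj⁻ = λ
    { {inj₁ i} (inj₁ e) → cong inj₁ (Fin.toℕ-injective (trans (sym (Fin.toℕ-inject₁ i)) (suc-injective e)))
    ; {inj₁ i} (inj₂ e) → contradiction
        (subst₂ _≤_ (trans (sym e) (cong (λ k → suc (suc k)) (Fin.toℕ-fromℕ m))) refl
          (≤-trans (≤-reflexive (Fin.toℕ-inject₁ i)) (Fin.toℕ≤pred[n] i))) (<⇒≱ (m≤n⇒m≤1+n ≤-refl))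
    ; {inj₂ _} e → contradiction e (Fin.fromℕ≢inject₁) }
  }

-- R is laid out along the path v₀ … v_m, with root v_m and further leaves u attached at v_{g u}.
record Laid (R : Rooted) (U : Set) (m : ℕ) (g : U → ℕ) : Set where
  constructor laid
  field
    spot   : U → Fin (suc m)
    spot≡  : ∀ u → toℕ (spot u) ≡ g u
    layout : RootedIso (graph R) (root R) (attach (path (suc m)) spot) (inj₁ (fromℕ m))

laid-• : ∀ {U g} → ¬ U → Laid • U 0 g
laid-• ¬U = laid (⊥-elim ∘ ¬U) (⊥-elim ∘ ¬U) (record
  { to = λ _ → inj₁ fzero ; from = λ _ → tt
  ; to-from = λ { (inj₁ fzero) → refl ; (inj₂ u) → ⊥-elim (¬U u) } ; from-to = λ _ → refl
  ; adj⁺ = λ _ _ () ; adj⁻ = λ { _ _ (inj₁ ()) ; _ _ (inj₂ ()) } } , refl)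

laid-▸• : ∀ {R U m g} → Laid R U m g → Laid (R ▸ •) U (suc m) g
laid-▸• {R} (laid f e φ) = laid (inject₁ ∘ f) (λ u → trans (Fin.toℕ-inject₁ (f u)) (e u))
  (pendant-iso (pendant-root R) (attach-ext f) φ , pendant-iso-new (pendant-root R) (attach-ext f) φ)

laid-•▸ : ∀ {R U U′ m g} (o : OneMore U U′) {g′} → (∀ u → g′ (keep o u) ≡ g u) → g′ (extra o) ≡ m →
          Laid R U m g → Laid (• ▸ R) U′ m g′
laid-•▸ {R} {U} {U′} {m} {g} o {g′} eq eq′ (laid f e φ) = laid f′ f′≡
  (pendant-iso (pendant-• R) p φ ,
   trans (pendant-iso-old (pendant-• R) p φ (root R)) (cong (old p) (rooted φ)))
  where
  choose : ∀ w → (∃ λ u → keep o u ≡ w) ⊎ extra o ≡ w → Fin (suc m)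
  choose _ (inj₁ (u , _)) = f u
  choose _ (inj₂ _)       = fromℕ m
  f′ : U′ → Fin (suc m)
  f′ w = choose w (keep-view o w)
  f′-keep : ∀ u → f′ (keep o u) ≡ f u
  f′-keep u with keep-view o (keep o u)
  ... | inj₁ (v , e) = cong f (keep-inj o e)
  ... | inj₂ e       = ⊥-elim (keep≢ o (sym e))
  f′-extra : f′ (extra o) ≡ fromℕ m
  f′-extra with keep-view o (extra o)
  ... | inj₁ (v , e) = ⊥-elim (keep≢ o e)
  ... | inj₂ _       = refl
  f′≡ : ∀ w → toℕ (f′ w) ≡ g′ w
  f′≡ w with keep-view o w
  ... | inj₁ (u , refl) = trans (e u) (sym (eq u))
  ... | inj₂ refl       = trans (Fin.toℕ-fromℕ m) (sym eq′)
  p = attach-leaf o f f′ f′-keep f′-extra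

laid-ext : ∀ {R U m g} t → Laid R U m g → Laid (ext t R) U (t + m) g
laid-ext zero    l = l
laid-ext (suc t) l = laid-▸• (laid-ext t l)

-- A tooth is a new last vertex of the path and then a leaf at it, which explains the position
-- `suc (k + m)`.
laid-comb : ∀ {R m} (U : ℕ → Set) (o : ∀ k → OneMore (U k) (U (suc k))) (g : ∀ k → U k → ℕ) →
            (∀ k u → g (suc k) (keep (o k) u) ≡ g k u) → (∀ k → g (suc k) (extra (o k)) ≡ suc (k + m)) →
            ∀ k → Laid R (U 0) m (g 0) → Laid (comb k R) (U k) (k + m) (g k)
laid-comb U o g e e′ zero    l = l
laid-comb U o g e e′ (suc k) l = laid-•▸ (o k) (e k) (e′ k) (laid-▸• (laid-comb U o g e e′ k l))

attach-cong : ∀ {m m′ U} {f : U → Fin m} {f′ : U → Fin m′} → m ≡ m′ → (∀ u → toℕ (f u) ≡ toℕ (f′ u)) →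
              Iso (attach (path m) f) (attach (path m′) f′)
attach-cong {m} {f = f} {f′} refl e = record
  { to = id ; from = id ; to-from = λ _ → refl ; from-to = λ _ → refl
  ; adj⁺ = λ
    { (inj₁ _) (inj₁ _) a → a
    ; (inj₁ _) (inj₂ u) a → trans a (Fin.toℕ-injective (e u))
    ; (inj₂ u) (inj₁ _) a → trans a (Fin.toℕ-injective (e u)) }
  ; adj⁻ = λ
    { (inj₁ _) (inj₁ _) a → a
    ; (inj₁ _) (inj₂ u) a → trans a (Fin.toℕ-injective (sym (e u)))
    ; (inj₂ u) (inj₁ _) a → trans a (Fin.toℕ-injective (sym (e u))) } }

toℕ-vertex : ∀ {m} i .(p : 1 ≤ i) .(q : i ≤ m) → suc (toℕ (vertex i p q)) ≡ i
toℕ-vertex (suc i) _ q = cong suc (Fin.toℕ-fromℕ< q)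

comb-• : ∀ k R → comb k (• ▸ R ▸ •) ≡ comb (suc k) R
comb-• zero    R = refl
comb-• (suc k) R = cong (λ S → • ▸ S ▸ •) (comb-• k R)

ext-▸• : ∀ j R → ext j (R ▸ •) ≡ ext (suc j) R
ext-▸• zero    R = refl
ext-▸• (suc j) R = cong (_▸ •) (ext-▸• j R)

ext-+ : ∀ j i R → ext j (ext i R) ≡ ext (j + i) R
ext-+ zero    i R = refl
ext-+ (suc j) i R = cong (_▸ •) (ext-+ j i R)

-- The edge joining the two parts can be slid along the path between them.
slide-ext : ∀ A B j → Iso (graph (A ▸ ext j B)) (graph (ext j A ▸ B))
slide-ext A B zero    = iso-refl
slide-ext A B (suc j) = subst (λ S → Iso (graph (A ▸ ext (suc j) B)) (graph (S ▸ B))) (ext-▸• j A)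
  (iso-trans (iso-trans (▸-comm-iso A (ext j B) •) (swap-▸ (ext j B) (A ▸ •))) (slide-ext (A ▸ •) B j))

-- Moving the joining edge past a tooth transfers that tooth to the other part, until a single
-- vertex remains.
slide-comb : ∀ A k → Iso (graph (A ▸ comb k •)) (graph (comb k A ▸ •))
slide-comb A zero    = iso-refl
slide-comb A (suc k) = subst (λ S → Iso (graph (A ▸ comb (suc k) •)) (graph (S ▸ •))) (comb-• k A)
  (iso-trans (∼⇒iso (∼-trans (▸-comm A • (comb k • ▸ •)) (∼-trans
      (▸-cong ∼-refl (▸-comm A (comb k •) •)) (▸-comm • (comb k •) (A ▸ •)))))
    (iso-trans (swap-▸ (comb k •) (• ▸ A ▸ •)) (slide-comb (• ▸ A ▸ •) k)))

-- The two combs point away from each other. With the root at the outer end of the second one, the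
-- spine is built up in the order in which `C` and `F` number their paths.
spine-iso : ∀ i a A j b → Iso (graph (ext i (comb a A) ▸ ext j (comb b •)))
                              (graph (comb b (ext (j + i) (comb a A)) ▸ •))
spine-iso i a A j b = iso-trans (slide-ext (ext i (comb a A)) (comb b •) j)
  (subst (λ S → Iso (graph (ext j (ext i (comb a A)) ▸ comb b •)) (graph (comb b S ▸ •))) (ext-+ j i (comb a A))
    (slide-comb (ext j (ext i (comb a A))) b))

-- The trees C and F

module _ (d : ℕ) {a b : ℕ} where

  -- Counted from zero, so that the path vertex `vᵢ` has position `i - 1`; `d` is where the right
  -- family begins.
  position : Fin a ⊎ Fin b → ℕ
  position = [ (λ j → 1 + toℕ j) , (λ j → d + toℕ j) ]′

position-keepˡ : ∀ d {b} k (u : Fin k ⊎ Fin b) →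
                 position d (keep (oneMore-⊎ˡ (Fin b) (Fin-oneMore k)) u) ≡ position d u
position-keepˡ d k (inj₁ j) = cong suc (Fin.toℕ-inject₁ j)
position-keepˡ d k (inj₂ j) = refl

position-keepʳ : ∀ d {a} k (u : Fin a ⊎ Fin k) →
                 position d (keep (oneMore-⊎ʳ (Fin a) (Fin-oneMore k)) u) ≡ position d u
position-keepʳ d k (inj₁ j) = refl
position-keepʳ d k (inj₂ j) = cong (d +_) (Fin.toℕ-inject₁ j)

no-Fin0 : ¬ (Fin 0 ⊎ Fin 0)
no-Fin0 (inj₁ ())
no-Fin0 (inj₂ ())

laid-C : ∀ a b t → Laid (comb b (ext t (comb a •)) ▸ •) (Fin a ⊎ Fin b)
                        (suc (b + (t + (a + 0)))) (position (suc (t + (a + 0))))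
laid-C a b t = laid-▸•
  (laid-comb (λ k → Fin a ⊎ Fin k) (λ k → oneMore-⊎ʳ (Fin a) (Fin-oneMore k)) (λ _ → position d)
    (position-keepʳ d) (λ k → cong suc (trans (cong (t + (a + 0) +_) (Fin.toℕ-fromℕ k)) (+-comm _ k))) b
    (laid-ext t
      (laid-comb (λ k → Fin k ⊎ Fin 0) (λ k → oneMore-⊎ˡ (Fin 0) (Fin-oneMore k)) (λ _ → position d)
        (position-keepˡ d) (λ k → cong suc (trans (Fin.toℕ-fromℕ k) (sym (+-identityʳ k)))) a
        (laid-• no-Fin0))))
  where d = suc (t + (a + 0))

-- One leaf of `claw` begins the path, and the other two are the two pendent vertices at position 1.
laid-F : ∀ a b t → Laid (comb b (ext t (comb a claw)) ▸ •) (⊤ ⊎ (Fin (suc a) ⊎ Fin b))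
                        (suc (b + (t + (a + 1)))) [ const 1 , position (suc (t + (a + 1))) ]′
laid-F a b t = laid-▸•
  (laid-comb (λ k → ⊤ ⊎ (Fin (suc a) ⊎ Fin k)) (λ k → oneMore-⊎ʳ ⊤ (oneMore-⊎ʳ (Fin (suc a)) (Fin-oneMore k)))
    (λ _ → [ const 1 , position d ]′)
    (λ { k (inj₁ _) → refl ; k (inj₂ u) → position-keepʳ d k u })
    (λ k → cong suc (trans (cong (t + (a + 1) +_) (Fin.toℕ-fromℕ k)) (+-comm _ k))) b
    (laid-ext t
      (laid-comb (λ k → ⊤ ⊎ (Fin (suc k) ⊎ Fin 0))
        (λ k → oneMore-⊎ʳ ⊤ (oneMore-⊎ˡ (Fin 0) (Fin-oneMore (suc k)))) (λ _ → [ const 1 , position d ]′)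
        (λ { k (inj₁ _) → refl ; k (inj₂ u) → position-keepˡ d (suc k) u })
        (λ k → cong suc (trans (Fin.toℕ-fromℕ (suc k)) (+-comm 1 k))) a
        (laid-•▸ (oneMore-⊎ʳ ⊤ (oneMore-⊎ˡ (Fin 0) (Fin-oneMore 0))) {[ const 1 , position d ]′}
          (λ { (inj₁ _) → refl ; (inj₂ u) → position-keepˡ d 0 u }) refl
          (laid-•▸ first {[ const 1 , position d ]′} (λ u → contradiction u no-Fin0) refl (laid-▸• (laid-• {g = const 0} no-Fin0)))))))
  where
  d = suc (t + (a + 1))
  first : OneMore (Fin 0 ⊎ Fin 0) (⊤ ⊎ (Fin 0 ⊎ Fin 0))
  first = record
    { keep = inj₂ ; extra = inj₁ tt
    ; keep-view = λ { (inj₁ tt) → inj₂ refl ; (inj₂ u) → contradiction u no-Fin0 }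
    ; keep-inj = λ { {u} → contradiction u no-Fin0 }
    ; keep≢ = λ () }

-- `n` is bracketed so that the truncated subtractions in `C` cancel one summand after the other.
isC : ∀ {A : Set} {G : Graph A} n a b t → n ≡ a + (2 * b + (a + t + 2)) →
      Iso G (graph (comb b (ext t (comb a •)) ▸ •)) → IsC G n a b
isC {G = G} n a b t e φ = room , Iso⇒≅ (iso-trans φ (iso-trans (iso (Laid.layout L)) shape))
  where
  L = laid-C a b t
  room : 2 * (a + b) + 1 ≤ n
  room = subst (2 * (a + b) + 1 ≤_) (trans eq (sym e)) (m≤m+n _ (t + 1))
    where
    eq : 2 * (a + b) + 1 + (t + 1) ≡ a + (2 * b + (a + t + 2))
    eq = solve (a ∷ b ∷ t ∷ [])
  right≡ : n ∸ a ∸ 2 * b ≡ a + t + 2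
  right≡ = trans (cong (λ k → k ∸ a ∸ 2 * b) e)
    (trans (cong (_∸ 2 * b) (m+n∸m≡n a (2 * b + (a + t + 2)))) (m+n∸m≡n (2 * b) (a + t + 2)))
  length≡ : suc (suc (b + (t + (a + 0)))) ≡ n ∸ a ∸ b
  length≡ = sym (trans (cong (λ k → k ∸ a ∸ b) e)
    (trans (cong (_∸ b) (trans (m+n∸m≡n a (2 * b + (a + t + 2))) eq)) (m+n∸m≡n b (suc (suc (b + (t + (a + 0))))))))
    where
    eq : 2 * b + (a + t + 2) ≡ b + suc (suc (b + (t + (a + 0))))
    eq = solve (a ∷ b ∷ t ∷ [])
  eq : ∀ i → a + t + 2 + i ≡ suc (suc (t + (a + 0)) + i)
  eq i = solve (a ∷ t ∷ i ∷ [])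
  in-left : ∀ (j : Fin a) → 2 + toℕ j ≤ n ∸ a ∸ b
  in-left j = subst (2 + toℕ j ≤_) length≡ (lemma (toℕ j) (Fin.toℕ<n j))
    where
    lemma : ∀ i → suc i ≤ a → 2 + i ≤ suc (suc (b + (t + (a + 0))))
    lemma i h = deduce (b + t + 1) h (solve (a ∷ b ∷ t ∷ i ∷ []))
  in-right : ∀ (j : Fin b) → n ∸ a ∸ 2 * b + toℕ j ≤ n ∸ a ∸ b
  in-right j = subst₂ _≤_ (cong (_+ toℕ j) (sym right≡)) length≡ (lemma (toℕ j) (Fin.toℕ<n j))
    where
    lemma : ∀ i → suc i ≤ b → a + t + 2 + i ≤ suc (suc (b + (t + (a + 0))))
    lemma i h = deduce 1 h (solve (a ∷ b ∷ t ∷ i ∷ []))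
  shape : Iso (attach (path (suc (suc (b + (t + (a + 0)))))) (Laid.spot L)) (C n a b room)
  shape = attach-cong length≡ λ
    { (inj₁ j) → trans (Laid.spot≡ L (inj₁ j)) (suc-injective (sym (toℕ-vertex (2 + toℕ j) (s≤s z≤n) (in-left j))))
    ; (inj₂ j) → trans (Laid.spot≡ L (inj₂ j)) (suc-injective (sym (trans (toℕ-vertex (n ∸ a ∸ 2 * b + toℕ j) _ (in-right j))
        (trans (cong (_+ toℕ j) right≡) (eq (toℕ j)))))) }

isF : ∀ {A : Set} {G : Graph A} n a b t → n ≡ a + (2 * b + (2 + (a + t + 3))) →
      Iso G (graph (comb b (ext t (comb a claw)) ▸ •)) → IsF G n a b
isF {G = G} n a b t e φ = room , Iso⇒≅ (iso-trans φ (iso-trans (iso (Laid.layout L)) shape))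
  where
  L = laid-F a b t
  room : 2 * (a + b) + 5 ≤ n
  room = subst (2 * (a + b) + 5 ≤_) (trans eq (sym e)) (m≤m+n _ t)
    where
    eq : 2 * (a + b) + 5 + t ≡ a + (2 * b + (2 + (a + t + 3)))
    eq = solve (a ∷ b ∷ t ∷ [])
  right≡ : n ∸ a ∸ 2 * b ∸ 2 ≡ a + t + 3
  right≡ = trans (cong (λ k → k ∸ a ∸ 2 * b ∸ 2) e)
    (cong (_∸ 2) (trans (cong (_∸ 2 * b) (m+n∸m≡n a (2 * b + (2 + (a + t + 3))))) (m+n∸m≡n (2 * b) (2 + (a + t + 3)))))
  length≡ : suc (suc (b + (t + (a + 1)))) ≡ n ∸ a ∸ b ∸ 2
  length≡ = sym (trans (cong (λ k → k ∸ a ∸ b ∸ 2) e)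
    (cong (_∸ 2) (trans (cong (_∸ b) (trans (m+n∸m≡n a (2 * b + (2 + (a + t + 3)))) eq)) (m+n∸m≡n b (2 + suc (suc (b + (t + (a + 1)))))))))
    where
    eq : 2 * b + (2 + (a + t + 3)) ≡ b + (2 + suc (suc (b + (t + (a + 1)))))
    eq = solve (a ∷ b ∷ t ∷ [])
  eq : ∀ i → a + t + 3 + i ≡ suc (suc (t + (a + 1)) + i)
  eq i = solve (a ∷ t ∷ i ∷ [])
  in-left : ∀ (j : Fin (suc a)) → 2 + toℕ j ≤ n ∸ a ∸ b ∸ 2
  in-left j = subst (2 + toℕ j ≤_) length≡ (lemma (toℕ j) (Fin.toℕ<n j))
    where
    lemma : ∀ i → suc i ≤ suc a → 2 + i ≤ suc (suc (b + (t + (a + 1))))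
    lemma i h = deduce (b + t + 1) h (solve (a ∷ b ∷ t ∷ i ∷ []))
  in-right : ∀ (j : Fin b) → n ∸ a ∸ 2 * b ∸ 2 + toℕ j ≤ n ∸ a ∸ b ∸ 2
  in-right j = subst₂ _≤_ (cong (_+ toℕ j) (sym right≡)) length≡ (lemma (toℕ j) (Fin.toℕ<n j))
    where
    lemma : ∀ i → suc i ≤ b → a + t + 3 + i ≤ suc (suc (b + (t + (a + 1))))
    lemma i h = deduce 1 h (solve (a ∷ b ∷ t ∷ i ∷ []))
  shape : Iso (attach (path (suc (suc (b + (t + (a + 1)))))) (Laid.spot L)) (F n a b room)
  shape = attach-cong length≡ λ
    { (inj₁ tt) → trans (Laid.spot≡ L (inj₁ tt)) (suc-injective (sym (toℕ-vertex 2 (s≤s z≤n) (in-left fzero))))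
    ; (inj₂ (inj₁ j)) → trans (Laid.spot≡ L (inj₂ (inj₁ j))) (suc-injective (sym (toℕ-vertex (2 + toℕ j) (s≤s z≤n) (in-left j))))
    ; (inj₂ (inj₂ j)) → trans (Laid.spot≡ L (inj₂ (inj₂ j))) (suc-injective (sym (trans (toℕ-vertex (n ∸ a ∸ 2 * b ∸ 2 + toℕ j) _ (in-right j))
        (trans (cong (_+ toℕ j) right≡) (eq (toℕ j)))))) }

-- Comparison with a balanced caterpillar

-- The `t` vertices are handed out one at a time, always to the side that is currently smaller.
balance : ∀ t u v → u ≤ v + t → v ≤ 2 + (u + t) →
          ∃ λ i → ∃ λ j → i + j ≡ t × i + u ≤ j + v × j + v ≤ 2 + (i + u)
balance zero u v h k = 0 , 0 , refl ,
  ≤-trans h (≤-reflexive (+-identityʳ v)) , ≤-trans k (≤-reflexive (cong (2 +_) (+-identityʳ u)))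
balance (suc t) u v h k with suc u ≤? v
... | yes u<v =
  let i , j , e , p , q = balance t (suc u) v (≤-trans u<v (m≤m+n v t)) (≤-trans k (≤-reflexive (cong (2 +_) (+-suc u t))))
  in suc i , j , cong suc e , ≤-trans (≤-reflexive (sym (+-suc i u))) p , ≤-trans q (≤-reflexive (cong (2 +_) (+-suc i u)))
... | no u≮v =
  let i , j , e , p , q = balance t u (suc v) (≤-trans h (≤-reflexive (+-suc v t)))
                            (≤-trans (≰⇒> u≮v) (≤-trans (m≤m+n (suc u) (suc t)) (≤-reflexive (cong suc (+-suc u t)))))
  in i , suc j , trans (+-suc i j) (cong suc e) , ≤-trans p (≤-reflexive (+-suc j v)) , ≤-trans (≤-reflexive (sym (+-suc j v))) q

-- A tree to compare with: its Mostar index is 2 (l + size X * below Y).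
record Target (n s l : ℕ) : Set where
  constructor mkTarget
  field
    X Y     : Rooted
    size≡   : n ≡ size X + size Y
    others≡ : others 0 (X ▸ Y) ≡ s
    light   : Light (size X + size Y) (X ▸ Y)
    loss≡   : loss X + loss Y ≡ l

target : ∀ {n s l u v} t P Q → size P ≡ u → size Q ≡ v → u ≤ v + t → v ≤ 2 + (u + t) → n ≡ t + u + v →
         suc (kinks P) + suc (kinks Q) ≡ s → loss P + loss Q ≡ l → Target n s l
target t P Q refl refl h k refl refl refl with balance t (size P) (size Q) h k
... | i , j , refl , p , q = record
  { X = ext i P ; Y = ext j Q
  ; size≡ = trans (shuffle (size P) (size Q)) (sym (cong₂ _+_ (size-ext i P) (size-ext j Q)))
  ; others≡ = cong₂ _+_ (trans (others≡1+kinks (ext i P)) (cong suc (kinks-ext i P)))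
                        (trans (others≡1+kinks (ext j Q)) (cong suc (kinks-ext j Q)))
  ; light = let p′ = subst₂ _≤_ (sym (size-ext i P)) (sym (size-ext j Q)) p
                q′ = subst₂ (λ y x → y ≤ 2 + x) (sym (size-ext j Q)) (sym (size-ext i P)) q
                hX = half (size (ext i P)) (size (ext j Q)) p′
            in hX , size≤⇒Light _ (ext i P) hX ,
               below≤⇒Light _ (ext j Q) (half′ (size (ext i P)) (size (ext j Q)) (below (ext j Q)) (size≡1+below (ext j Q)) q′)
  ; loss≡ = cong₂ _+_ (loss-ext i P) (loss-ext j Q) }
  where
  shuffle : ∀ u v → i + j + u + v ≡ (i + u) + (j + v)
  shuffle u v = solve (i ∷ j ∷ u ∷ v ∷ [])
  half : ∀ x y → x ≤ y → 2 * x ≤ x + y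
  half x y h = deduce 0 h (solve (x ∷ y ∷ []))
  half′ : ∀ x y b → y ≡ suc b → y ≤ 2 + x → 2 * b ≤ x + y
  half′ x y b refl h = deduce 0 h (solve (x ∷ b ∷ []))

-- The star with four leaves, the only optimal tree without a balanced edge.
star : Rooted
star = • ▸ • ▸ • ▸ • ▸ •

leaf-branches : ∀ N R → N ≤ 4 → Small N R → R ≡ • ⊎ 4 ≤ N
leaf-branches N •       _ _       = inj₁ refl
leaf-branches N (X ▸ Y) _ (h , _) = inj₂
  (≤-trans (s≤s (s≤s (*-monoʳ-≤ 2 (≤-trans (s≤s z≤n) (≤-reflexive (sym (size≡1+below X))))))) h)

small-star : ∀ R → below R ≡ 4 → Small 4 R → R ≡ star
small-star R e s = go R 4 e s
  where
  stars : ℕ → Rooted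
  stars zero    = •
  stars (suc k) = • ▸ stars k
  leaf : ∀ X → 2 + 2 * size X ≤ 4 → X ≡ •
  leaf X h = size≡1⇒• X (≤-antisym (*-cancelˡ-≤ 2 (≤-pred (≤-pred h)))
    (≤-trans (s≤s z≤n) (≤-reflexive (sym (size≡1+below X)))))
  go : ∀ R k → below R ≡ k → Small 4 R → R ≡ stars k
  go •       k refl _        = refl
  go (X ▸ Y) k e (h , s) with refl ← leaf X h with k
  ... | suc k′ = cong (• ▸_) (go Y k′ (suc-injective e) s)

compare-tree : ∀ {n t} (T : Tree n) → (∀ T′ → T′ ∈ ℰ n t → Mo T ≤ Mo T′) →
               ∀ S → n ≡ size S → twos 0 S ≡ t → Light n S → Mo T ≤ 2 * loss S
compare-tree T minimal S refl t≡ light = begin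
  Mo T                     ≤⟨ minimal (rooted⇒tree S) (trans (#degreeTwo-iso (finGraph-iso S)) t≡) ⟩
  Mo (rooted⇒tree S)       ≡⟨ mostar-iso (finGraph-iso S) (Tree.connected (rooted⇒tree S)) ⟩
  moSum (size S) S         ≤⟨ Light⇒moSum≤2loss S light ⟩
  2 * loss S               ∎
  where open ≤-Reasoning

-- 4xb ≥ (x + b)² − 1 when x and b differ by at most one, and 4yc ≤ (y + c)² in any case.
edge-loss : ∀ {l k} x b y c → x + b ≡ y + c → x ≤ suc b → b ≤ suc x → l + x * b ≤ k + y * c → l ≤ k
edge-loss {l} {k} x b y c e h h′ g = double-≤ (double-≤ (deduce 2
  (scale 4 g ⊕ 2xy≤x²+y² y c ⊕ ≤-reflexive (cong (λ z → z * z) (sym e)) ⊕ close x b h h′)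
  (solve (l ∷ k ∷ x ∷ b ∷ y ∷ c ∷ []))))
  where
  close : ∀ x b → x ≤ suc b → b ≤ suc x → x * x + b * b ≤ 2 * (x * b) + 1
  close zero    zero    _ _ = z≤n
  close zero    1       _ _ = s≤s z≤n
  close zero    (suc (suc _)) _ (s≤s ())
  close (suc zero)    zero _ _ = s≤s z≤n
  close (suc (suc _)) zero (s≤s ()) _
  close (suc x) (suc b) (s≤s h) (s≤s h′) = deduce 0 (close x b h h′) (solve (x ∷ b ∷ []))

-- `2N²` absorbs `8yc` because `4yc ≤ (y + c)²`; what remains bounds the `l` of the competitor from
-- below.
vertex-loss : ∀ {N w l r} y c → N ≡ y + c → 2 * (N * N) + w ≤ 8 * r → r ≤ l + y * c → w ≤ 8 * l
vertex-loss {w = w} {l} {r} y c refl h g = deduce 0 (h ⊕ scale 8 g ⊕ scale 2 (2xy≤x²+y² y c))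
  (solve (w ∷ l ∷ r ∷ y ∷ c ∷ []))

-- Consequences of minimality at an edge and at a vertex

module Optimal {n t s} (T : Tree n) (T∈ : T ∈ ℰ n t) (minimal : ∀ T′ → T′ ∈ ℰ n t → Mo T ≤ Mo T′)
               (n≡ : n ≡ t + s) (4≤n : 4 ≤ n) where

  G : Graph (Fin n)
  G = Tree.graph T

  module _ {R} (φ : Iso G (graph R)) where

    n≡1+below : n ≡ suc (below R)
    n≡1+below = trans (iso-size φ) (size≡1+below R)

    others≡s : others 0 R ≡ s
    others≡s = +-cancelˡ-≡ t (others 0 R) s (begin
      t + others 0 R        ≡⟨ cong (_+ others 0 R) (trans (sym T∈) (#degreeTwo-iso φ)) ⟩
      twos 0 R + others 0 R ≡⟨ twos+others 0 R ⟩
      size R                ≡⟨ size≡1+below R ⟩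
      suc (below R)         ≡⟨ n≡1+below ⟨
      n                     ≡⟨ n≡ ⟩
      t + s                 ∎)
      where open ≡-Reasoning

    module _ {l} (T* : Target n s l) where
      open Target T*

      loss≤ : loss R ≤ l + size X * below Y
      loss≤ = *-cancelˡ-≤ 2 (begin
        2 * loss R                 ≤⟨ moSum≥2loss R ⟩
        moSum (size R) R           ≡⟨ cong (λ k → moSum k R) (trans (size≡1+below R) (sym n≡1+below)) ⟩
        moSum n R                  ≡⟨ mostar-iso φ (Tree.connected T) ⟨
        Mo T                       ≤⟨ compare-tree T minimal (X ▸ Y) size≡ twos≡
                                       (subst (λ k → Light k (X ▸ Y)) (sym size≡) light) ⟩
        2 * loss (X ▸ Y)           ≡⟨ cong (λ k → 2 * (k + size X * below Y)) loss≡ ⟩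
        2 * (l + size X * below Y) ∎)
        where
        open ≤-Reasoning
        twos≡ : twos 0 (X ▸ Y) ≡ t
        twos≡ = +-cancelʳ-≡ s (twos 0 (X ▸ Y)) t (trans (cong (twos 0 (X ▸ Y) +_) (sym others≡))
          (trans (twos+others 0 (X ▸ Y)) (trans (sym size≡) n≡)))

      below≡ : below R ≡ size X + below Y
      below≡ = suc-injective (trans (sym n≡1+below) (trans size≡
        (trans (cong (size X +_) (size≡1+below Y)) (+-suc (size X) (below Y)))))

  record AtEdge (l : ℕ) : Set where
    field
      X Y    : Rooted
      split  : Iso G (graph (X ▸ Y))
      size≡  : n ≡ size X + size Y
      kinks≡ : suc (kinks X) + suc (kinks Y) ≡ s
      loss≤l : loss X + loss Y ≤ l

  at-edge-split : ∀ {X Y l} → Iso G (graph (X ▸ Y)) → size X ≤ size Y → size Y ≤ 2 + size X →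
                  Target n s l → AtEdge l
  at-edge-split {X} {Y} φ h h′ T* = record
    { X = X ; Y = Y ; split = φ
    ; size≡ = trans (n≡1+below φ) (below-▸ X Y)
    ; kinks≡ = trans (sym (cong₂ _+_ (others≡1+kinks X) (others≡1+kinks Y))) (others≡s φ)
    ; loss≤l = edge-loss (size X) (below Y) (size T*.X) (below T*.Y)
        (trans (cong (_+ below Y) (size≡1+below X)) (below≡ φ T*))
        (≤-trans h (≤-reflexive (size≡1+below Y)))
        (≤-pred (≤-trans (≤-reflexive (sym (size≡1+below Y))) h′))
        (loss≤ φ T*) }
    where module T* = Target T*

  record AtVertex (l : ℕ) : Set where
    field
      σ      : ℕ
      s≡     : s ≡ 2 + σ
      large  : σ * σ + 8 ≤ 8 * l
      large₃ : σ ≡ 3 → 25 ≤ 8 * l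

  at-vertex-centred : ∀ {R l} → Iso G (graph R) → Centred R → Target n s l → AtVertex l
  at-vertex-centred {R} φ c T* = record
    { σ = σ
    ; s≡ = trans (sym (others≡s φ)) (trans others≡ (trans (others≡1+kinks R) (cong suc kinks≡)))
    ; large = vertex-loss (size T*.X) (below T*.Y) (below≡ φ T*)
        (≤-trans (≤-reflexive (sym (+-assoc (2 * (below R * below R)) (σ * σ) 8))) loss≥) (loss≤ φ T*)
    ; large₃ = λ e → vertex-loss (size T*.X) (below T*.Y) (below≡ φ T*) (loss≥-3 e) (loss≤ φ T*) }
    where
    module T* = Target T*
    open Centred c

  -- Any branch forces `4 ≤ N`; and for `N = 4` every branch is a leaf.
  tiny : ∀ {R} → Iso G (graph R) → Small (below R) R → ¬ (5 ≤ below R) → R ≡ star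
  tiny {R} φ sm N≱5 with leaf-branches (below R) R (≤-pred (≰⇒> N≱5)) sm
  ... | inj₁ refl = contradiction (≤-trans 4≤n (≤-reflexive (n≡1+below φ))) λ { (s≤s ()) }
  ... | inj₂ 4≤N  = small-star R N≡4 (subst (λ N → Small N R) N≡4 sm)
    where
    N≡4 : below R ≡ 4
    N≡4 = ≤-antisym (≤-pred (≰⇒> N≱5)) 4≤N

  data Case (l : ℕ) : Set where
    on-edge   : AtEdge l → Case l
    on-vertex : AtVertex l → Case l
    on-star   : Iso G (graph star) → Case l

  analyse : ∀ {l} → Centroid G → Target n s l → Case l
  analyse (at-edge X Y φ h h′) T* = on-edge (at-edge-split φ h h′ T*)
  analyse (at-vertex R φ sm) T* with 5 ≤? below R
  ... | yes 5≤N = on-vertex (at-vertex-centred φ (centred R sm 5≤N) T*)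
  ... | no N≱5  with refl ← tiny φ sm N≱5 = on-star φ

-- Optimal trees

shape-C : ∀ {A : Set} {G : Graph A} {X Y n} a b i j → X ∼ ext i (comb a •) → Y ∼ ext j (comb b •) →
          Iso G (graph (X ▸ Y)) → n ≡ size X + size Y → IsC G n a b
shape-C a b i j p q φ e = isC _ a b (j + i)
  (trans e (trans (cong₂ _+_ (trans (∼-size p) (trans (size-ext i _) (cong (i +_) (size-comb a •))))
                             (trans (∼-size q) (trans (size-ext j _) (cong (j +_) (size-comb b •)))))
    (solve (a ∷ b ∷ i ∷ j ∷ []))))
  (iso-trans φ (iso-trans (∼⇒iso (▸-cong p q)) (spine-iso i a • j b)))

shape-F : ∀ {A : Set} {G : Graph A} {X Y n} a b i j → X ∼ ext i (comb a claw) → Y ∼ ext j (comb b •) →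
          Iso G (graph (X ▸ Y)) → n ≡ size X + size Y → IsF G n a b
shape-F a b i j p q φ e = isF _ a b (j + i)
  (trans e (trans (cong₂ _+_ (trans (∼-size p) (trans (size-ext i _) (cong (i +_) (size-comb a claw))))
                             (trans (∼-size q) (trans (size-ext j _) (cong (j +_) (size-comb b •)))))
    (solve (a ∷ b ∷ i ∷ j ∷ []))))
  (iso-trans φ (iso-trans (∼⇒iso (▸-cong p q)) (spine-iso i a claw j b)))

even-kinks : ∀ R k → kinks R ≡ 2 * k → k * k ≤ loss R
even-kinks R k e = even-loss k (loss R) (subst (λ p → p * p ≤ 4 * loss R) e (kinks²≤4loss R))

odd-kinks : ∀ R k → kinks R ≡ 2 * k + 3 → k * k + 3 * k + 3 ≤ loss R
odd-kinks R k e = odd-loss k (loss R) (subst (λ p → p * p ≤ 4 * loss R) e (kinks²≤4loss R))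

tight-shapes : ∀ X Y l → loss X + loss Y ≤ l → 8 * l ≤ (kinks X + kinks Y) * (kinks X + kinks Y) + 7 → Shape X × Shape Y
tight-shapes X Y l h k =
  tight⇒shape X (tight (kinks X) (kinks Y) (loss X) (loss Y) bound (kinks²≤4loss Y)) ,
  tight⇒shape Y (tight (kinks Y) (kinks X) (loss Y) (loss X)
    (subst₂ (λ m p → 8 * m ≤ p * p + 7) (+-comm (loss X) _) (+-comm (kinks X) _) bound) (kinks²≤4loss X))
  where
  bound : 8 * (loss X + loss Y) ≤ (kinks X + kinks Y) * (kinks X + kinks Y) + 7
  bound = ≤-trans (scale 8 h) k

module _ {A : Set} {G : Graph A} {X Y : Rooted} {n : ℕ} (φ : Iso G (graph (X ▸ Y))) (n≡ : n ≡ size X + size Y) where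

  private
    flipped : Iso G (graph (Y ▸ X))
    flipped = iso-trans φ (swap-▸ X Y)
    n≡′ : n ≡ size Y + size X
    n≡′ = trans n≡ (+-comm (size X) _)

  classify-C : ∀ a b → Near a b → kinks X + kinks Y ≡ 2 * (a + b) → loss X + loss Y ≤ a * a + b * b →
               Shape X → Shape Y → IsC G n a b
  classify-C a b near e h (even k i p eX) (even l j q eY)
    with even-unique k l near
      (*-cancelˡ-≡ (k + l) (a + b) 2 (trans (*-distribˡ-+ 2 k l) (trans (sym (cong₂ _+_ eX eY)) e)))
      (≤-trans (even-kinks X k eX ⊕ even-kinks Y l eY) h)
  ... | inj₁ (refl , refl) = shape-C a b j i q p flipped n≡′
  ... | inj₂ (refl , refl) = shape-C a b i j p q φ n≡
  classify-C a b near e h (odd k i p eX) (odd l j q eY) = contradiction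
    (≤-trans (odd-kinks X k eX ⊕ odd-kinks Y l eY) h)
    (odd-odd-loss k l a b
      (*-cancelˡ-≡ (k + l + 3) (a + b) 2 (deduce-≡ (trans (sym (cong₂ _+_ eX eY)) e) (solve (k ∷ l ∷ a ∷ b ∷ []))))
      (near-square near))
  classify-C a b near e h (odd k i p eX) (even l j q eY) = ⊥-elim (odd≢even (1 + k + l) (a + b)
    (deduce-≡ (trans (sym (cong₂ _+_ eX eY)) e) (solve (k ∷ l ∷ a ∷ b ∷ []))))
  classify-C a b near e h (even k i p eX) (odd l j q eY) = ⊥-elim (odd≢even (1 + k + l) (a + b)
    (deduce-≡ (trans (sym (cong₂ _+_ eX eY)) e) (solve (k ∷ l ∷ a ∷ b ∷ []))))

  -- Uniqueness of the parameters is an argument, since `a = b = 0`, the case of five vertices of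
  -- degree other than two, does not satisfy `Next`.
  classify-F : ∀ a b → kinks X + kinks Y ≡ 2 * (a + b) + 3 → loss X + loss Y ≤ a * a + 3 * a + 3 + b * b →
               (∀ k l → k + l ≡ a + b → k * k + 3 * k + 3 + l * l ≤ a * a + 3 * a + 3 + b * b → k ≡ a × l ≡ b) →
               Shape X → Shape Y → IsF G n a b
  classify-F a b e h unique (odd k i p eX) (even l j q eY)
    with refl , refl ← unique k l
      (*-cancelˡ-≡ (k + l) (a + b) 2 (deduce-≡ (trans (sym (cong₂ _+_ eX eY)) e) (solve (k ∷ l ∷ a ∷ b ∷ []))))
      (≤-trans (odd-kinks X k eX ⊕ even-kinks Y l eY) h) = shape-F a b i j p q φ n≡
  classify-F a b e h unique (even k i p eX) (odd l j q eY)
    with refl , refl ← unique l k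
      (*-cancelˡ-≡ (l + k) (a + b) 2 (deduce-≡ (trans (sym (cong₂ _+_ eX eY)) e) (solve (k ∷ l ∷ a ∷ b ∷ []))))
      (≤-trans (≤-trans (≤-reflexive (+-comm (l * l + 3 * l + 3) (k * k))) (even-kinks X k eX ⊕ odd-kinks Y l eY)) h) =
    shape-F a b j i q p flipped n≡′
  classify-F a b e h unique (even k i p eX) (even l j q eY) = ⊥-elim (odd≢even (1 + a + b) (k + l)
    (deduce-≡ (sym (trans (sym (cong₂ _+_ eX eY)) e)) (solve (k ∷ l ∷ a ∷ b ∷ []))))
  classify-F a b e h unique (odd k i p eX) (odd l j q eY) = ⊥-elim (odd≢even (1 + a + b) (3 + k + l)
    (deduce-≡ (sym (trans (sym (cong₂ _+_ eX eY)) e)) (solve (k ∷ l ∷ a ∷ b ∷ []))))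

even-target : ∀ {n t s} a b → Near a b → n ≡ t + s → s ≡ 2 + 2 * (a + b) → Target n s (a * a + b * b)
even-target {t = t} a b near refl refl =
  target t (comb b •) (comb a •) (size-comb b •) (size-comb a •) (sizes₁ near) (sizes₂ near) (solve (a ∷ b ∷ t ∷ []))
    (trans (cong₂ (λ p q → suc p + suc q) (kinks-comb b •) (kinks-comb a •)) (solve (a ∷ b ∷ [])))
    (trans (cong₂ _+_ (loss-comb-• b) (loss-comb-• a)) (+-comm (b * b) (a * a)))
  where
  sizes₁ : ∀ {a b} → Near a b → 2 * b + 1 ≤ 2 * a + 1 + t
  sizes₁ {a}     (inj₁ refl) = m≤m+n (2 * a + 1) t
  sizes₁ {_} {b} (inj₂ refl) = deduce (2 + t) (z≤n {0}) (solve (b ∷ t ∷ []))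
  sizes₂ : ∀ {a b} → Near a b → 2 * a + 1 ≤ 2 + (2 * b + 1 + t)
  sizes₂ {a}     (inj₁ refl) = deduce (2 + t) (z≤n {0}) (solve (a ∷ t ∷ []))
  sizes₂ {_} {b} (inj₂ refl) = deduce t (z≤n {0}) (solve (b ∷ t ∷ []))

odd-target : ∀ {n t s} a b → Next a b → n ≡ t + s → s ≡ 5 + 2 * (a + b) → Target n s (a * a + 3 * a + 3 + b * b)
odd-target {t = t} a b (inj₁ refl) refl refl =
  target t (comb b •) (comb a claw) (size-comb b •) (size-comb a claw)
    (deduce (1 + t) (z≤n {0}) (solve (a ∷ t ∷ []))) (deduce (1 + t) (z≤n {0}) (solve (a ∷ t ∷ [])))
    (solve (a ∷ t ∷ []))
    (trans (cong₂ (λ p q → suc p + suc q) (kinks-comb b •) (kinks-comb a claw)) (solve (a ∷ [])))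
    (trans (cong₂ _+_ (loss-comb-• b) (loss-comb-claw a)) (+-comm (b * b) (a * a + 3 * a + 3)))
odd-target {t = t} a b (inj₂ refl) refl refl =
  target t (comb a claw) (comb b •) (size-comb a claw) (size-comb b •)
    (deduce (1 + t) (z≤n {0}) (solve (a ∷ t ∷ []))) (deduce (1 + t) (z≤n {0}) (solve (a ∷ t ∷ [])))
    (solve (a ∷ t ∷ []))
    (trans (cong₂ (λ p q → suc p + suc q) (kinks-comb a claw) (kinks-comb b •)) (solve (a ∷ [])))
    (cong₂ _+_ (loss-comb-claw a) (loss-comb-• b))

-- The sizes 1 and 4 of a leaf and `claw` differ by three, so a vertex of degree two is required to
-- balance them.
claw-target : ∀ {n} t → n ≡ suc t + 5 → Target n 5 3
claw-target t refl = target (suc t) • claw refl refl (s≤s z≤n) (s≤s (s≤s (s≤s (s≤s z≤n)))) (solve (t ∷ [])) refl refl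

m+8≰m+k : ∀ {k} m → k < 8 → ¬ (m + 8 ≤ m + k)
m+8≰m+k m k<8 h = <⇒≱ k<8 (+-cancelˡ-≤ m 8 _ h)

module _ {n t s} (T : Tree n) (T∈ : T ∈ ℰ n t) (minimal : ∀ T′ → T′ ∈ ℰ n t → Mo T ≤ Mo T′)
         (n≡ : n ≡ t + s) (4≤n : 4 ≤ n) (centre : Centroid (Tree.graph T)) where

  open Optimal T T∈ minimal n≡ 4≤n

  even-optimum : ∀ a b → Near a b → s ≡ 2 + 2 * (a + b) → IsC G n a b
  even-optimum a b near s≡ with analyse centre (even-target a b near n≡ s≡)
  ... | on-star φ = ⊥-elim (odd≢even 2 (1 + (a + b)) (deduce-≡ (trans (others≡s φ) s≡) (solve (a ∷ b ∷ []))))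
  ... | on-vertex v = contradiction
    (≤-trans large (≤-trans (near-square near) (≤-reflexive (cong (λ k → k * k + 4) (sym σ≡)))))
    (m+8≰m+k (σ * σ) (m≤m+n 5 3))
    where
    open AtVertex v renaming (s≡ to s≡′)
    σ≡ : σ ≡ 2 * (a + b)
    σ≡ = +-cancelˡ-≡ 2 σ _ (trans (sym s≡′) s≡)
  ... | on-edge e = classify-C split size≡ a b near kinks≡′ loss≤l (proj₁ shapes) (proj₂ shapes)
    where
    open AtEdge e
    kinks≡′ : kinks X + kinks Y ≡ 2 * (a + b)
    kinks≡′ = deduce-≡ (trans kinks≡ s≡) (lemma (kinks X) (kinks Y))
      where
      lemma : ∀ x y → x + y + (2 + 2 * (a + b)) ≡ 2 * (a + b) + (suc x + suc y)
      lemma x y = solve (x ∷ y ∷ a ∷ b ∷ [])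
    shapes : Shape X × Shape Y
    shapes = tight-shapes X Y (a * a + b * b) loss≤l
      (subst (λ k → 8 * (a * a + b * b) ≤ k * k + 7) (sym kinks≡′)
        (≤-trans (near-square near) (+-monoʳ-≤ (2 * (a + b) * (2 * (a + b))) (m≤m+n 4 3))))

  odd-optimum : ∀ a b → Next a b → s ≡ 5 + 2 * (a + b) → IsF G n a b
  odd-optimum a b next s≡ with analyse centre (odd-target a b next n≡ s≡)
  ... | on-star φ = contradiction (+-cancelˡ-≡ 5 0 _ (trans (others≡s φ) s≡)) (positive next)
    where
    positive : ∀ {a b} → Next a b → 0 ≢ 2 * (a + b)
    positive {a} (inj₁ refl) e with () ← trans (*-cancelˡ-≡ 0 (a + (1 + a)) 2 e) (+-suc a a)
    positive {a} (inj₂ refl) e with () ← trans (*-cancelˡ-≡ 0 (a + (2 + a)) 2 e) (+-suc a (suc a))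
  ... | on-vertex v = contradiction
    (≤-trans large (≤-trans (next-square next) (≤-reflexive (cong (λ k → k * k + 7) (sym σ≡)))))
    (m+8≰m+k (σ * σ) ≤-refl)
    where
    open AtVertex v renaming (s≡ to s≡′)
    σ≡ : σ ≡ 2 * (a + b) + 3
    σ≡ = +-cancelˡ-≡ 2 σ _ (trans (sym s≡′) (trans s≡ (cong (2 +_) (+-comm 3 (2 * (a + b))))))
  ... | on-edge e = classify-F split size≡ a b kinks≡′ loss≤l (λ k l → odd-unique k l next) (proj₁ shapes) (proj₂ shapes)
    where
    open AtEdge e
    kinks≡′ : kinks X + kinks Y ≡ 2 * (a + b) + 3
    kinks≡′ = deduce-≡ (trans kinks≡ s≡) (lemma (kinks X) (kinks Y))
      where
      lemma : ∀ x y → x + y + (5 + 2 * (a + b)) ≡ 2 * (a + b) + 3 + (suc x + suc y)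
      lemma x y = solve (x ∷ y ∷ a ∷ b ∷ [])
    shapes : Shape X × Shape Y
    shapes = tight-shapes X Y (a * a + 3 * a + 3 + b * b) loss≤l
      (subst (λ k → 8 * (a * a + 3 * a + 3 + b * b) ≤ k * k + 7) (sym kinks≡′) (next-square next))

-- Five vertices of degree other than two

three-kinks : ∀ {p q} → p ≢ 1 → q ≢ 1 → p + q ≡ 3 → (p ≡ 0 × q ≡ 3) ⊎ (p ≡ 3 × q ≡ 0)
three-kinks {0} {3} _ _ _ = inj₁ (refl , refl)
three-kinks {1} p≢1 _ _   = contradiction refl p≢1
three-kinks {2} {1} _ q≢1 _ = contradiction refl q≢1
three-kinks {3} {0} _ _ _ = inj₂ (refl , refl)

-- The value `8 · 3 = 24` exceeds `9 + 7`, which puts `tight` out of reach; but here `k` is at least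
-- three and uses up the whole bound.
claw-tight : ∀ l k → 9 ≤ 4 * k → l + k ≤ 3 → 4 * l ≤ 3 × 4 * k ≤ 12
claw-tight l k h g = lemma , ≤-trans (scale 4 (m≤n+m k l)) (scale 4 g)
  where
  lemma : 4 * l ≤ 3
  lemma = deduce 0 (h ⊕ scale 4 g) (solve (l ∷ k ∷ []))

module _ {n t s} (T : Tree n) (T∈ : T ∈ ℰ n t) (minimal : ∀ T′ → T′ ∈ ℰ n t → Mo T ≤ Mo T′)
         (n≡ : n ≡ t + s) (4≤n : 4 ≤ n) (s≡ : s ≡ 5) where

  open Optimal T T∈ minimal n≡ 4≤n

  star-F : Iso G (graph star) → IsF G n 0 0
  star-F φ = isF n 0 0 0 (n≡1+below φ) (iso-trans φ (swap-▸ • claw))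

  -- For `t = 0` there is no balanced competitor, and the tree on five vertices is found directly:
  -- at a balanced edge its parts have at most two and three vertices, too few for three kinks. The
  -- equation `t ≡ t′` permits the case distinction on the module parameter.
  five-optimum : Centroid G → ∀ {t′} → t ≡ t′ → IsF G n 0 0
  five-optimum (at-vertex R φ sm) {0} t≡0 = star-F
    (subst (λ R → Iso G (graph R)) (tiny φ sm λ 5≤N → <⇒≱ (s≤s ≤-refl)
      (≤-trans (s≤s 5≤N) (≤-reflexive (trans (sym (n≡1+below φ)) n≡5)))) φ)
    where
    n≡5 : n ≡ 5
    n≡5 = trans n≡ (cong₂ _+_ t≡0 s≡)
  five-optimum (at-edge X Y φ h h′) {0} t≡0 =
    contradiction kinks≡3 (≢3 (below-two (≤-trans (kinks<size X) X≤2) (kinks≢1 X)))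
    where
    n≡5 : size X + size Y ≡ 5
    n≡5 = trans (sym (trans (n≡1+below φ) (below-▸ X Y))) (trans n≡ (cong₂ _+_ t≡0 s≡))
    kinks≡3 : kinks X + kinks Y ≡ 3
    kinks≡3 = suc-injective (suc-injective (trans (cong suc (sym (+-suc (kinks X) (kinks Y))))
      (trans (sym (cong₂ _+_ (others≡1+kinks X) (others≡1+kinks Y))) (trans (others≡s φ) s≡))))
    half : ∀ x y → x + y ≡ 5 → x ≤ y → 2 * x ≤ 2 * 2 + 1
    half x y e k = deduce 0 (k ⊕ ≤-reflexive e) (solve (x ∷ y ∷ []))
    half′ : ∀ x y → x + y ≡ 5 → y ≤ 2 + x → 2 * y ≤ 2 * 3 + 1
    half′ x y e k = deduce 0 (k ⊕ ≤-reflexive e) (solve (x ∷ y ∷ []))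
    X≤2 : size X ≤ 2
    X≤2 = double-≤ (half (size X) (size Y) n≡5 h)
    Y≤3 : size Y ≤ 3
    Y≤3 = double-≤ (half′ (size X) (size Y) n≡5 h′)
    ≢3 : kinks X ≡ 0 → kinks X + kinks Y ≢ 3
    ≢3 e e′ = <⇒≢ (≤-trans (kinks<size Y) Y≤3) (trans (cong (_+ kinks Y) (sym e)) e′)
  five-optimum centre {suc t′} t≡ with analyse centre
    (subst (λ k → Target n k 3) (sym s≡) (claw-target t′ (trans n≡ (cong₂ _+_ t≡ s≡))))
  ... | on-star φ   = star-F φ
  ... | on-vertex v = contradiction (AtVertex.large₃ v (+-cancelˡ-≡ 2 _ 3 (trans (sym (AtVertex.s≡ v)) s≡)))
    (<⇒≱ ≤-refl)
  ... | on-edge e   = classify-F split size≡ 0 0 kinks≡3 loss≤l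
    (λ k l e _ → m+n≡0⇒m≡0 k e , m+n≡0⇒n≡0 k e) (proj₁ shapes) (proj₂ shapes)
    where
    open AtEdge e
    kinks≡3 : kinks X + kinks Y ≡ 3
    kinks≡3 = suc-injective (suc-injective (trans (cong suc (sym (+-suc (kinks X) (kinks Y)))) (trans kinks≡ s≡)))
    shapes : Shape X × Shape Y
    shapes with three-kinks (kinks≢1 X) (kinks≢1 Y) kinks≡3
    ... | inj₁ (p , q) =
      let hX , hY = claw-tight (loss X) (loss Y) (subst (λ k → k * k ≤ 4 * loss Y) q (kinks²≤4loss Y)) loss≤l
      in tight⇒shape X (subst (λ k → 4 * loss X ≤ k * k + 3) (sym p) hX) ,
         tight⇒shape Y (subst (λ k → 4 * loss Y ≤ k * k + 3) (sym q) hY)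
    ... | inj₂ (p , q) =
      let hY , hX = claw-tight (loss Y) (loss X) (subst (λ k → k * k ≤ 4 * loss X) p (kinks²≤4loss X))
                      (≤-trans (≤-reflexive (+-comm (loss Y) _)) loss≤l)
      in tight⇒shape X (subst (λ k → 4 * loss X ≤ k * k + 3) (sym p) hX) ,
         tight⇒shape Y (subst (λ k → 4 * loss Y ≤ k * k + 3) (sym q) hY)

-- Rounded quarters and the three cases

quarter : ∀ j r → r < 4 → (r + j * 4) / 4 ≡ j
quarter j r r<4 = trans (+-distrib-/-∣ʳ r (divides j refl)) (cong₂ _+_ (m<n⇒m/n≡0 r<4) (m*n/n≡m j 4))

halves : ∀ m → ∃ λ j → m ≡ 2 * j ⊎ m ≡ 1 + 2 * j
halves zero    = 0 , inj₁ refl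
halves (suc m) with halves m
... | j , inj₁ refl = j , inj₂ refl
... | j , inj₂ refl = suc j , inj₁ (cong suc (sym (+-suc j (j + 0))))

even-quarters : ∀ j → ∃ λ a → ∃ λ b → ⌈ 2 * j /4⌉ ≡ a × ⌊ 2 * j /4⌋ ≡ b × Near a b × j ≡ a + b
even-quarters j with halves j
... | i , inj₁ refl = i , i ,
  trans (cong (_/ 4) eq) (quarter i 3 ≤-refl) ,
  trans (cong (_/ 4) eq′) (quarter i 0 (s≤s z≤n)) , inj₁ refl , cong (i +_) (+-identityʳ i)
  where
  eq : 2 * (2 * i) + 3 ≡ 3 + i * 4
  eq = solve (i ∷ [])
  eq′ : 2 * (2 * i) ≡ 0 + i * 4
  eq′ = solve (i ∷ [])
... | i , inj₂ refl = suc i , i ,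
  trans (cong (_/ 4) eq) (quarter (suc i) 1 (s≤s (s≤s z≤n))) ,
  trans (cong (_/ 4) eq′) (quarter i 2 (s≤s (s≤s (s≤s z≤n)))) , inj₂ refl , cong suc (cong (i +_) (+-identityʳ i))
  where
  eq : 2 * (1 + 2 * i) + 3 ≡ 1 + suc i * 4
  eq = solve (i ∷ [])
  eq′ : 2 * (1 + 2 * i) ≡ 2 + i * 4
  eq′ = solve (i ∷ [])

-- Moving one unit from the half rounded up to the other half keeps the sum and turns `Near` into
-- `Next`.
odd-quarters : ∀ j → ∃ λ a → ∃ λ b →
               ⌈ 2 * suc j /4⌉ ∸ 1 ≡ a × ⌊ 2 * suc j /4⌋ + 1 ≡ b × Next a b × suc j ≡ a + b
odd-quarters j with even-quarters (suc j)
... | suc a , b , p , q , inj₁ refl , e =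
  a , suc (suc a) , cong (_∸ 1) p , trans (cong (_+ 1) q) (+-comm (suc a) 1) , inj₂ refl , trans e (sym (+-suc a (suc a)))
... | suc a , b , p , q , inj₂ refl , e =
  a , suc a , cong (_∸ 1) p , trans (cong (_+ 1) q) (+-comm a 1) , inj₁ refl , trans e (sym (+-suc a a))

theorem4p2 : (n t : ℕ) → t + 4 ≤ n →
    (T : Tree n) → T ∈ ℰ n t →
    (∀ T′ → T′ ∈ ℰ n t → Mo T ≤ Mo T′) →
    (n ∸ t ≡ 5 → IsF (Tree.graph T) n 0 0) ×
    (¬ (2 ∣ n ∸ t) → 7 ≤ n ∸ t →
    IsF (Tree.graph T) n (⌈ n ∸ t ∸ 5 /4⌉ ∸ 1) (⌊ n ∸ t ∸ 5 /4⌋ + 1)) ×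
    (2 ∣ n ∸ t →
    IsC (Tree.graph T) n ⌈ n ∸ t ∸ 2 /4⌉ ⌊ n ∸ t ∸ 2 /4⌋)
theorem4p2 zero t h T T∈ minimal = contradiction (m+n≤o⇒n≤o t h) λ ()
theorem4p2 n@(suc _) t h T T∈ minimal = five , odds , evens
  where
  G = Tree.graph T
  s = n ∸ t
  n≡ : n ≡ t + s
  n≡ = sym (m+[n∸m]≡n (m+n≤o⇒m≤o t h))
  4≤n : 4 ≤ n
  4≤n = m+n≤o⇒n≤o t h
  4≤s : 4 ≤ s
  4≤s = m+n≤o⇒m≤o∸n 4 (≤-trans (≤-reflexive (+-comm 4 t)) h)
  centre : Centroid G
  centre = let R , φ = tree⇒rooted G (Tree.connected T) (Tree.acyclic T) in centroid R φ

  five : s ≡ 5 → IsF G n 0 0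
  five s≡ = five-optimum T T∈ minimal n≡ 4≤n s≡ centre refl

  odds : ¬ (2 ∣ s) → 7 ≤ s → IsF G n (⌈ s ∸ 5 /4⌉ ∸ 1) (⌊ s ∸ 5 /4⌋ + 1)
  odds odd-s 7≤s with halves (s ∸ 5) | m+[n∸m]≡n (≤-trans (m≤n+m 5 2) 7≤s)
  ... | j     , inj₂ e | e′ = contradiction
    (divides (3 + j) (trans (sym e′) (trans (cong (5 +_) e) (solve (j ∷ []))))) odd-s
  ... | zero  , inj₁ e | e′ = contradiction
    (≤-trans 7≤s (≤-reflexive (trans (sym e′) (cong (5 +_) e)))) (<⇒≱ (n≤1+n 6))
  ... | suc j , inj₁ e | e′ =
    let a , b , p , q , next , f = odd-quarters j
    in subst₂ (IsF G n)
      (sym (trans (cong (λ k → ⌈ k /4⌉ ∸ 1) e) p)) (sym (trans (cong (λ k → ⌊ k /4⌋ + 1) e) q))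
      (odd-optimum T T∈ minimal n≡ 4≤n centre a b next (trans (sym e′) (cong (5 +_) (trans e (cong (2 *_) f)))))

  evens : 2 ∣ s → IsC G n ⌈ s ∸ 2 /4⌉ ⌊ s ∸ 2 /4⌋
  evens (divides zero    e) = contradiction (≤-trans 4≤s (≤-reflexive e)) λ ()
  evens (divides (suc j) e) =
    let a , b , p , q , near , f = even-quarters j
        e′ = trans (cong (_∸ 2) e) (*-comm j 2)
    in subst₂ (IsC G n) (sym (trans (cong ⌈_/4⌉ e′) p)) (sym (trans (cong ⌊_/4⌋ e′) q))
      (even-optimum T T∈ minimal n≡ 4≤n centre a b near (trans e (cong (2 +_) (trans (*-comm j 2) (cong (2 *_) f)))))
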